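{- Let $p$ be a prime, $q=p^l$, $n\ge 2$ and $k\ge1$ integers, and $d=\gcd(k,q-1)$. If $q>d^2$, $p\nmid k$, and $p\in\{2,3\}$, then for $n>\max\left\{3,\frac{4\ln(k-1)}{\ln q}\right\}$ every matrix in $M_n(\mathbb F_q)$ is of the form $A^k+B^k$ with $A,B\in M_n(\mathbb F_q)$.
   Context: Convention: $\ln(0)=-\infty$ (relevant when $k=1$). -}

module Defs where

open import Level using (Level; _⊔_)
open import Algebra.Bundles using (CommutativeRing)
open import Data.Nat using (ℕ; zero; suc)
open import Data.Fin using (Fin; zero; suc)
open import Data.Product using (∃)
open import Relation.Binary.PropositionalEquality using (_≡_)
open import Relation.Nullary using (¬_)

record IsFiniteField {c ℓ : Level} (F : CommutativeRing c ℓ) (q : ℕ) : Set (c ⊔ ℓ) where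
  open CommutativeRing F
  field
    nontrivial : ¬ (0# ≈ 1#)
    inverse    : ∀ x → ¬ (x ≈ 0#) → ∃ λ y → (x * y) ≈ 1#
    enum       : Fin q → Carrier
    enum-inj   : ∀ i j → enum i ≈ enum j → i ≡ j
    enum-surj  : ∀ x → ∃ λ i → enum i ≈ x

module Matrices {c ℓ : Level} (R : CommutativeRing c ℓ) where
  open CommutativeRing R using (Carrier; _≈_; _+_; _*_; 0#; 1#)

  Mat : ℕ → Set c
  Mat n = Fin n → Fin n → Carrier

  ∑ : (n : ℕ) → (Fin n → Carrier) → Carrier
  ∑ zero    f = 0#
  ∑ (suc n) f = f zero + ∑ n (λ i → f (suc i))

  _≈M_ : {n : ℕ} → Mat n → Mat n → Set ℓ
  A ≈M B = ∀ i j → A i j ≈ B i j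

  _+M_ : {n : ℕ} → Mat n → Mat n → Mat n
  (A +M B) i j = A i j + B i j

  _*M_ : {n : ℕ} → Mat n → Mat n → Mat n
  _*M_ {n} A B i j = ∑ n (λ t → A i t * B t j)

  idM : {n : ℕ} → Mat n
  idM zero    zero    = 1#
  idM zero    (suc j) = 0#
  idM (suc i) zero    = 0#
  idM (suc i) (suc j) = idM i j

  _^M_ : {n : ℕ} → Mat n → ℕ → Mat n
  A ^M zero  = idM
  A ^M suc k = A *M (A ^M k)

{-# OPTIONS --safe #-}
module Submission where

-- Write H for the set of nonzero k-th powers of a field with q elements.
--
-- Scalar matrices.  M_n(F_q) contains a field K with q^n elements, so it is enough that
-- every c in K is a sum of two k-th powers.  This replaces Weil's bound: count the points
-- of the grid (H ∪ 0)² on each line y = m x + b.  The second moment of these counts over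
-- all lines is known exactly, and if c were not a sum then the lines with m in −H and
-- b in cH would all be empty; Cauchy–Schwarz on the remaining lines, with the lines m = 0
-- and b = 0 treated exactly, contradicts (k − 1)^4 < q^n.
-- K is found inside the ring of polynomials acting by shifts on sequences of period
-- q^n − 1: there y^(q^n) = y, so idempotents y^(q^n − 1) cut the ring down to a field, in
-- which the class x of X still has n distinct conjugates.
--
-- Nonscalar matrices.  Such a matrix is similar to one with any prescribed diagonal of the
-- right trace.  Splitting it into a lower and an upper triangular matrix, each summand is a
-- k-th power as soon as its diagonal entries are k-th powers, all but the first nonzero
-- (here p ∤ k is used).  So the trace has to be a sum of 2n elements of H, up to two of
-- them replaced by 0.  Since gcd(k, q − 1)² < q gives |H|² ≥ q − 1, Glibichuk's argument
-- shows that every element is a sum of at most 8 ≤ 2n elements of H: the same second moment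
-- yields a slope m ≠ 0 with |H₀ ± m H₀| > q/2, where H₀ = H ∪ 0, and m is a quotient of
-- two sums of two elements of H₀.  Finally 1 + 1 = 0 or 1 + 1 + 1 = 0 allows to pad the sum
-- to the required length.

-- The counting must be nearly lossless. Put j = k - 1 and h = |H| in the large field: the fibres of
-- x^k and the hypothesis on q^n give only h ≥ j^4/(j + 1), while the contradiction needs h to
-- exceed about j^2 (j - 1) = (j^4 - j^2)/(j + 1). This is why some lines are evaluated exactly
-- instead of being estimated. No irreducible polynomial of degree n is exhibited. A field with
-- y^(q^n) = y and an element having n distinct conjugates already has exactly q^n elements:
-- independence of 1, x, ..., x^(n-1) bounds the order below, the roots of Y^(q^n) - Y bound it
-- above. A triangular matrix with two zeros on its diagonal need not have a k-th root, for it may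
-- contain a nonzero nilpotent block. So the trace needs an exact number of nonzero terms, with 0
-- allowed only in the two corners. Adding p ones lengthens a sum by p and keeps its value; as p ≤
-- 3, this brings the shortfall down to at most 2, precisely the number of places open to 0.

open import Defs
open import Level using (_⊔_) renaming (suc to lsuc)
open import Algebra.Bundles using (CommutativeRing; CommutativeMonoid; RawRing)
open import Algebra.Solver.Ring.AlmostCommutativeRing using (_-Raw-AlmostCommutative⟶_; fromCommutativeRing; Induced-equivalence)
open import Data.Empty using (⊥; ⊥-elim)
open import Data.Fin using (Fin; zero; suc; toℕ; fromℕ; fromℕ<; inject₁; inject≤; finToFun; funToFin; combine)
open import Data.Fin.Permutation using (Permutation; permutation)
open import Data.Fin.Properties as Fin using (any?; all?; toℕ-fromℕ<; toℕ-inject₁; toℕ-fromℕ; toℕ<n; toℕ-injective; inject≤-injective; finToFun-funToFin; funToFin-finToFin)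
open import Data.List using (List; []; _∷_; _++_; map; length; replicate; tabulate)
open import Data.List.Properties using (length-++; length-map; length-replicate; length-tabulate)
open import Data.List.Relation.Unary.All using (All; []; _∷_)
open import Data.List.Relation.Unary.All.Properties using (++⁻ʳ; map⁻; tabulate⁻)
open import Data.Maybe using (just; nothing)
open import Data.Nat as ℕ using (ℕ; zero; suc; _≤_; _<_; z≤n; s≤s; _%_; _/_)
open import Data.Nat.DivMod using (m%n<n; m≡m%n+[m/n]*n; m<n⇒m%n≡m; n%n≡0; [m+n]%n≡m%n)
open import Data.Nat.Divisibility using (_∣_; m%n≡0⇒n∣m)
open import Data.Nat.GCD using (gcd; gcd-GCD; gcd[m,n]≡0⇒m≡0; module Bézout)
open import Data.Nat.Primality using (Prime)
open import Data.Nat.Properties as ℕₚ using ()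
open import Data.Nat.Solver using (module +-*-Solver)
open import Data.Product using (_×_; _,_; proj₁; proj₂; ∃; ∃₂)
open import Data.Sum using (_⊎_; inj₁; inj₂; [_,_])
open import Function using (_∘_; id)
open import Relation.Binary.Definitions using (WeaklyDecidable; tri<; tri≈; tri>)
open import Relation.Binary.PropositionalEquality as ≡ using (_≡_; _≢_)
open import Relation.Nullary using (¬_; Dec; yes; no; contradiction)
open import Relation.Nullary.Decidable using (map′; ¬?; _×-dec_; decidable-stable)
import Algebra.Properties.CommutativeMonoid.Sum as MonoidSum
import Algebra.Properties.CommutativeSemiring.Exp as Exp
import Algebra.Properties.Ring
import Algebra.Properties.Semiring.Sum as SemiringSum

-- Coefficients a − b of the ring solver, kept in lowest terms so that equal
-- coefficients are syntactically equal.
reduce : ℕ × ℕ → ℕ × ℕ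
reduce (suc a , suc b) = reduce (a , b)
reduce (a , b) = (a , b)

differences : RawRing _ _
differences = record
  { Carrier = ℕ × ℕ
  ; _≈_ = _≡_
  ; _+_ = λ (a , b) (c , d) → reduce (a ℕ.+ c , b ℕ.+ d)
  ; _*_ = λ (a , b) (c , d) → reduce (a ℕ.* c ℕ.+ b ℕ.* d , a ℕ.* d ℕ.+ b ℕ.* c)
  ; -_ = λ (a , b) → (b , a)
  ; 0# = (0 , 0)
  ; 1# = (1 , 0)
  }

module Solver {c ℓ} (R : CommutativeRing c ℓ) where
  open CommutativeRing R
  open import Algebra.Properties.Semiring.Mult semiring using (×-homo-+; ×1-homo-*) renaming (_×_ to _·_)
  open import Algebra.Properties.Ring ring using (-‿distribˡ-*; -‿distribʳ-*; -0#≈0#; -‿involutive; -‿+-comm)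
  open import Algebra.Properties.CommutativeSemigroup +-commutativeSemigroup using (interchange)
  open import Relation.Binary.Reasoning.Setoid setoid

  private
    ⟪_⟫ : ℕ × ℕ → Carrier
    ⟪ (a , b) ⟫ = a · 1# + - (b · 1#)

    reduce-sound : ∀ x → ⟪ reduce x ⟫ ≈ ⟪ x ⟫
    reduce-sound (zero , b) = refl
    reduce-sound (suc a , zero) = refl
    reduce-sound (suc a , suc b) = begin
      ⟪ reduce (a , b) ⟫ ≈⟨ reduce-sound (a , b) ⟩
      a · 1# + - (b · 1#) ≈⟨ +-identityˡ _ ⟨
      0# + (a · 1# + - (b · 1#)) ≈⟨ +-congʳ (-‿inverseʳ 1#) ⟨
      1# + - 1# + (a · 1# + - (b · 1#)) ≈⟨ interchange _ _ _ _ ⟩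
      1# + a · 1# + (- 1# + - (b · 1#)) ≈⟨ +-congˡ (-‿+-comm _ _) ⟩
      1# + a · 1# + - (1# + b · 1#) ∎

    ⟪⟫-+ : ∀ a b c d → ⟪ (a ℕ.+ c , b ℕ.+ d) ⟫ ≈ ⟪ (a , b) ⟫ + ⟪ (c , d) ⟫
    ⟪⟫-+ a b c d = begin
      (a ℕ.+ c) · 1# + - ((b ℕ.+ d) · 1#) ≈⟨ +-cong (×-homo-+ 1# a c) (-‿cong (×-homo-+ 1# b d)) ⟩
      a · 1# + c · 1# + - (b · 1# + d · 1#) ≈⟨ +-congˡ (-‿+-comm _ _) ⟨
      a · 1# + c · 1# + (- (b · 1#) + - (d · 1#)) ≈⟨ interchange _ _ _ _ ⟩
      ⟪ (a , b) ⟫ + ⟪ (c , d) ⟫ ∎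

    ⟪⟫-* : ∀ a b c d → ⟪ (a ℕ.* c ℕ.+ b ℕ.* d , a ℕ.* d ℕ.+ b ℕ.* c) ⟫ ≈ ⟪ (a , b) ⟫ * ⟪ (c , d) ⟫
    ⟪⟫-* a b c d = begin
      ⟪ (a ℕ.* c ℕ.+ b ℕ.* d , a ℕ.* d ℕ.+ b ℕ.* c) ⟫
        ≈⟨ +-cong (trans (×-homo-+ 1# (a ℕ.* c) _) (+-cong (×1-homo-* a c) (×1-homo-* b d)))
                  (-‿cong (trans (×-homo-+ 1# (a ℕ.* d) _) (+-cong (×1-homo-* a d) (×1-homo-* b c)))) ⟩
      A * C + B * D + - (A * D + B * C) ≈⟨ +-congˡ (-‿+-comm _ _) ⟨
      A * C + B * D + (- (A * D) + - (B * C))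
        ≈⟨ +-cong (+-congˡ (trans (sym (-‿involutive _)) (trans (-‿cong (-‿distribˡ-* _ _)) (-‿distribʳ-* _ _))))
                                                        (+-cong (-‿distribʳ-* _ _) (-‿distribˡ-* _ _)) ⟩
      A * C + - B * - D + (A * - D + - B * C) ≈⟨ +-congˡ (+-comm _ _) ⟩
      A * C + - B * - D + (- B * C + A * - D) ≈⟨ interchange _ _ _ _ ⟩
      A * C + - B * C + (- B * - D + A * - D) ≈⟨ +-cong (sym (distribʳ _ _ _)) (trans (+-comm _ _) (sym (distribʳ _ _ _))) ⟩
      (A + - B) * C + (A + - B) * - D ≈⟨ distribˡ _ _ _ ⟨
      ⟪ (a , b) ⟫ * ⟪ (c , d) ⟫ ∎
      where
      A = a · 1#
      B = b · 1#
      C = c · 1#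
      D = d · 1#

    -- Agrees with ⟪_⟫, but makes con (0 , 0) and con (1 , 0) denote 0# and 1# on the nose.
    value : ℕ × ℕ → Carrier
    value (0 , 0) = 0#
    value (1 , 0) = 1#
    value x = ⟪ x ⟫

    value-⟪⟫ : ∀ x → value x ≈ ⟪ x ⟫
    value-⟪⟫ (0 , 0) = sym (-‿inverseʳ 0#)
    value-⟪⟫ (1 , 0) = sym (trans (+-cong (+-identityʳ 1#) -0#≈0#) (+-identityʳ 1#))
    value-⟪⟫ (0 , suc b) = refl
    value-⟪⟫ (1 , suc b) = refl
    value-⟪⟫ (suc (suc a) , b) = refl

    value-reduce : ∀ x → value (reduce x) ≈ ⟪ x ⟫
    value-reduce x = trans (value-⟪⟫ (reduce x)) (reduce-sound x)

    morphism : differences -Raw-AlmostCommutative⟶ fromCommutativeRing R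
    morphism = record
      { ⟦_⟧ = value
      ; +-homo = λ x@(a , b) y@(c , d) → trans (value-reduce (a ℕ.+ c , b ℕ.+ d))
          (trans (⟪⟫-+ a b c d) (sym (+-cong (value-⟪⟫ x) (value-⟪⟫ y))))
      ; *-homo = λ x@(a , b) y@(c , d) → trans (value-reduce (a ℕ.* c ℕ.+ b ℕ.* d , a ℕ.* d ℕ.+ b ℕ.* c))
          (trans (⟪⟫-* a b c d) (sym (*-cong (value-⟪⟫ x) (value-⟪⟫ y))))
      ; -‿homo = λ x@(a , b) → trans (value-⟪⟫ (b , a)) (trans (trans (+-comm _ _)
          (trans (+-congˡ (sym (-‿involutive _))) (-‿+-comm _ _))) (-‿cong (sym (value-⟪⟫ x))))
      ; 0-homo = refl
      ; 1-homo = refl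
      }

    _≟′_ : WeaklyDecidable (Induced-equivalence morphism)
    (a , b) ≟′ (c , d) with a ℕ.≟ c | b ℕ.≟ d
    ... | yes ≡.refl | yes ≡.refl = just refl
    ... | _ | _ = nothing

  open import Algebra.Solver.Ring differences (fromCommutativeRing R) morphism _≟′_ public
    using (solve; _:+_; _:*_; _:-_; :-_; _:=_; con)

-- Counting in finite fields

module ℕΣ = SemiringSum ℕₚ.+-*-semiring

⟦_⟧ : ∀ {a} {P : Set a} → Dec P → ℕ
⟦ yes _ ⟧ = 1
⟦ no _ ⟧ = 0

⟦⟧-yes : ∀ {a} {P : Set a} (d : Dec P) → P → ⟦ d ⟧ ≡ 1
⟦⟧-yes (yes _) p = ≡.refl
⟦⟧-yes (no ¬p) p = contradiction p ¬p

⟦⟧-no : ∀ {a} {P : Set a} (d : Dec P) → ¬ P → ⟦ d ⟧ ≡ 0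
⟦⟧-no (yes p) ¬p = contradiction p ¬p
⟦⟧-no (no _) ¬p = ≡.refl

⟦⟧-⇔ : ∀ {a b} {P : Set a} {Q : Set b} (d : Dec P) (e : Dec Q) → (P → Q) → (Q → P) → ⟦ d ⟧ ≡ ⟦ e ⟧
⟦⟧-⇔ (yes p) e f g = ≡.sym (⟦⟧-yes e (f p))
⟦⟧-⇔ (no ¬p) e f g = ≡.sym (⟦⟧-no e (¬p ∘ g))

⟦⟧-idem : ∀ {a} {P : Set a} (d : Dec P) → ⟦ d ⟧ ℕ.* ⟦ d ⟧ ≡ ⟦ d ⟧
⟦⟧-idem (yes _) = ≡.refl
⟦⟧-idem (no _) = ≡.refl

⟦⟧*n≤n : ∀ {a} {P : Set a} (d : Dec P) n → ⟦ d ⟧ ℕ.* n ≤ n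
⟦⟧*n≤n (yes _) n = ℕₚ.≤-reflexive (ℕₚ.*-identityˡ n)
⟦⟧*n≤n (no _) n = z≤n

sum-mono : ∀ {n} {f g : Fin n → ℕ} → (∀ i → f i ≤ g i) → ℕΣ.sum f ≤ ℕΣ.sum g
sum-mono {zero} f≤g = z≤n
sum-mono {suc n} f≤g = ℕₚ.+-mono-≤ (f≤g zero) (sum-mono (f≤g ∘ suc))

module _ {a ℓ} (M : CommutativeMonoid a ℓ) where
  open CommutativeMonoid M
  open MonoidSum M using (sum; sum-cong-≋; sum-replicate-zero)

  sum-single : ∀ {n} (f : Fin n → Carrier) i → (∀ j → j ≢ i → f j ≈ ε) → sum f ≈ f i
  sum-single {suc n} f zero f≈ε =
    trans (∙-congˡ (trans (sum-cong-≋ {n} (λ j → f≈ε (suc j) λ ())) (sum-replicate-zero n))) (identityʳ _)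
  sum-single {suc n} f (suc i) f≈ε =
    trans (∙-cong (f≈ε zero λ ()) (sum-single (f ∘ suc) i λ j j≢i → f≈ε (suc j) (j≢i ∘ Fin.suc-injective))) (identityˡ _)

-- This turns a count into an injection, the form in which bounds on numbers of roots are applied.
select : ∀ {a n} {P : Fin n → Set a} (P? : ∀ i → Dec (P i)) →
         ∃ λ (f : Fin (ℕΣ.sum (λ i → ⟦ P? i ⟧)) → Fin n) → (∀ i → P (f i)) × (∀ i j → f i ≡ f j → i ≡ j)
select {n = zero} P? = (λ ()) , (λ ()) , λ ()
select {n = suc n} P? with P? zero | select (P? ∘ suc)
... | no _ | f , Pf , inj = suc ∘ f , Pf , λ i j → inj i j ∘ Fin.suc-injective
... | yes p | f , Pf , inj = f′ , Pf′ , inj′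
  where
  f′ : Fin _ → Fin (suc n)
  f′ zero = zero
  f′ (suc i) = suc (f i)
  Pf′ : ∀ i → _
  Pf′ zero = p
  Pf′ (suc i) = Pf i
  inj′ : ∀ i j → f′ i ≡ f′ j → i ≡ j
  inj′ zero zero _ = ≡.refl
  inj′ zero (suc j) ()
  inj′ (suc i) zero ()
  inj′ (suc i) (suc j) eq = ≡.cong suc (inj i j (Fin.suc-injective eq))

-- Cauchy-Schwarz over the natural numbers

module _ where
  open import Data.Nat using (_+_; _*_)
  open import Data.Nat.Solver using (module +-*-Solver)
  open +-*-Solver
  open ℕₚ.≤-Reasoning

  4xy≤[x+y]² : ∀ x y → 4 * (x * y) ≤ (x + y) * (x + y)
  4xy≤[x+y]² x y with ℕₚ.≤-total x y
  ... | inj₁ x≤y with ℕₚ.m≤n⇒∃[o]m+o≡n x≤y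
  ...   | e , ≡.refl = ℕₚ.≤-trans (ℕₚ.m≤m+n _ (e * e)) (ℕₚ.≤-reflexive
    (solve 2 (λ x e → con 4 :* (x :* (x :+ e)) :+ e :* e := (x :+ (x :+ e)) :* (x :+ (x :+ e))) ≡.refl x e))
  4xy≤[x+y]² x y | inj₂ y≤x with ℕₚ.m≤n⇒∃[o]m+o≡n y≤x
  ...   | e , ≡.refl = ℕₚ.≤-trans (ℕₚ.m≤m+n _ (e * e)) (ℕₚ.≤-reflexive
    (solve 2 (λ y e → con 4 :* ((y :+ e) :* y) :+ e :* e := (y :+ e :+ y) :* (y :+ e :+ y)) ≡.refl y e))

  square-cancel-≤ : ∀ {m n} → m * m ≤ n * n → m ≤ n
  square-cancel-≤ {m} {n} mm≤nn with m ℕ.≤? n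
  ... | yes m≤n = m≤n
  ... | no m≰n = contradiction (ℕₚ.*-mono-< (ℕₚ.≰⇒> m≰n) (ℕₚ.≰⇒> m≰n)) (ℕₚ.≤⇒≯ mm≤nn)

  -- Induction on the length. Given S² ≤ AB, the cross term 2xyS is at most x²B + y²A, since its
  -- square is at most 4 (x²B)(y²A).
  cauchy-schwarz : ∀ {n} (a b : Fin n → ℕ) →
    ℕΣ.sum (λ i → a i * b i) * ℕΣ.sum (λ i → a i * b i) ≤ ℕΣ.sum (λ i → a i * a i) * ℕΣ.sum (λ i → b i * b i)
  cauchy-schwarz {zero} a b = z≤n
  cauchy-schwarz {suc n} a b = begin
    (x * y + S) * (x * y + S)
      ≡⟨ solve 3 (λ x y S → (x :* y :+ S) :* (x :* y :+ S) := x :* x :* (y :* y) :+ (con 2 :* (x :* y :* S) :+ S :* S)) ≡.refl x y S ⟩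
    x * x * (y * y) + (2 * (x * y * S) + S * S)
      ≤⟨ ℕₚ.+-monoʳ-≤ (x * x * (y * y)) (ℕₚ.+-mono-≤ (square-cancel-≤ cross) ih) ⟩
    x * x * (y * y) + (x * x * B + y * y * A + A * B)
      ≡⟨ solve 4 (λ x y A B → x :* x :* (y :* y) :+ (x :* x :* B :+ y :* y :* A :+ A :* B) := (x :* x :+ A) :* (y :* y :+ B)) ≡.refl x y A B ⟩
    (x * x + A) * (y * y + B) ∎
    where
    x = a zero
    y = b zero
    S = ℕΣ.sum (λ i → a (suc i) * b (suc i))
    A = ℕΣ.sum (λ i → a (suc i) * a (suc i))
    B = ℕΣ.sum (λ i → b (suc i) * b (suc i))
    ih : S * S ≤ A * B
    ih = cauchy-schwarz (a ∘ suc) (b ∘ suc)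
    cross : 2 * (x * y * S) * (2 * (x * y * S)) ≤ (x * x * B + y * y * A) * (x * x * B + y * y * A)
    cross = begin
      2 * (x * y * S) * (2 * (x * y * S))
        ≡⟨ solve 3 (λ x y S → con 2 :* (x :* y :* S) :* (con 2 :* (x :* y :* S)) := con 4 :* (x :* x :* (y :* y)) :* (S :* S)) ≡.refl x y S ⟩
      4 * (x * x * (y * y)) * (S * S) ≤⟨ ℕₚ.*-monoʳ-≤ (4 * (x * x * (y * y))) ih ⟩
      4 * (x * x * (y * y)) * (A * B)
        ≡⟨ solve 4 (λ x y A B → con 4 :* (x :* x :* (y :* y)) :* (A :* B) := con 4 :* (x :* x :* B :* (y :* y :* A))) ≡.refl x y A B ⟩
      4 * (x * x * B * (y * y * A)) ≤⟨ 4xy≤[x+y]² (x * x * B) (y * y * A) ⟩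
      (x * x * B + y * y * A) * (x * x * B + y * y * A) ∎

inverses⇒noZeroDivisors : ∀ {c ℓ} (R : CommutativeRing c ℓ) → let open CommutativeRing R in
  (∀ x → ¬ x ≈ 0# → ∃ λ y → x * y ≈ 1#) → ∀ {x y} → x * y ≈ 0# → ¬ x ≈ 0# → y ≈ 0#
inverses⇒noZeroDivisors R inverse {x} {y} xy≈0 x≉0 = let z , xz≈1 = inverse x x≉0 in begin
  y ≈⟨ *-identityˡ y ⟨
  1# * y ≈⟨ *-congʳ xz≈1 ⟨
  x * z * y ≈⟨ solve 3 (λ x y z → x :* z :* y := z :* (x :* y)) refl x y z ⟩
  z * (x * y) ≈⟨ trans (*-congˡ xy≈0) (zeroʳ z) ⟩
  0# ∎
  where
  open CommutativeRing R
  open Solver R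
  open import Relation.Binary.Reasoning.Setoid setoid

module FiniteField {c ℓ} (F : CommutativeRing c ℓ) {q : ℕ} (isFF : IsFiniteField F q) where
  open CommutativeRing F hiding (zero)
  open IsFiniteField isFF
  open Solver F
  open import Algebra.Properties.CommutativeSemiring.Exp commutativeSemiring
  open import Algebra.Properties.Semiring.Mult semiring using () renaming (_×_ to _·_)
  open import Algebra.Properties.Ring ring using (x∙y⁻¹≈ε⇒x≈y)
  open import Relation.Binary.Reasoning.Setoid setoid

  index : Carrier → Fin q
  index x = proj₁ (enum-surj x)

  enum-index : ∀ x → enum (index x) ≈ x
  enum-index x = proj₂ (enum-surj x)

  index-cong : ∀ {x y} → x ≈ y → index x ≡ index y
  index-cong x≈y = enum-inj _ _ (trans (enum-index _) (trans x≈y (sym (enum-index _))))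

  index-enum : ∀ i → index (enum i) ≡ i
  index-enum i = enum-inj _ _ (enum-index _)

  infix 4 _≟_
  _≟_ : ∀ x y → Dec (x ≈ y)
  x ≟ y = map′ (λ eq → trans (sym (enum-index x)) (trans (reflexive (≡.cong enum eq)) (enum-index y))) index-cong
    (index x Fin.≟ index y)

  search : ∀ {b} {P : Carrier → Set b} → (∀ {x y} → x ≈ y → P x → P y) → (∀ x → Dec (P x)) → Dec (∃ P)
  search resp P? = map′ (λ (i , p) → enum i , p) (λ (x , p) → index x , resp (sym (enum-index x)) p) (any? (P? ∘ enum))

  noZeroDivisors : ∀ {x y} → x * y ≈ 0# → ¬ x ≈ 0# → y ≈ 0#
  noZeroDivisors = inverses⇒noZeroDivisors F inverse

  *-nonzero : ∀ {x y} → ¬ x ≈ 0# → ¬ y ≈ 0# → ¬ x * y ≈ 0#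
  *-nonzero x≉0 y≉0 xy≈0 = y≉0 (noZeroDivisors xy≈0 x≉0)

  1≉0 : ¬ 1# ≈ 0#
  1≉0 = nontrivial ∘ sym

  1^n≈1 : ∀ n → 1# ^ n ≈ 1#
  1^n≈1 zero = refl
  1^n≈1 (suc n) = trans (*-identityˡ _) (1^n≈1 n)

  ^-nonzero : ∀ {x} n → ¬ x ≈ 0# → ¬ x ^ n ≈ 0#
  ^-nonzero zero x≉0 = 1≉0
  ^-nonzero (suc n) x≉0 = *-nonzero x≉0 (^-nonzero n x≉0)

  *-cancelˡ : ∀ {x y z} → ¬ x ≈ 0# → x * y ≈ x * z → y ≈ z
  *-cancelˡ {x} {y} {z} x≉0 eq = x∙y⁻¹≈ε⇒x≈y y z (noZeroDivisors (begin
    x * (y - z) ≈⟨ solve 3 (λ x y z → x :* (y :- z) := x :* y :- x :* z) refl x y z ⟩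
    x * y - x * z ≈⟨ +-congʳ eq ⟩
    x * z - x * z ≈⟨ -‿inverseʳ _ ⟩
    0# ∎) x≉0)

  module _ {a b} (M : CommutativeMonoid a b) where
    private module M = CommutativeMonoid M
    open MonoidSum M using (sum; sum-permute; sum-cong-≋)

    sum-bijection : (f : Carrier → M.Carrier) → (∀ {x y} → x ≈ y → f x M.≈ f y) →
      (φ ψ : Carrier → Carrier) → (∀ {x y} → x ≈ y → φ x ≈ φ y) → (∀ {x y} → x ≈ y → ψ x ≈ ψ y) →
      (∀ x → φ (ψ x) ≈ x) → (∀ x → ψ (φ x) ≈ x) →
      sum (f ∘ φ ∘ enum) M.≈ sum (f ∘ enum)
    sum-bijection f f-cong φ ψ φ-cong ψ-cong φψ ψφ =
      M.sym (M.trans (sum-permute (f ∘ enum) π) (sum-cong-≋ {q} (λ i → f-cong (enum-index (φ (enum i))))))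
      where
      π : Permutation q q
      π = permutation (index ∘ φ ∘ enum) (index ∘ ψ ∘ enum)
        (λ i → ≡.trans (index-cong (trans (φ-cong (enum-index _)) (φψ _))) (index-enum i))
        (λ i → ≡.trans (index-cong (trans (ψ-cong (enum-index _)) (ψφ _))) (index-enum i))

  -- Translation by 1 permutes the field, so the sum of all elements equals itself plus `q · 1#`.
  q·1≈0 : q · 1# ≈ 0#
  q·1≈0 = begin
    q · 1# ≈⟨ solve 2 (λ a b → a := a :+ b :- b) refl (q · 1#) S ⟩
    q · 1# + S - S ≈⟨ +-congʳ (begin
      q · 1# + S ≈⟨ +-congʳ (AS.sum-replicate q) ⟨
      AS.sum {q} (λ _ → 1#) + S ≈⟨ AS.∑-distrib-+ {q} (λ _ → 1#) enum ⟨
      AS.sum {q} (λ i → 1# + enum i) ≈⟨ sum-bijection +-commutativeMonoid id id (1# +_) (- 1# +_) +-congˡ +-congˡ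
         (λ x → solve 2 (λ a x → a :+ (:- a :+ x) := x) refl 1# x) (λ x → solve 2 (λ a x → :- a :+ (a :+ x) := x) refl 1# x) ⟩
      S ∎) ⟩
    S - S ≈⟨ -‿inverseʳ S ⟩
    0# ∎
    where
    module AS = MonoidSum +-commutativeMonoid
    S = AS.sum {q} enum

  -- Multiplication by x permutes the field. To multiply over all q elements, `g` replaces the value
  -- 0 by 1, and `e` supplies at y = 0 the factor x that is missing there. Comparing products gives
  -- P x = x^q P directly, without enumerating the nonzero elements.
  ^-fixed : ∀ x → x ^ q ≈ x
  ^-fixed x with x ≟ 0#
  ... | yes x≈0 = zero-case q (index 0#)
    where
    zero-case : ∀ n → Fin n → x ^ n ≈ x
    zero-case (suc n) _ = trans (trans (*-congʳ x≈0) (zeroˡ _)) (sym x≈0)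
  ... | no x≉0 = sym (*-cancelˡ P≉0 (begin
    P * x ≈⟨ *-congˡ ∏e≈x ⟨
    P * ∏ e ≈⟨ *-congʳ (sum-bijection *-commutativeMonoid g g-cong (x *_) (x⁻¹ *_) *-congˡ *-congˡ
       (λ y → trans (sym (*-assoc _ _ _)) (trans (*-congʳ xx⁻¹≈1) (*-identityˡ y)))
       (λ y → trans (sym (*-assoc _ _ _)) (trans (*-congʳ (trans (*-comm _ _) xx⁻¹≈1)) (*-identityˡ y)))) ⟨
    ∏ (λ y → g (x * y)) * ∏ e ≈⟨ MS.∑-distrib-+ {q} (λ i → g (x * enum i)) (e ∘ enum) ⟨
    ∏ (λ y → g (x * y) * e y) ≈⟨ MS.sum-cong-≋ {q} (λ i → pointwise (enum i)) ⟩
    ∏ (λ y → x * g y) ≈⟨ MS.∑-distrib-+ {q} (λ _ → x) (g ∘ enum) ⟩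
    ∏ (λ _ → x) * P ≈⟨ *-cong (MS.sum-replicate q) refl ⟩
    x ^ q * P ≈⟨ *-comm _ _ ⟩
    P * x ^ q ∎))
    where
    module MS = MonoidSum *-commutativeMonoid
    x⁻¹ = proj₁ (inverse x x≉0)
    xx⁻¹≈1 = proj₂ (inverse x x≉0)
    ∏ : (Carrier → Carrier) → Carrier
    ∏ f = MS.sum {q} (f ∘ enum)
    g e : Carrier → Carrier
    g y with y ≟ 0#
    ... | yes _ = 1#
    ... | no _ = y
    e y with y ≟ 0#
    ... | yes _ = x
    ... | no _ = 1#
    P = ∏ g
    g-cong : ∀ {y z} → y ≈ z → g y ≈ g z
    g-cong {y} {z} y≈z with y ≟ 0# | z ≟ 0#
    ... | yes _ | yes _ = refl
    ... | yes y≈0 | no z≉0 = contradiction (trans (sym y≈z) y≈0) z≉0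
    ... | no y≉0 | yes z≈0 = contradiction (trans y≈z z≈0) y≉0
    ... | no _ | no _ = y≈z
    pointwise : ∀ y → g (x * y) * e y ≈ x * g y
    pointwise y with y ≟ 0# | x * y ≟ 0#
    ... | yes _ | yes _ = *-comm _ _
    ... | yes y≈0 | no xy≉0 = contradiction (trans (*-congˡ y≈0) (zeroʳ x)) xy≉0
    ... | no y≉0 | yes xy≈0 = contradiction xy≈0 (*-nonzero x≉0 y≉0)
    ... | no _ | no _ = *-identityʳ _
    product-nonzero : ∀ {n} (f : Fin n → Carrier) → (∀ i → ¬ f i ≈ 0#) → ¬ MS.sum f ≈ 0#
    product-nonzero {zero} f f≉0 = 1≉0
    product-nonzero {suc n} f f≉0 = *-nonzero (f≉0 zero) (product-nonzero (f ∘ suc) (f≉0 ∘ suc))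
    g-nonzero : ∀ y → ¬ g y ≈ 0#
    g-nonzero y with y ≟ 0#
    ... | yes _ = 1≉0
    ... | no y≉0 = y≉0
    P≉0 : ¬ P ≈ 0#
    P≉0 = product-nonzero (g ∘ enum) (g-nonzero ∘ enum)
    e-at-0 : e (enum (index 0#)) ≈ x
    e-at-0 with enum (index 0#) ≟ 0#
    ... | yes _ = refl
    ... | no ≉0 = contradiction (enum-index 0#) ≉0
    e-elsewhere : ∀ i → i ≢ index 0# → e (enum i) ≈ 1#
    e-elsewhere i i≢ with enum i ≟ 0#
    ... | yes ≈0 = contradiction (≡.trans (≡.sym (index-enum i)) (index-cong ≈0)) i≢
    ... | no _ = refl
    ∏e≈x : ∏ e ≈ x
    ∏e≈x = trans (sum-single *-commutativeMonoid (e ∘ enum) (index 0#) e-elsewhere) e-at-0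

-- Roots of polynomials

module Roots {c ℓ} (R : CommutativeRing c ℓ) where
  open CommutativeRing R hiding (zero)
  open Solver R
  open import Algebra.Properties.CommutativeSemiring.Exp commutativeSemiring
  open import Algebra.Properties.Ring ring using (x∙y⁻¹≈ε⇒x≈y)
  open import Relation.Binary.Reasoning.Setoid setoid

  eval : List Carrier → Carrier → Carrier
  eval [] y = 0#
  eval (a ∷ p) y = a + y * eval p y

  eval-cong : ∀ p {y z} → y ≈ z → eval p y ≈ eval p z
  eval-cong [] y≈z = refl
  eval-cong (a ∷ p) y≈z = +-congˡ (*-cong y≈z (eval-cong p y≈z))

  -- The quotient of a ∷ p by X − r; it does not depend on a.
  deflate : Carrier → List Carrier → List Carrier
  deflate r [] = []
  deflate r (b ∷ p) = eval (b ∷ p) r ∷ deflate r p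

  length-deflate : ∀ r p → length (deflate r p) ≡ length p
  length-deflate r [] = ≡.refl
  length-deflate r (b ∷ p) = ≡.cong suc (length-deflate r p)

  eval-deflate : ∀ r a p y → eval (a ∷ p) y ≈ eval (a ∷ p) r + (y - r) * eval (deflate r p) y
  eval-deflate r a [] y = solve 3 (λ a r y → a :+ y :* con (0 , 0) := a :+ r :* con (0 , 0) :+ (y :- r) :* con (0 , 0)) refl a r y
  eval-deflate r a (b ∷ p) y = trans (+-congˡ (*-congˡ (eval-deflate r b p y)))
    (solve 5 (λ a r y E D → a :+ y :* (E :+ (y :- r) :* D) := a :+ r :* E :+ (y :- r) :* (E :+ y :* D)) refl
       a r y (eval (b ∷ p) r) (eval (deflate r p) y))

  deflate-zero : ∀ r a p → eval (a ∷ p) r ≈ 0# → All (_≈ 0#) (deflate r p) → All (_≈ 0#) (a ∷ p)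
  deflate-zero r a [] ar≈0 [] = trans (solve 2 (λ a r → a := a :+ r :* con (0 , 0)) refl a r) ar≈0 ∷ []
  deflate-zero r a (b ∷ p) ar≈0 (br≈0 ∷ ds) =
    trans (sym (trans (+-congˡ (trans (*-congˡ br≈0) (zeroʳ r))) (+-identityʳ a))) ar≈0 ∷ deflate-zero r b p br≈0 ds

  eval-monic : ∀ p y → eval (p ++ 1# ∷ []) y ≈ eval p y + y ^ length p
  eval-monic [] y = solve 1 (λ y → con (1 , 0) :+ y :* con (0 , 0) := con (0 , 0) :+ con (1 , 0)) refl y
  eval-monic (a ∷ p) y = trans (+-congˡ (*-congˡ (eval-monic p y)))
    (solve 4 (λ a y E Y → a :+ y :* (E :+ Y) := a :+ y :* E :+ y :* Y) refl a y _ _)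

  eval-zeros : ∀ n y → eval (replicate n 0#) y ≈ 0#
  eval-zeros zero y = refl
  eval-zeros (suc n) y = trans (+-identityˡ _) (trans (*-congˡ (eval-zeros n y)) (zeroʳ y))

  module _ (noZeroDivisors : ∀ {x y} → x * y ≈ 0# → ¬ x ≈ 0# → y ≈ 0#) where

    -- A list of m coefficients has degree below m. Each root splits off a linear factor and
    -- shortens the list by one; `deflate-zero` carries the vanishing back up.
    roots⇒zero : ∀ {m} p → length p ≡ m → (f : Fin m → Carrier) → (∀ i j → f i ≈ f j → i ≡ j) →
                 (∀ i → eval p (f i) ≈ 0#) → All (_≈ 0#) p
    roots⇒zero [] _ f inj root = []
    roots⇒zero {suc m} (a ∷ p) eq f inj root = deflate-zero r a p (root zero)
      (roots⇒zero (deflate r p) (≡.trans (length-deflate r p) (ℕₚ.suc-injective eq)) (f ∘ suc)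
        (λ i j → Fin.suc-injective ∘ inj (suc i) (suc j)) root′)
      where
      r = f zero
      root′ : ∀ i → eval (deflate r p) (f (suc i)) ≈ 0#
      root′ i = noZeroDivisors (begin
        (y - r) * D ≈⟨ +-identityˡ _ ⟨
        0# + (y - r) * D ≈⟨ +-congʳ (root zero) ⟨
        eval (a ∷ p) r + (y - r) * D ≈⟨ eval-deflate r a p y ⟨
        eval (a ∷ p) y ≈⟨ root (suc i) ⟩
        0# ∎) λ y-r≈0 → contradiction (inj (suc i) zero (x∙y⁻¹≈ε⇒x≈y y r y-r≈0)) λ ()
        where
        y = f (suc i)
        D = eval (deflate r p) y

    monic-roots : ¬ 1# ≈ 0# → ∀ {m} p → m ≡ suc (length p) → (f : Fin m → Carrier) → (∀ i j → f i ≈ f j → i ≡ j) →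
                  ¬ (∀ i → eval p (f i) + f i ^ length p ≈ 0#)
    monic-roots 1≉0 p eq f inj root
      with ++⁻ʳ p (roots⇒zero (p ++ 1# ∷ []) (≡.trans (length-++ p) (≡.trans (ℕₚ.+-comm _ 1) (≡.sym eq))) f inj
                    (λ i → trans (eval-monic p (f i)) (root i)))
    ... | 1≈0 ∷ [] = 1≉0 1≈0

    power-fibre : ¬ 1# ≈ 0# → ∀ n a (f : Fin (suc (suc n)) → Carrier) → (∀ i j → f i ≈ f j → i ≡ j) →
                  ¬ (∀ i → f i ^ suc n ≈ a)
    power-fibre 1≉0 n a f inj eq = monic-roots 1≉0 p (≡.cong (λ m → suc (suc m)) (≡.sym (length-replicate n))) f inj λ i → begin
      - a + f i * eval (replicate n 0#) (f i) + f i ^ length p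
        ≈⟨ +-cong (trans (+-congˡ (trans (*-congˡ (eval-zeros n (f i))) (zeroʳ _))) (+-identityʳ _))
                  (trans (^-congʳ (f i) (≡.cong suc (length-replicate n))) (eq i)) ⟩
      - a + a ≈⟨ -‿inverseˡ a ⟩
      0# ∎
      where
      p = - a ∷ replicate n 0#

-- The numerical inequality that closes the scalar case

module MomentInequality where
  open import Data.Nat using (_+_; _*_)
  open +-*-Solver
  open ℕₚ.≤-Reasoning

  -- The second hypothesis is the sum of the lower bounds over all slopes. Adding
  -- `s * g * (h₀ * (h₀ * h₀))` to both sides lets the exact value of the moment be substituted
  -- without subtraction, and nearly everything cancels. In the conclusion the term h^4 h₀^2 is the
  -- whole gain obtained from the empty lines.
  moment-gap : ∀ h g M → let h₀ = suc h; s = h + g in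
    M + h₀ * (h₀ * h₀) ≡ h₀ * h₀ * (h₀ * h₀) + h₀ * (suc s * h₀) →
    s * g * (h₀ * (h₀ * h₀)) + h * (s * g * (h₀ * h₀) + g * (h₀ * h * (h₀ * h)))
      + g * (s * g + g * (h * (2 + h) * (h * (2 + h)))) + h * (h * (h₀ * h * (h₀ * h))) ≤ s * g * M →
    h * (g * g * (h * h₀) + h * h * h * (h₀ * h₀)) ≤ h * (g * g * (g * (2 + h)))
  moment-gap h g M eq le = ℕₚ.+-cancelˡ-≤ R _ _ (begin
    R + h * (g * g * (h * h₀) + h * h * h * (h₀ * h₀))
      ≤⟨ ℕₚ.+-monoˡ-≤ _ (ℕₚ.+-monoˡ-≤ (s * g * (h₀ * (h₀ * h₀))) le) ⟩
    s * g * M + s * g * (h₀ * (h₀ * h₀)) + h * (g * g * (h * h₀) + h * h * h * (h₀ * h₀))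
      ≡⟨ ≡.cong (_+ h * (g * g * (h * h₀) + h * h * h * (h₀ * h₀))) (≡.trans (≡.sym (ℕₚ.*-distribˡ-+ (s * g) M _)) (≡.cong (s * g *_) eq)) ⟩
    s * g * (h₀ * h₀ * (h₀ * h₀) + h₀ * (suc s * h₀)) + h * (g * g * (h * h₀) + h * h * h * (h₀ * h₀))
      ≡⟨ solve 2 (λ h g → let h₀ = con 1 :+ h; s = h :+ g in
           s :* g :* (h₀ :* h₀ :* (h₀ :* h₀) :+ h₀ :* ((con 1 :+ s) :* h₀)) :+ h :* (g :* g :* (h :* h₀) :+ h :* h :* h :* (h₀ :* h₀))
           := s :* g :* (h₀ :* (h₀ :* h₀)) :+ h :* (s :* g :* (h₀ :* h₀) :+ g :* (h₀ :* h :* (h₀ :* h)))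
              :+ g :* (s :* g :+ g :* (h :* (con 2 :+ h) :* (h :* (con 2 :+ h)))) :+ h :* (h :* (h₀ :* h :* (h₀ :* h)))
              :+ s :* g :* (h₀ :* (h₀ :* h₀)) :+ h :* (g :* g :* (g :* (con 2 :+ h)))) ≡.refl h g ⟩
    R + h * (g * g * (g * (2 + h))) ∎)
    where
    h₀ = suc h
    s = h + g
    R = s * g * (h₀ * (h₀ * h₀)) + h * (s * g * (h₀ * h₀) + g * (h₀ * h * (h₀ * h)))
      + g * (s * g + g * (h * (2 + h) * (h * (2 + h)))) + h * (h * (h₀ * h * (h₀ * h))) + s * g * (h₀ * (h₀ * h₀))

  -- Multiply by 2 + i: as i (2 + i) = j^2 - 1, the leading term becomes j^4 h - j^2 h, to which the
  -- hypothesis applies. The missing `j * j * h` is added on both sides.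
  no-gap : ∀ h i → suc i * suc i * (suc i * suc i) ≤ (2 + i) * suc h → let h = suc h in
    suc i * suc i * (i * h + (i + suc i)) < suc h * suc h
  no-gap h′ i le = ℕₚ.*-cancelˡ-< (2 + i) _ _ (ℕₚ.+-cancelʳ-< (j * j * h) _ _ (begin-strict
    (2 + i) * (j * j * (i * h + (i + j))) + j * j * h
      ≡⟨ solve 2 (λ i h → let j = con 1 :+ i in (con 2 :+ i) :* (j :* j :* (i :* h :+ (i :+ j))) :+ j :* j :* h
           := j :* j :* (j :* j) :* h :+ con 2 :* (j :* j :* (j :* j)) :+ j :* j :* i) ≡.refl i h ⟩
    j * j * (j * j) * h + 2 * (j * j * (j * j)) + j * j * i
      ≤⟨ ℕₚ.+-mono-≤ (ℕₚ.+-mono-≤ (ℕₚ.*-monoˡ-≤ h le) (ℕₚ.*-monoʳ-≤ 2 le)) (ℕₚ.*-monoʳ-≤ (j * j) i≤h) ⟩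
    (2 + i) * h * h + 2 * ((2 + i) * h) + j * j * h <⟨ ℕₚ.+-monoˡ-< (j * j * h) (ℕₚ.m<m+n ((2 + i) * h * h + 2 * ((2 + i) * h)) {2 + i} (s≤s z≤n)) ⟩
    (2 + i) * h * h + 2 * ((2 + i) * h) + (2 + i) + j * j * h
      ≡⟨ solve 3 (λ i h J → (con 2 :+ i) :* h :* h :+ con 2 :* ((con 2 :+ i) :* h) :+ (con 2 :+ i) :+ J := (con 2 :+ i) :* ((con 1 :+ h) :* (con 1 :+ h)) :+ J)
           ≡.refl i h (j * j * h) ⟩
    (2 + i) * (suc h * suc h) + j * j * h ∎))
    where
    h = suc h′
    j = suc i
    i≤h : i ≤ h
    i≤h with i ℕ.≤? h
    ... | yes p = p
    ... | no i≰h = contradiction le (ℕₚ.<⇒≱ (begin-strict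
      (2 + i) * h ≤⟨ ℕₚ.*-monoʳ-≤ (2 + i) (ℕₚ.<⇒≤ (ℕₚ.≰⇒> i≰h)) ⟩
      (2 + i) * i <⟨ ℕₚ.n<1+n _ ⟩
      suc ((2 + i) * i) ≡⟨ solve 1 (λ i → con 1 :+ (con 2 :+ i) :* i := (con 1 :+ i) :* (con 1 :+ i)) ≡.refl i ⟩
      j * j ≡⟨ ℕₚ.*-identityʳ (j * j) ⟨
      j * j * 1 ≤⟨ ℕₚ.*-monoʳ-≤ (j * j) (s≤s z≤n) ⟩
      j * j * (j * j) ∎))

  -- In use j = k - 1, and g ≤ jh is the fibre bound s ≤ kh. Replacing g by jh in the gap inequality
  -- lets h^3 cancel and leaves (h + 1)^2 ≤ j^2 ((j - 1) h + 2j - 1), which `no-gap` refutes.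
  moment-contradiction : ∀ h g M i → 1 ≤ h → let h₀ = suc h; s = h + g; j = suc i in
    M + h₀ * (h₀ * h₀) ≡ h₀ * h₀ * (h₀ * h₀) + h₀ * (suc s * h₀) →
    s * g * (h₀ * (h₀ * h₀)) + h * (s * g * (h₀ * h₀) + g * (h₀ * h * (h₀ * h)))
      + g * (s * g + g * (h * (2 + h) * (h * (2 + h)))) + h * (h * (h₀ * h * (h₀ * h))) ≤ s * g * M →
    g ≤ j * h → j * j * (j * j) ≤ s → ⊥
  moment-contradiction h@(suc h′) g M i _ eq le g≤jh j⁴≤s = ℕₚ.<⇒≱ (no-gap h′ i (ℕₚ.≤-trans j⁴≤s (ℕₚ.+-monoʳ-≤ h g≤jh)))
    (ℕₚ.*-cancelˡ-≤ (h * h * h) (begin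
      h * h * h * (h₀ * h₀) ≤⟨ ℕₚ.+-cancelˡ-≤ (g * g * (h * h₀)) _ _ (begin
        g * g * (h * h₀) + h * h * h * (h₀ * h₀) ≤⟨ ℕₚ.*-cancelˡ-≤ h (moment-gap h g M eq le) ⟩
        g * g * (g * (2 + h)) ≤⟨ ℕₚ.*-monoʳ-≤ (g * g) (ℕₚ.*-monoˡ-≤ (2 + h) g≤jh) ⟩
        g * g * (j * h * (2 + h))
          ≡⟨ solve 3 (λ G h i → G :* ((con 1 :+ i) :* h :* (con 2 :+ h)) := G :* (h :* (con 1 :+ h)) :+ G :* (h :* (i :* h :+ (i :+ (con 1 :+ i))))) ≡.refl (g * g) h i ⟩
        g * g * (h * h₀) + g * g * (h * (i * h + (i + j))) ∎) ⟩
      g * g * (h * (i * h + (i + j))) ≤⟨ ℕₚ.*-monoˡ-≤ (h * (i * h + (i + j))) (ℕₚ.*-mono-≤ g≤jh g≤jh) ⟩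
      j * h * (j * h) * (h * (i * h + (i + j)))
        ≡⟨ solve 3 (λ j h X → j :* h :* (j :* h) :* (h :* X) := h :* h :* h :* (j :* j :* X)) ≡.refl j h (i * h + (i + j)) ⟩
      h * h * h * (j * j * (i * h + (i + j))) ∎))
    where
    h₀ = suc h
    s = h + g
    j = suc i

-- Points of Pow × Pow on lines

module Moments {c ℓ} (F : CommutativeRing c ℓ) {q : ℕ} (isFF : IsFiniteField F q) (k-1 : ℕ) where
  open CommutativeRing F using (Carrier; _≈_; 0#; 1#; -_; refl; sym; trans; setoid; commutativeSemiring; ring)
    renaming (_+_ to _⊕_; _*_ to _⊛_)
  module F = CommutativeRing F
  open IsFiniteField isFF
  open FiniteField F isFF
  open import Algebra.Properties.CommutativeSemiring.Exp commutativeSemiring renaming (_^_ to _↑_)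
  open import Algebra.Properties.Ring ring using (-‿involutive; x∙y⁻¹≈ε⇒x≈y)
  open import Data.Nat using (_+_; _*_)
  module FS = Solver F
  open ≡.≡-Reasoning

  Respects : (Carrier → ℕ) → Set _
  Respects f = ∀ {x y} → x ≈ y → f x ≡ f y

  abstract
    Σ : (Carrier → ℕ) → ℕ
    Σ f = ℕΣ.sum (f ∘ enum)

    Σ-cong : ∀ {f g : Carrier → ℕ} → (∀ x → f x ≡ g x) → Σ f ≡ Σ g
    Σ-cong eq = ℕΣ.sum-cong-≗ {q} (eq ∘ enum)

    Σ-mono : ∀ {f g : Carrier → ℕ} → (∀ x → f x ≤ g x) → Σ f ≤ Σ g
    Σ-mono le = sum-mono {q} (le ∘ enum)

    Σ-+ : ∀ f g → Σ (λ x → f x + g x) ≡ Σ f + Σ g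
    Σ-+ f g = ℕΣ.∑-distrib-+ {q} (f ∘ enum) (g ∘ enum)

    Σ-*ˡ : ∀ a f → Σ (λ x → a * f x) ≡ a * Σ f
    Σ-*ˡ a f = ≡.sym (ℕΣ.*-distribˡ-sum {q} a (f ∘ enum))

    Σ-*ʳ : ∀ a f → Σ (λ x → f x * a) ≡ Σ f * a
    Σ-*ʳ a f = ≡.sym (ℕΣ.*-distribʳ-sum {q} a (f ∘ enum))

    Σ-*Σ : ∀ f g → Σ f * Σ g ≡ Σ (λ x → Σ (λ y → f x * g y))
    Σ-*Σ f g = ≡.trans (≡.sym (Σ-*ʳ (Σ g) f)) (Σ-cong (λ x → ≡.sym (Σ-*ˡ (f x) g)))

    Σ-swap : ∀ (f : Carrier → Carrier → ℕ) → Σ (λ x → Σ (f x)) ≡ Σ (λ y → Σ (λ x → f x y))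
    Σ-swap f = ℕΣ.∑-comm {q} {q} (λ i j → f (enum i) (enum j))

    Σ-const : ∀ a → Σ (λ _ → a) ≡ q * a
    Σ-const a = const q
      where
      const : ∀ n → ℕΣ.sum {n} (λ _ → a) ≡ n * a
      const zero = ≡.refl
      const (suc n) = ≡.cong (a +_) (const n)

    Σ-shift : ∀ {f} → Respects f → ∀ v → Σ (λ x → f (v ⊕ x)) ≡ Σ f
    Σ-shift {f} resp v = sum-bijection ℕₚ.+-0-commutativeMonoid f resp (v ⊕_) (- v ⊕_) F.+-congˡ F.+-congˡ
      (λ x → FS.solve 2 (λ v x → v FS.:+ (FS.:- v FS.:+ x) FS.:= x) refl v x)
      (λ x → FS.solve 2 (λ v x → FS.:- v FS.:+ (v FS.:+ x) FS.:= x) refl v x)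

    Σ-scale : ∀ {f} → Respects f → ∀ {u} → ¬ u ≈ 0# → Σ (λ x → f (u ⊛ x)) ≡ Σ f
    Σ-scale {f} resp {u} u≉0 with inverse u u≉0
    ... | v , uv≈1 = sum-bijection ℕₚ.+-0-commutativeMonoid f resp (u ⊛_) (v ⊛_) F.*-congˡ F.*-congˡ
      (λ x → trans (sym (F.*-assoc u v x)) (trans (F.*-congʳ uv≈1) (F.*-identityˡ x)))
      (λ x → trans (sym (F.*-assoc v u x)) (trans (F.*-congʳ (trans (F.*-comm v u) uv≈1)) (F.*-identityˡ x)))

    Σ-neg : ∀ {f} → Respects f → Σ (λ x → f (- x)) ≡ Σ f
    Σ-neg {f} resp = sum-bijection ℕₚ.+-0-commutativeMonoid f resp -_ -_ F.-‿cong F.-‿cong -‿involutive -‿involutive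

    Σ-single : ∀ {f} → Respects f → ∀ a → Σ (λ x → ⟦ x ≟ a ⟧ * f x) ≡ f a
    Σ-single {f} resp a = ≡.trans
      (sum-single ℕₚ.+-0-commutativeMonoid (λ i → ⟦ enum i ≟ a ⟧ * f (enum i)) (index a)
        (λ i i≢ → ≡.cong (_* f (enum i)) (⟦⟧-no (enum i ≟ a) λ eq → i≢ (≡.trans (≡.sym (index-enum i)) (index-cong eq)))))
      (≡.trans (≡.cong₂ _*_ (⟦⟧-yes (enum (index a) ≟ a) (enum-index a)) (resp (enum-index a))) (ℕₚ.*-identityˡ (f a)))

    Σ-cauchy : ∀ (u v : Carrier → ℕ) → Σ (λ x → u x * v x) * Σ (λ x → u x * v x) ≤ Σ (λ x → u x * u x) * Σ (λ x → v x * v x)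
    Σ-cauchy u v = cauchy-schwarz {q} (u ∘ enum) (v ∘ enum)

    count-≤ : ∀ {b} {P : Carrier → Set b} (P? : ∀ x → Dec (P x)) n →
              ¬ (∃ λ (f : Fin (suc n) → Carrier) → (∀ i j → f i ≈ f j → i ≡ j) × (∀ i → P (f i))) → Σ (λ x → ⟦ P? x ⟧) ≤ n
    count-≤ P? n none with Σ (λ x → ⟦ P? x ⟧) ℕ.≤? n
    ... | yes le = le
    ... | no ≰n with select (P? ∘ enum)
    ... | f , Pf , inj = contradiction
      ((λ i → enum (f (inject≤ i n<))) , (λ i j eq → inject≤-injective n< n< i j (inj _ _ (enum-inj _ _ eq))) , λ i → Pf _) none
      where
      n< : n < ℕΣ.sum (λ i → ⟦ P? (enum i) ⟧)
      n< = ℕₚ.≰⇒> ≰n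

  k : ℕ
  k = suc k-1

  Pow : Carrier → Set _
  Pow x = ∃ λ y → y ↑ k ≈ x

  Pow-resp : ∀ {x y} → x ≈ y → Pow x → Pow y
  Pow-resp x≈y (z , eq) = z , trans eq x≈y

  Pow? : ∀ x → Dec (Pow x)
  Pow? x = search (λ y≈z eq → trans (^-congˡ k (sym y≈z)) eq) (λ y → y ↑ k ≟ x)

  Pow-0 : Pow 0#
  Pow-0 = 0# , F.zeroˡ _

  Pow-1 : Pow 1#
  Pow-1 = 1# , 1^n≈1 k

  Pow-* : ∀ {x y} → Pow x → Pow y → Pow (x ⊛ y)
  Pow-* (u , eq) (v , eq′) = u ⊛ v , trans (^-distrib-* u v k) (F.*-cong eq eq′)

  Pow-cancel : ∀ {x y} → Pow x → ¬ x ≈ 0# → Pow (x ⊛ y) → Pow y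
  Pow-cancel {x} {y} (u , eq) x≉0 (v , eq′) with inverse u u≉0
    where
    u≉0 : ¬ u ≈ 0#
    u≉0 u≈0 = x≉0 (trans (sym eq) (trans (F.*-congʳ u≈0) (F.zeroˡ _)))
  ... | w , uw≈1 = v ⊛ w , *-cancelˡ x≉0 (R.begin
      x ⊛ (v ⊛ w) ↑ k R.≈⟨ F.*-cong (sym eq) (^-congˡ k (F.*-comm v w)) ⟩
      u ↑ k ⊛ (w ⊛ v) ↑ k R.≈⟨ ^-distrib-* u (w ⊛ v) k ⟨
      (u ⊛ (w ⊛ v)) ↑ k R.≈⟨ ^-congˡ k (trans (sym (F.*-assoc u w v)) (trans (F.*-congʳ uw≈1) (F.*-identityˡ v))) ⟩
      v ↑ k R.≈⟨ eq′ ⟩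
      x ⊛ y R.∎)
    where import Relation.Binary.Reasoning.Setoid setoid as R

  χ χ⁺ χ⁻ δ ε : Carrier → ℕ
  χ x = ⟦ Pow? x ⟧
  χ⁺ x = ⟦ Pow? x ×-dec ¬? (x ≟ 0#) ⟧
  χ⁻ x = ⟦ ¬? (Pow? x) ⟧
  δ x = ⟦ x ≟ 0# ⟧
  ε x = ⟦ ¬? (x ≟ 0#) ⟧

  χ-resp : Respects χ
  χ-resp x≈y = ⟦⟧-⇔ (Pow? _) (Pow? _) (Pow-resp x≈y) (Pow-resp (sym x≈y))

  χ⁺-resp : Respects χ⁺
  χ⁺-resp x≈y = ⟦⟧-⇔ (Pow? _ ×-dec ¬? (_ ≟ 0#)) (Pow? _ ×-dec ¬? (_ ≟ 0#))
    (λ (p , ≉0) → Pow-resp x≈y p , λ ≈0 → ≉0 (trans x≈y ≈0)) (λ (p , ≉0) → Pow-resp (sym x≈y) p , λ ≈0 → ≉0 (trans (sym x≈y) ≈0))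

  χ⁻-resp : Respects χ⁻
  χ⁻-resp x≈y = ⟦⟧-⇔ (¬? (Pow? _)) (¬? (Pow? _)) (λ ¬p → ¬p ∘ Pow-resp (sym x≈y)) (λ ¬p → ¬p ∘ Pow-resp x≈y)

  χ≡δ+χ⁺ : ∀ x → χ x ≡ δ x + χ⁺ x
  χ≡δ+χ⁺ x with Pow? x | x ≟ 0#
  ... | yes _ | yes _ = ≡.refl
  ... | yes _ | no _ = ≡.refl
  ... | no ¬p | yes ≈0 = contradiction (Pow-resp (sym ≈0) Pow-0) ¬p
  ... | no _ | no _ = ≡.refl

  δ+χ⁺+χ⁻≡1 : ∀ x → δ x + (χ⁺ x + χ⁻ x) ≡ 1
  δ+χ⁺+χ⁻≡1 x with Pow? x | x ≟ 0#
  ... | yes _ | yes _ = ≡.refl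
  ... | yes _ | no _ = ≡.refl
  ... | no ¬p | yes ≈0 = contradiction (Pow-resp (sym ≈0) Pow-0) ¬p
  ... | no _ | no _ = ≡.refl

  ε≡χ⁺+χ⁻ : ∀ x → ε x ≡ χ⁺ x + χ⁻ x
  ε≡χ⁺+χ⁻ x with Pow? x | x ≟ 0#
  ... | yes _ | yes _ = ≡.refl
  ... | yes _ | no _ = ≡.refl
  ... | no ¬p | yes ≈0 = contradiction (Pow-resp (sym ≈0) Pow-0) ¬p
  ... | no _ | no _ = ≡.refl

  -- Here |H| and the number of non-powers are the only counts. Defining `h₀` and `s` from them
  -- makes the later identities polynomial in h and g alone; `Σχ≡h₀` and `q≡1+s` identify them with
  -- |H ∪ 0| and q - 1.
  h g h₀ s : ℕ
  h = Σ χ⁺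
  g = Σ χ⁻
  h₀ = suc h
  s = h + g

  Σδ≡1 : Σ δ ≡ 1
  Σδ≡1 = ≡.trans (Σ-cong (λ x → ≡.sym (ℕₚ.*-identityʳ (δ x)))) (Σ-single (λ _ → ≡.refl) 0#)

  Σχ≡h₀ : Σ χ ≡ h₀
  Σχ≡h₀ = ≡.trans (Σ-cong χ≡δ+χ⁺) (≡.trans (Σ-+ δ χ⁺) (≡.cong (_+ h) Σδ≡1))

  q≡1+s : q ≡ suc s
  q≡1+s = begin
    q ≡⟨ ℕₚ.*-identityʳ q ⟨
    q * 1 ≡⟨ Σ-const 1 ⟨
    Σ (λ _ → 1) ≡⟨ Σ-cong δ+χ⁺+χ⁻≡1 ⟨
    Σ (λ x → δ x + (χ⁺ x + χ⁻ x)) ≡⟨ Σ-+ δ _ ⟩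
    Σ δ + Σ (λ x → χ⁺ x + χ⁻ x) ≡⟨ ≡.cong₂ _+_ Σδ≡1 (Σ-+ χ⁺ χ⁻) ⟩
    suc s ∎

  Σε≡s : Σ ε ≡ s
  Σε≡s = ≡.trans (Σ-cong ε≡χ⁺+χ⁻) (Σ-+ χ⁺ χ⁻)

  Σ-split : ∀ {f} → Respects f → Σ f ≡ f 0# + Σ (λ x → ε x * f x)
  Σ-split {f} resp = begin
    Σ f ≡⟨ Σ-cong pointwise ⟩
    Σ (λ x → δ x * f x + ε x * f x) ≡⟨ Σ-+ _ _ ⟩
    Σ (λ x → δ x * f x) + Σ (λ x → ε x * f x) ≡⟨ ≡.cong (_+ Σ (λ x → ε x * f x)) (Σ-single resp 0#) ⟩
    f 0# + Σ (λ x → ε x * f x) ∎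
    where
    pointwise : ∀ x → f x ≡ δ x * f x + ε x * f x
    pointwise x with x ≟ 0#
    ... | yes _ = ≡.sym (≡.trans (ℕₚ.+-identityʳ _) (ℕₚ.*-identityˡ _))
    ... | no _ = ≡.sym (ℕₚ.*-identityˡ _)

  h≥1 : 1 ≤ h
  h≥1 = ℕₚ.≤-trans (ℕₚ.≤-reflexive (≡.sym (≡.trans (Σ-single χ⁺-resp 1#) (⟦⟧-yes (Pow? 1# ×-dec ¬? (1# ≟ 0#)) (Pow-1 , 1≉0)))))
    (Σ-mono (λ x → ⟦⟧*n≤n (x ≟ 1#) (χ⁺ x)))

  -- N m b counts the points of the grid Pow × Pow on the line y = m x + b.
  N : Carrier → Carrier → ℕ
  N m b = Σ (λ α → χ α * χ (m ⊛ α ⊕ b))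

  T : Carrier → ℕ
  T m = Σ (λ b → N m b * N m b)

  N-resp : ∀ m → Respects (N m)
  N-resp m b≈b′ = Σ-cong (λ α → ≡.cong (χ α *_) (χ-resp (F.+-congˡ b≈b′)))

  ΣN : ∀ m → Σ (N m) ≡ h₀ * h₀
  ΣN m = begin
    Σ (λ b → Σ (λ α → χ α * χ (m ⊛ α ⊕ b))) ≡⟨ Σ-swap _ ⟩
    Σ (λ α → Σ (λ b → χ α * χ (m ⊛ α ⊕ b))) ≡⟨ Σ-cong (λ α → ≡.trans (Σ-*ˡ (χ α) _) (≡.cong (χ α *_) (Σ-shift χ-resp (m ⊛ α)))) ⟩
    Σ (λ α → χ α * Σ χ) ≡⟨ Σ-*ʳ (Σ χ) χ ⟩
    Σ χ * Σ χ ≡⟨ ≡.cong₂ _*_ Σχ≡h₀ Σχ≡h₀ ⟩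
    h₀ * h₀ ∎

  pairs : Carrier → Carrier → Carrier → ℕ
  pairs m α α′ = Σ (λ b → χ (m ⊛ α ⊕ b) * χ (m ⊛ α′ ⊕ b))

  T-pairs : ∀ m → T m ≡ Σ (λ α → Σ (λ α′ → χ α * χ α′ * pairs m α α′))
  T-pairs m = begin
    Σ (λ b → N m b * N m b) ≡⟨ Σ-cong (λ b → Σ-*Σ _ _) ⟩
    Σ (λ b → Σ (λ α → Σ (λ α′ → χ α * χ (m ⊛ α ⊕ b) * (χ α′ * χ (m ⊛ α′ ⊕ b))))) ≡⟨ Σ-swap _ ⟩
    Σ (λ α → Σ (λ b → Σ (λ α′ → χ α * χ (m ⊛ α ⊕ b) * (χ α′ * χ (m ⊛ α′ ⊕ b))))) ≡⟨ Σ-cong (λ α → Σ-swap _) ⟩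
    Σ (λ α → Σ (λ α′ → Σ (λ b → χ α * χ (m ⊛ α ⊕ b) * (χ α′ * χ (m ⊛ α′ ⊕ b)))))
      ≡⟨ Σ-cong (λ α → Σ-cong (λ α′ → ≡.trans (Σ-cong (λ b →
           solve 4 (λ x y z w → x :* y :* (z :* w) := x :* z :* (y :* w)) ≡.refl (χ α) (χ (m ⊛ α ⊕ b)) (χ α′) (χ (m ⊛ α′ ⊕ b))))
           (Σ-*ˡ (χ α * χ α′) _))) ⟩
    Σ (λ α → Σ (λ α′ → χ α * χ α′ * pairs m α α′)) ∎
    where open +-*-Solver using (solve; _:*_; _:=_)

  pairs-diagonal : ∀ m {α α′} → α ≈ α′ → pairs m α α′ ≡ h₀
  pairs-diagonal m {α} {α′} eq = begin
    pairs m α α′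
      ≡⟨ Σ-cong (λ b → ≡.trans (≡.cong (χ (m ⊛ α ⊕ b) *_) (χ-resp (F.+-congʳ (F.*-congˡ (sym eq))))) (⟦⟧-idem (Pow? (m ⊛ α ⊕ b)))) ⟩
    Σ (λ b → χ (m ⊛ α ⊕ b)) ≡⟨ Σ-shift χ-resp (m ⊛ α) ⟩
    Σ χ ≡⟨ Σχ≡h₀ ⟩
    h₀ ∎

  -- After replacing b by b - mα, the two ordinates are b and b + (α′ - α) m. Since α′ - α is
  -- invertible, they run over all pairs of field elements as m and b vary.
  Σpairs-off-diagonal : ∀ {α α′} → ¬ α ≈ α′ → Σ (λ m → pairs m α α′) ≡ h₀ * h₀
  Σpairs-off-diagonal {α} {α′} neq = begin
    Σ (λ m → pairs m α α′) ≡⟨ Σ-cong (λ m → ≡.sym (Σ-shift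
         (λ x≈y → ≡.cong₂ _*_ (χ-resp (F.+-congˡ x≈y)) (χ-resp (F.+-congˡ x≈y))) (- (m ⊛ α)))) ⟩
    Σ (λ m → Σ (λ b → χ (m ⊛ α ⊕ (- (m ⊛ α) ⊕ b)) * χ (m ⊛ α′ ⊕ (- (m ⊛ α) ⊕ b))))
      ≡⟨ Σ-cong (λ m → Σ-cong (λ b → ≡.cong₂ _*_
           (χ-resp (FS.solve 2 (λ x b → x FS.:+ (FS.:- x FS.:+ b) FS.:= b) refl (m ⊛ α) b))
           (χ-resp (FS.solve 4 (λ m a a′ b → m FS.:* a′ FS.:+ (FS.:- (m FS.:* a) FS.:+ b) FS.:= b FS.:+ (a′ FS.:- a) FS.:* m) refl m α α′ b)))) ⟩
    Σ (λ m → Σ (λ b → χ b * χ (b ⊕ (α′ F.- α) ⊛ m))) ≡⟨ Σ-swap _ ⟩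
    Σ (λ b → Σ (λ m → χ b * χ (b ⊕ (α′ F.- α) ⊛ m)))
      ≡⟨ Σ-cong (λ b → ≡.trans (Σ-*ˡ (χ b) _) (≡.cong (χ b *_)
           (≡.trans (Σ-scale (λ x≈y → χ-resp (F.+-congˡ x≈y)) α′-α≉0) (Σ-shift χ-resp b)))) ⟩
    Σ (λ b → χ b * Σ χ) ≡⟨ Σ-*ʳ (Σ χ) χ ⟩
    Σ χ * Σ χ ≡⟨ ≡.cong₂ _*_ Σχ≡h₀ Σχ≡h₀ ⟩
    h₀ * h₀ ∎
    where
    α′-α≉0 : ¬ α′ F.- α ≈ 0#
    α′-α≉0 eq = neq (sym (x∙y⁻¹≈ε⇒x≈y α′ α eq))

  second-moment : Σ T + h₀ * (h₀ * h₀) ≡ h₀ * h₀ * (h₀ * h₀) + h₀ * (suc s * h₀)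
  second-moment = begin
    Σ T + h₀ * (h₀ * h₀) ≡⟨ ≡.cong (_+ h₀ * (h₀ * h₀)) (≡.trans (Σ-cong T-pairs)
       (≡.trans (Σ-swap _) (Σ-cong (λ α → ≡.trans (Σ-swap _) (Σ-cong (λ α′ → Σ-*ˡ (χ α * χ α′) _)))))) ⟩
    Σ (λ α → Σ (λ α′ → χ α * χ α′ * S α α′)) + h₀ * (h₀ * h₀) ≡⟨ ≡.cong (Σ (λ α → Σ (λ α′ → χ α * χ α′ * S α α′)) +_) (diagonal (h₀ * h₀)) ⟨
    Σ (λ α → Σ (λ α′ → χ α * χ α′ * S α α′)) + Σ (λ α → Σ (λ α′ → χ α * χ α′ * (⟦ α′ ≟ α ⟧ * (h₀ * h₀))))
      ≡⟨ ΣΣ-+ _ _ ⟩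
    Σ (λ α → Σ (λ α′ → χ α * χ α′ * S α α′ + χ α * χ α′ * (⟦ α′ ≟ α ⟧ * (h₀ * h₀))))
      ≡⟨ Σ-cong (λ α → Σ-cong (λ α′ → ≡.trans (≡.sym (ℕₚ.*-distribˡ-+ (χ α * χ α′) _ _))
           (≡.trans (≡.cong (χ α * χ α′ *_) (by-cases α α′)) (ℕₚ.*-distribˡ-+ (χ α * χ α′) (h₀ * h₀) _)))) ⟩
    Σ (λ α → Σ (λ α′ → χ α * χ α′ * (h₀ * h₀) + χ α * χ α′ * (⟦ α′ ≟ α ⟧ * (suc s * h₀))))
      ≡⟨ ΣΣ-+ _ _ ⟨
    Σ (λ α → Σ (λ α′ → χ α * χ α′ * (h₀ * h₀))) + Σ (λ α → Σ (λ α′ → χ α * χ α′ * (⟦ α′ ≟ α ⟧ * (suc s * h₀))))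
      ≡⟨ ≡.cong₂ _+_ everything (diagonal (suc s * h₀)) ⟩
    h₀ * h₀ * (h₀ * h₀) + h₀ * (suc s * h₀) ∎
    where
    S : Carrier → Carrier → ℕ
    S α α′ = Σ (λ m → pairs m α α′)
    ΣΣ-+ : ∀ (u v : Carrier → Carrier → ℕ) → Σ (λ x → Σ (u x)) + Σ (λ x → Σ (v x)) ≡ Σ (λ x → Σ (λ y → u x y + v x y))
    ΣΣ-+ u v = ≡.trans (≡.sym (Σ-+ _ _)) (Σ-cong (λ x → ≡.sym (Σ-+ (u x) (v x))))
    everything : Σ (λ α → Σ (λ α′ → χ α * χ α′ * (h₀ * h₀))) ≡ h₀ * h₀ * (h₀ * h₀)
    everything = ≡.trans (Σ-cong (λ α → Σ-*ʳ (h₀ * h₀) _)) (≡.trans (Σ-*ʳ (h₀ * h₀) _)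
      (≡.cong (_* (h₀ * h₀)) (≡.trans (≡.sym (Σ-*Σ χ χ)) (≡.cong₂ _*_ Σχ≡h₀ Σχ≡h₀))))
    diagonal : ∀ e → Σ (λ α → Σ (λ α′ → χ α * χ α′ * (⟦ α′ ≟ α ⟧ * e))) ≡ h₀ * e
    diagonal e = begin
      Σ (λ α → Σ (λ α′ → χ α * χ α′ * (⟦ α′ ≟ α ⟧ * e)))
        ≡⟨ Σ-cong (λ α → Σ-cong (λ α′ → solve 4 (λ x y d e → x :* y :* (d :* e) := d :* (x :* y :* e)) ≡.refl (χ α) (χ α′) ⟦ α′ ≟ α ⟧ e)) ⟩
      Σ (λ α → Σ (λ α′ → ⟦ α′ ≟ α ⟧ * (χ α * χ α′ * e)))
        ≡⟨ Σ-cong (λ α → Σ-single (λ x≈y → ≡.cong (λ z → χ α * z * e) (χ-resp x≈y)) α) ⟩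
      Σ (λ α → χ α * χ α * e) ≡⟨ Σ-cong (λ α → ≡.cong (_* e) (⟦⟧-idem (Pow? α))) ⟩
      Σ (λ α → χ α * e) ≡⟨ Σ-*ʳ e χ ⟩
      Σ χ * e ≡⟨ ≡.cong (_* e) Σχ≡h₀ ⟩
      h₀ * e ∎
      where open +-*-Solver using (solve; _:*_; _:=_)
    by-cases : ∀ α α′ → S α α′ + ⟦ α′ ≟ α ⟧ * (h₀ * h₀) ≡ h₀ * h₀ + ⟦ α′ ≟ α ⟧ * (suc s * h₀)
    by-cases α α′ with α′ ≟ α
    ... | yes eq = begin
      S α α′ + 1 * (h₀ * h₀) ≡⟨ ≡.cong (_+ 1 * (h₀ * h₀)) (≡.trans (Σ-cong (λ m → pairs-diagonal m (sym eq))) (Σ-const h₀)) ⟩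
      q * h₀ + 1 * (h₀ * h₀) ≡⟨ ≡.cong (λ n → n * h₀ + 1 * (h₀ * h₀)) q≡1+s ⟩
      suc s * h₀ + 1 * (h₀ * h₀) ≡⟨ solve 2 (λ x y → x :+ con 1 :* y := y :+ con 1 :* x) ≡.refl (suc s * h₀) (h₀ * h₀) ⟩
      h₀ * h₀ + 1 * (suc s * h₀) ∎
      where open +-*-Solver using (solve; _:+_; _:*_; _:=_; con)
    ... | no neq = ≡.cong (_+ 0) (Σpairs-off-diagonal (neq ∘ sym))

  N-slope-0 : ∀ {m} → m ≈ 0# → ∀ b → N m b ≡ h₀ * χ b
  N-slope-0 m≈0 b = ≡.trans (Σ-cong (λ α → ≡.cong (χ α *_) (χ-resp (trans (F.+-congʳ (trans (F.*-congʳ m≈0) (F.zeroˡ α))) (F.+-identityˡ b)))))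
    (≡.trans (Σ-*ʳ (χ b) χ) (≡.cong (_* χ b) Σχ≡h₀))

  T-slope-0 : ∀ {m} → m ≈ 0# → T m ≡ h₀ * (h₀ * h₀)
  T-slope-0 m≈0 = begin
    T _ ≡⟨ Σ-cong (λ b → ≡.trans (≡.cong₂ _*_ (N-slope-0 m≈0 b) (N-slope-0 m≈0 b))
             (≡.trans (solve 2 (λ a x → a :* x :* (a :* x) := a :* a :* (x :* x)) ≡.refl h₀ (χ b)) (≡.cong (h₀ * h₀ *_) (⟦⟧-idem (Pow? b))))) ⟩
    Σ (λ b → h₀ * h₀ * χ b) ≡⟨ ≡.trans (Σ-*ˡ (h₀ * h₀) χ) (≡.cong (h₀ * h₀ *_) Σχ≡h₀) ⟩
    h₀ * h₀ * h₀ ≡⟨ ℕₚ.*-assoc h₀ h₀ h₀ ⟩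
    h₀ * (h₀ * h₀) ∎
    where open +-*-Solver using (solve; _:*_; _:=_)

  -- Multiplication by m in H maps H ∪ 0 onto itself, so every α gives a grid point.
  N-origin-Pow : ∀ {m} → Pow m → ¬ m ≈ 0# → N m 0# ≡ h₀
  N-origin-Pow {m} Pm m≉0 = ≡.trans (Σ-cong (λ α → ≡.trans (≡.cong (χ α *_) (⟦⟧-⇔ (Pow? _) (Pow? α)
      (λ p → Pow-cancel Pm m≉0 (Pow-resp (F.+-identityʳ _) p)) (λ p → Pow-resp (sym (F.+-identityʳ _)) (Pow-* Pm p))))
      (⟦⟧-idem (Pow? α)))) Σχ≡h₀

  -- A grid point (α, mα) with α ≠ 0 would make m a quotient of two powers; only the origin is left.
  N-origin-¬Pow : ∀ {m} → ¬ Pow m → N m 0# ≡ 1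
  N-origin-¬Pow {m} ¬Pm = ≡.trans (Σ-cong pointwise) Σδ≡1
    where
    pointwise : ∀ α → χ α * χ (m ⊛ α ⊕ 0#) ≡ δ α
    pointwise α with Pow? α | Pow? (m ⊛ α ⊕ 0#) | α ≟ 0#
    ... | yes _ | yes _ | yes _ = ≡.refl
    ... | yes p | yes p′ | no α≉0 = contradiction (Pow-cancel p α≉0 (Pow-resp (trans (F.+-identityʳ _) (F.*-comm m α)) p′)) ¬Pm
    ... | yes _ | no ¬p | yes α≈0 = contradiction (Pow-resp (sym (trans (F.+-identityʳ _) (trans (F.*-congˡ α≈0) (F.zeroʳ m)))) Pow-0) ¬p
    ... | yes _ | no _ | no _ = ≡.refl
    ... | no ¬p | _ | yes α≈0 = contradiction (Pow-resp (sym α≈0) Pow-0) ¬p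
    ... | no _ | _ | no _ = ≡.refl

  -- The nonzero x are partitioned by the value of x^k into h fibres. It is used with d = k in the
  -- large field and with d = gcd(k, q - 1) in the small one.
  fibre-bound : ∀ d → (∀ a → Σ (λ x → ⟦ ¬? (x ≟ 0#) ×-dec (x ↑ k ≟ a) ⟧) ≤ d) → s ≤ d * h
  fibre-bound d bound = ℕₚ.≤-trans (ℕₚ.≤-reflexive (begin
    s ≡⟨ Σε≡s ⟨
    Σ ε ≡⟨ Σ-cong pointwise ⟩
    Σ (λ x → Σ (λ a → ⟦ a ≟ x ↑ k ⟧ * (χ⁺ a * fib a x))) ≡⟨ Σ-swap _ ⟩
    Σ (λ a → Σ (λ x → ⟦ a ≟ x ↑ k ⟧ * (χ⁺ a * fib a x))) ∎))
    (ℕₚ.≤-trans (Σ-mono (λ a → ℕₚ.≤-trans (Σ-mono (λ x → ⟦⟧*n≤n (a ≟ x ↑ k) (χ⁺ a * fib a x))) (ℕₚ.≤-trans (ℕₚ.≤-reflexive (Σ-*ˡ (χ⁺ a) (fib a)))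
       (ℕₚ.*-monoʳ-≤ (χ⁺ a) (bound a)))))
    (ℕₚ.≤-reflexive (≡.trans (Σ-*ʳ d χ⁺) (ℕₚ.*-comm h d))))
    where
    fib : Carrier → Carrier → ℕ
    fib a x = ⟦ ¬? (x ≟ 0#) ×-dec (x ↑ k ≟ a) ⟧
    fib-resp : ∀ x → Respects (λ a → χ⁺ a * fib a x)
    fib-resp x a≈b = ≡.cong₂ _*_ (χ⁺-resp a≈b) (⟦⟧-⇔ (¬? (x ≟ 0#) ×-dec (x ↑ k ≟ _)) (¬? (x ≟ 0#) ×-dec (x ↑ k ≟ _))
      (λ (n , e) → n , trans e a≈b) (λ (n , e) → n , trans e (sym a≈b)))
    pointwise : ∀ x → ε x ≡ Σ (λ a → ⟦ a ≟ x ↑ k ⟧ * (χ⁺ a * fib a x))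
    pointwise x = ≡.sym (≡.trans (Σ-single (fib-resp x) (x ↑ k)) at-x^k)
      where
      at-x^k : χ⁺ (x ↑ k) * fib (x ↑ k) x ≡ ε x
      at-x^k with x ≟ 0#
      ... | yes _ = ℕₚ.*-zeroʳ (χ⁺ (x ↑ k))
      ... | no x≉0 = ≡.cong₂ _*_ (⟦⟧-yes (Pow? (x ↑ k) ×-dec ¬? (x ↑ k ≟ 0#)) ((x , refl) , ^-nonzero k x≉0))
          (⟦⟧-yes (¬? (no x≉0) ×-dec (x ↑ k ≟ x ↑ k)) (x≉0 , refl))

-- Sums of two powers in a large field

module TwoPowers {c ℓ} (F : CommutativeRing c ℓ) {q : ℕ} (isFF : IsFiniteField F q) (k-1 : ℕ) where
  open CommutativeRing F using (Carrier; _≈_; 0#; 1#; -_; refl; sym; trans; setoid; commutativeSemiring; ring)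
    renaming (_+_ to _⊕_; _*_ to _⊛_)
  open IsFiniteField isFF
  open FiniteField F isFF
  open Roots F using (power-fibre)
  open Moments F isFF k-1
  open import Algebra.Properties.CommutativeSemiring.Exp commutativeSemiring renaming (_^_ to _↑_)
  open import Algebra.Properties.Ring ring using (-0#≈0#)
  open import Data.Nat using (_+_; _*_)
  open ℕₚ.≤-Reasoning

  Σ-cauchy-supported : ∀ (w f : Carrier → ℕ) → (∀ x → w x * w x ≡ w x) → (∀ x → w x * f x ≡ f x) → Σ f * Σ f ≤ Σ w * Σ (λ x → f x * f x)
  Σ-cauchy-supported w f idem supp = begin
    Σ f * Σ f ≡⟨ ≡.cong₂ _*_ (Σ-cong supp) (Σ-cong supp) ⟨
    Σ (λ x → w x * f x) * Σ (λ x → w x * f x) ≤⟨ Σ-cauchy w f ⟩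
    Σ (λ x → w x * w x) * Σ (λ x → f x * f x) ≡⟨ ≡.cong (_* Σ (λ x → f x * f x)) (Σ-cong idem) ⟩
    Σ w * Σ (λ x → f x * f x) ∎

  -- The count at b = 0 is known exactly; it is cut off here so that Cauchy-Schwarz does not average
  -- it with the others.
  N⁺ : Carrier → Carrier → ℕ
  N⁺ m b = ε b * N m b

  S₁ S₂ : Carrier → ℕ
  S₁ m = Σ (N⁺ m)
  S₂ m = Σ (λ b → N⁺ m b * N⁺ m b)

  ε-idem : ∀ b → ε b * ε b ≡ ε b
  ε-idem b = ⟦⟧-idem (¬? (b ≟ 0#))

  N₀+S₁ : ∀ m → N m 0# + S₁ m ≡ h₀ * h₀
  N₀+S₁ m = ≡.trans (≡.sym (Σ-split (N-resp m))) (ΣN m)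

  T≡N₀²+S₂ : ∀ m → T m ≡ N m 0# * N m 0# + S₂ m
  T≡N₀²+S₂ m = ≡.trans (Σ-split (λ eq → ≡.cong₂ _*_ (N-resp m eq) (N-resp m eq)))
    (≡.cong (N m 0# * N m 0# +_) (Σ-cong (λ b → ≡.trans (≡.cong (_* (N m b * N m b)) (≡.sym (ε-idem b)))
      (solve 2 (λ e n → e :* e :* (n :* n) := e :* n :* (e :* n)) ≡.refl (ε b) (N m b)))))
    where open +-*-Solver using (solve; _:*_; _:=_)

  S₁²≤sS₂ : ∀ m → S₁ m * S₁ m ≤ s * S₂ m
  S₁²≤sS₂ m = ≡.subst (λ n → S₁ m * S₁ m ≤ n * S₂ m) Σε≡s (Σ-cauchy-supported ε (N⁺ m) ε-idem
    (λ b → ≡.trans (≡.sym (ℕₚ.*-assoc (ε b) (ε b) (N m b))) (≡.cong (_* N m b) (ε-idem b))))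

  s≤kh : s ≤ k * h
  s≤kh = fibre-bound k (λ a → count-≤ (λ x → ¬? (x ≟ 0#) ×-dec (x ↑ k ≟ a)) k
    (λ (f , inj , P) → power-fibre noZeroDivisors 1≉0 k-1 a f inj (proj₂ ∘ P)))

  module NotSum (c : Carrier) (none : ∀ {x y} → Pow x → Pow y → ¬ x ⊕ y ≈ c) where

    c≉0 : ¬ c ≈ 0#
    c≉0 c≈0 = none Pow-0 Pow-0 (trans (F.+-identityˡ 0#) (sym c≈0))

    c⁻¹ = proj₁ (inverse c c≉0)
    cc⁻¹≈1 = proj₂ (inverse c c≉0)

    w : Carrier → ℕ
    w b = χ⁻ (c⁻¹ ⊛ b)

    Σw≡g : Σ w ≡ g
    Σw≡g = Σ-scale {χ⁻} χ⁻-resp λ c⁻¹≈0 → 1≉0 (trans (sym cc⁻¹≈1) (trans (F.*-congˡ c⁻¹≈0) (F.zeroʳ c)))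

    -- Write η = -m and b = cγ. A grid point (α, β) on the line satisfies β + ηα = cγ, and dividing
    -- by γ exhibits c as a sum of two powers.
    N-vanishes : ∀ {m b} → Pow (- m) → ¬ b ≈ 0# → Pow (c⁻¹ ⊛ b) → N m b ≡ 0
    N-vanishes {m} {b} Pη b≉0 Pγ = ≡.trans (Σ-cong pointwise) (Σ-const 0 ⟫ ℕₚ.*-zeroʳ q)
      where
      _⟫_ = ≡.trans
      γ = c⁻¹ ⊛ b
      cγ≈b : c ⊛ γ ≈ b
      cγ≈b = trans (sym (F.*-assoc c c⁻¹ b)) (trans (F.*-congʳ cc⁻¹≈1) (F.*-identityˡ b))
      γ≉0 : ¬ γ ≈ 0#
      γ≉0 γ≈0 = b≉0 (trans (sym cγ≈b) (trans (F.*-congˡ γ≈0) (F.zeroʳ c)))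
      γ⁻¹ = proj₁ (inverse γ γ≉0)
      γγ⁻¹≈1 = proj₂ (inverse γ γ≉0)
      Pow-/γ : ∀ {x} → Pow x → Pow (γ⁻¹ ⊛ x)
      Pow-/γ {x} p = Pow-cancel Pγ γ≉0 (Pow-resp (sym (trans (sym (F.*-assoc γ γ⁻¹ x)) (trans (F.*-congʳ γγ⁻¹≈1) (F.*-identityˡ x)))) p)
      pointwise : ∀ α → χ α * χ (m ⊛ α ⊕ b) ≡ 0
      pointwise α with Pow? α | Pow? (m ⊛ α ⊕ b)
      ... | no _ | _ = ≡.refl
      ... | yes _ | no _ = ≡.refl
      ... | yes pα | yes pβ = contradiction (R.begin
        γ⁻¹ ⊛ (m ⊛ α ⊕ b) ⊕ γ⁻¹ ⊛ (- m ⊛ α)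
          R.≈⟨ FS.solve 4 (λ i m a b → i FS.:* (m FS.:* a FS.:+ b) FS.:+ i FS.:* (FS.:- m FS.:* a) FS.:= i FS.:* b) refl γ⁻¹ m α b ⟩
        γ⁻¹ ⊛ b R.≈⟨ F.*-congˡ cγ≈b ⟨
        γ⁻¹ ⊛ (c ⊛ γ) R.≈⟨ FS.solve 3 (λ i c g → i FS.:* (c FS.:* g) FS.:= c FS.:* (g FS.:* i)) refl γ⁻¹ c γ ⟩
        c ⊛ (γ ⊛ γ⁻¹) R.≈⟨ F.*-congˡ γγ⁻¹≈1 ⟩
        c ⊛ 1# R.≈⟨ F.*-identityʳ c ⟩
        c R.∎) (none (Pow-/γ pβ) (Pow-/γ (Pow-* Pη pα)))
        where import Relation.Binary.Reasoning.Setoid setoid as R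

    S₁²≤gS₂ : ∀ {m} → Pow (- m) → S₁ m * S₁ m ≤ g * S₂ m
    S₁²≤gS₂ {m} Pη = ≡.subst (λ n → S₁ m * S₁ m ≤ n * S₂ m) Σw≡g
      (Σ-cauchy-supported w (N⁺ m) (λ b → ⟦⟧-idem (¬? (Pow? (c⁻¹ ⊛ b)))) supp)
      where
      supp : ∀ b → w b * N⁺ m b ≡ N⁺ m b
      supp b with Pow? (c⁻¹ ⊛ b)
      ... | no _ = ℕₚ.*-identityˡ _
      ... | yes Pγ with b ≟ 0#
      ... | yes _ = ≡.refl
      ... | no b≉0 = ≡.sym (≡.trans (ℕₚ.*-identityˡ _) (N-vanishes Pη b≉0 Pγ))

    -- The values of `S₁` for slopes in H, namely h₀² - h₀, and for slopes that are not powers,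
    -- namely h₀² - 1.
    e d : ℕ
    e = h₀ * h
    d = h * (2 + h)

    -- The factor s g clears the denominators of the two Cauchy-Schwarz bounds S₁²/s and S₁²/g. The
    -- second one, valid for -m in H, is better by h S₁² because s = h + g; replacing S₁ by its
    -- lower bound `e` makes the surplus independent of the kind of m.
    S₂-bound : ∀ m → e ≤ S₁ m → g * (S₁ m * S₁ m) + χ⁺ (- m) * (h * (e * e)) ≤ s * g * S₂ m
    S₂-bound m e≤S₁ with Pow? (- m) ×-dec ¬? (- m ≟ 0#)
    ... | no _ = begin
      g * (S₁ m * S₁ m) + 0 ≡⟨ ℕₚ.+-identityʳ _ ⟩
      g * (S₁ m * S₁ m) ≤⟨ ℕₚ.*-monoʳ-≤ g (S₁²≤sS₂ m) ⟩
      g * (s * S₂ m) ≡⟨ solve 3 (λ g s x → g :* (s :* x) := s :* g :* x) ≡.refl g s (S₂ m) ⟩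
      s * g * S₂ m ∎
      where open +-*-Solver using (solve; _:*_; _:=_)
    ... | yes (Pη , _) = begin
      g * (S₁ m * S₁ m) + (h * (e * e) + 0)
        ≤⟨ ℕₚ.+-monoʳ-≤ (g * (S₁ m * S₁ m)) (ℕₚ.≤-trans (ℕₚ.≤-reflexive (ℕₚ.+-identityʳ _)) (ℕₚ.*-monoʳ-≤ h (ℕₚ.*-mono-≤ e≤S₁ e≤S₁))) ⟩
      g * (S₁ m * S₁ m) + h * (S₁ m * S₁ m) ≡⟨ solve 3 (λ g h x → g :* x :+ h :* x := (h :+ g) :* x) ≡.refl g h (S₁ m * S₁ m) ⟩
      s * (S₁ m * S₁ m) ≤⟨ ℕₚ.*-monoʳ-≤ s (S₁²≤gS₂ Pη) ⟩
      s * (g * S₂ m) ≡⟨ ℕₚ.*-assoc s g _ ⟨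
      s * g * S₂ m ∎
      where open +-*-Solver using (solve; _:+_; _:*_; _:=_)

    row-bound : ∀ m → δ m * (s * g * (h₀ * (h₀ * h₀))) + χ⁺ m * (s * g * (h₀ * h₀) + g * (e * e))
                        + χ⁻ m * (s * g + g * (d * d)) + χ⁺ (- m) * (h * (e * e)) ≤ s * g * T m
    row-bound m with m ≟ 0# | Pow? m
    ... | yes m≈0 | no ¬p = contradiction (Pow-resp (sym m≈0) Pow-0) ¬p
    ... | yes m≈0 | yes _ = begin
      1 * (s * g * (h₀ * (h₀ * h₀))) + 0 + 0 + χ⁺ (- m) * (h * (e * e))
        ≡⟨ ≡.cong (λ n → 1 * (s * g * (h₀ * (h₀ * h₀))) + 0 + 0 + n * (h * (e * e)))
             (⟦⟧-no (Pow? (- m) ×-dec ¬? (- m ≟ 0#)) λ (_ , ≉0) → ≉0 (trans (F.-‿cong m≈0) -0#≈0#)) ⟩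
      1 * (s * g * (h₀ * (h₀ * h₀))) + 0 + 0 + 0
        ≡⟨ solve 1 (λ x → con 1 :* x :+ con 0 :+ con 0 :+ con 0 := x) ≡.refl (s * g * (h₀ * (h₀ * h₀))) ⟩
      s * g * (h₀ * (h₀ * h₀)) ≡⟨ ≡.cong (s * g *_) (T-slope-0 m≈0) ⟨
      s * g * T m ∎
      where open +-*-Solver using (solve; _:+_; _:*_; _:=_; con)
    ... | no m≉0 | yes Pm = begin
      0 + 1 * (s * g * (h₀ * h₀) + g * (e * e)) + 0 + χ⁺ (- m) * (h * (e * e))
        ≡⟨ solve 3 (λ x y z → con 0 :+ con 1 :* (x :+ y) :+ con 0 :+ z := x :+ (y :+ z)) ≡.refl (s * g * (h₀ * h₀)) (g * (e * e)) (χ⁺ (- m) * (h * (e * e))) ⟩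
      s * g * (h₀ * h₀) + (g * (e * e) + χ⁺ (- m) * (h * (e * e)))
        ≡⟨ ≡.cong (λ n → s * g * (h₀ * h₀) + (g * (n * n) + χ⁺ (- m) * (h * (e * e)))) S₁≡e ⟨
      s * g * (h₀ * h₀) + (g * (S₁ m * S₁ m) + χ⁺ (- m) * (h * (e * e)))
        ≤⟨ ℕₚ.+-monoʳ-≤ (s * g * (h₀ * h₀)) (S₂-bound m (ℕₚ.≤-reflexive (≡.sym S₁≡e))) ⟩
      s * g * (h₀ * h₀) + s * g * S₂ m ≡⟨ ℕₚ.*-distribˡ-+ (s * g) _ _ ⟨
      s * g * (h₀ * h₀ + S₂ m) ≡⟨ ≡.cong (λ n → s * g * (n * n + S₂ m)) (N-origin-Pow Pm m≉0) ⟨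
      s * g * (N m 0# * N m 0# + S₂ m) ≡⟨ ≡.cong (s * g *_) (T≡N₀²+S₂ m) ⟨
      s * g * T m ∎
      where
      open +-*-Solver using (solve; _:+_; _:*_; _:=_; con)
      S₁≡e : S₁ m ≡ e
      S₁≡e = ℕₚ.+-cancelˡ-≡ h₀ _ _ (≡.trans (≡.cong (_+ S₁ m) (≡.sym (N-origin-Pow Pm m≉0)))
        (≡.trans (N₀+S₁ m) (solve 1 (λ h → (con 1 :+ h) :* (con 1 :+ h) := con 1 :+ h :+ (con 1 :+ h) :* h) ≡.refl h)))
    ... | no _ | no ¬Pm = begin
      0 + 0 + 1 * (s * g + g * (d * d)) + χ⁺ (- m) * (h * (e * e))
        ≡⟨ solve 3 (λ x y z → con 0 :+ con 0 :+ con 1 :* (x :+ y) :+ z := x :* (con 1 :* con 1) :+ (y :+ z)) ≡.refl (s * g) (g * (d * d)) (χ⁺ (- m) * (h * (e * e))) ⟩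
      s * g * (1 * 1) + (g * (d * d) + χ⁺ (- m) * (h * (e * e)))
        ≡⟨ ≡.cong (λ n → s * g * (1 * 1) + (g * (n * n) + χ⁺ (- m) * (h * (e * e)))) S₁≡d ⟨
      s * g * (1 * 1) + (g * (S₁ m * S₁ m) + χ⁺ (- m) * (h * (e * e)))
        ≤⟨ ℕₚ.+-monoʳ-≤ (s * g * (1 * 1)) (S₂-bound m (ℕₚ.≤-trans e≤d (ℕₚ.≤-reflexive (≡.sym S₁≡d)))) ⟩
      s * g * (1 * 1) + s * g * S₂ m ≡⟨ ℕₚ.*-distribˡ-+ (s * g) _ _ ⟨
      s * g * (1 * 1 + S₂ m) ≡⟨ ≡.cong (λ n → s * g * (n * n + S₂ m)) (N-origin-¬Pow ¬Pm) ⟨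
      s * g * (N m 0# * N m 0# + S₂ m) ≡⟨ ≡.cong (s * g *_) (T≡N₀²+S₂ m) ⟨
      s * g * T m ∎
      where
      open +-*-Solver using (solve; _:+_; _:*_; _:=_; con)
      S₁≡d : S₁ m ≡ d
      S₁≡d = ℕₚ.+-cancelˡ-≡ 1 _ _ (≡.trans (≡.cong (_+ S₁ m) (≡.sym (N-origin-¬Pow ¬Pm)))
        (≡.trans (N₀+S₁ m) (solve 1 (λ h → (con 1 :+ h) :* (con 1 :+ h) := con 1 :+ h :* (con 2 :+ h)) ≡.refl h)))
      e≤d : e ≤ d
      e≤d = ℕₚ.≤-trans (ℕₚ.≤-reflexive (ℕₚ.*-comm h₀ h)) (ℕₚ.*-monoʳ-≤ h (ℕₚ.n≤1+n h₀))

    total-bound : s * g * (h₀ * (h₀ * h₀)) + h * (s * g * (h₀ * h₀) + g * (e * e))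
                    + g * (s * g + g * (d * d)) + h * (h * (e * e)) ≤ s * g * Σ T
    total-bound = begin
      A + h * B + g * C + h * D ≡⟨ ≡.cong₂ _+_ (≡.cong₂ _+_ (≡.cong₂ _+_
          (≡.sym (≡.trans (Σ-*ʳ A δ) (≡.trans (≡.cong (_* A) Σδ≡1) (ℕₚ.*-identityˡ A))))
          (≡.sym (Σ-*ʳ B χ⁺))) (≡.sym (Σ-*ʳ C χ⁻)))
          (≡.sym (≡.trans (Σ-*ʳ D (λ m → χ⁺ (- m))) (≡.cong (_* D) (Σ-neg {χ⁺} χ⁺-resp)))) ⟩
      Σ (λ m → δ m * A) + Σ (λ m → χ⁺ m * B) + Σ (λ m → χ⁻ m * C) + Σ (λ m → χ⁺ (- m) * D)
        ≡⟨ ≡.trans (≡.cong (_+ Σ (λ m → χ⁺ (- m) * D)) (≡.trans (≡.cong (_+ Σ (λ m → χ⁻ m * C)) (≡.sym (Σ-+ _ _))) (≡.sym (Σ-+ _ _)))) (≡.sym (Σ-+ _ _)) ⟩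
      Σ (λ m → δ m * A + χ⁺ m * B + χ⁻ m * C + χ⁺ (- m) * D) ≤⟨ Σ-mono row-bound ⟩
      Σ (λ m → s * g * T m) ≡⟨ Σ-*ˡ (s * g) T ⟩
      s * g * Σ T ∎
      where
      A = s * g * (h₀ * (h₀ * h₀))
      B = s * g * (h₀ * h₀) + g * (e * e)
      C = s * g + g * (d * d)
      D = h * (e * e)

  two-powers : k-1 * k-1 * (k-1 * k-1) < q → ∀ c → ∃₂ λ x y → x ↑ k ⊕ y ↑ k ≈ c
  two-powers k-1⁴<q c with search {P = λ x → Pow (c F.- x ↑ k)} (λ x≈y → Pow-resp (F.+-congˡ (F.-‿cong (^-congˡ k x≈y)))) (λ x → Pow? (c F.- x ↑ k))
  ... | yes (x , y , eq) = x , y , trans (F.+-congˡ eq) (FS.solve 2 (λ a c → a FS.:+ (c FS.:- a) FS.:= c) refl (x ↑ k) c)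
  ... | no none = ⊥-elim (impossible k-1 ≡.refl)
    where
    none′ : ∀ {x y} → Pow x → Pow y → ¬ x ⊕ y ≈ c
    none′ {x} {y} (u , u^k≈x) py x+y≈c = none (u , Pow-resp (trans
      (FS.solve 2 (λ x y → y FS.:= x FS.:+ y FS.:- x) refl x y) (F.+-cong x+y≈c (F.-‿cong (sym u^k≈x)))) py)
    impossible : ∀ j → j ≡ k-1 → ⊥
    -- For k = 1 every c is itself a power. The inequality is written with j = `suc i` and covers
    -- only k ≥ 2.
    impossible zero ≡.refl = none′ (c , F.*-identityʳ c) Pow-0 (F.+-identityʳ c)
    impossible (suc i) ≡.refl = MomentInequality.moment-contradiction h g (Σ T) i h≥1 second-moment (NotSum.total-bound c none′)
      (ℕₚ.+-cancelˡ-≤ h g (k-1 * h) s≤kh) (ℕₚ.≤-pred (≡.subst (k-1 * k-1 * (k-1 * k-1) <_) q≡1+s k-1⁴<q))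

-- Sums of eight powers

module LargeSubsets where
  open import Data.Nat using (_+_; _*_)
  open +-*-Solver
  open ℕₚ.≤-Reasoning

  -- If 2y ≤ s + 2, then 2s (h + 1)² ≤ (s + 2)(h² + s), and s ≤ h² with h ≤ s bounds the right side
  -- by 2sh² + 2s + 2sh. What remains is 4sh ≤ 2sh.
  more-than-half : ∀ h s y → 1 ≤ h → h ≤ s → s ≤ h * h → s * (suc h * suc h) ≤ y * (h * h + s) → suc (suc s) < y + y
  more-than-half h s y h≥1 h≤s s≤hh le with suc (suc s) ℕ.<? y + y
  ... | yes p = p
  ... | no ≮ = contradiction (ℕₚ.+-cancelˡ-≤ R (4 * (s * h)) (2 * (s * h)) (begin
      R + 4 * (s * h)
        ≡⟨ solve 2 (λ s h → con 2 :* (s :* (h :* h)) :+ con 2 :* s :+ con 4 :* (s :* h) := con 2 :* (s :* ((con 1 :+ h) :* (con 1 :+ h)))) ≡.refl s h ⟩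
      2 * (s * (suc h * suc h)) ≤⟨ ℕₚ.*-monoʳ-≤ 2 le ⟩
      2 * (y * (h * h + s)) ≡⟨ solve 2 (λ y x → con 2 :* (y :* x) := (y :+ y) :* x) ≡.refl y (h * h + s) ⟩
      (y + y) * (h * h + s) ≤⟨ ℕₚ.*-monoˡ-≤ (h * h + s) (ℕₚ.≮⇒≥ ≮) ⟩
      (2 + s) * (h * h + s)
        ≡⟨ solve 2 (λ h s → (con 2 :+ s) :* (h :* h :+ s) := s :* (h :* h) :+ s :* s :+ con 2 :* s :+ con 2 :* (h :* h)) ≡.refl h s ⟩
      s * (h * h) + s * s + 2 * s + 2 * (h * h)
        ≤⟨ ℕₚ.+-mono-≤ (ℕₚ.+-monoˡ-≤ (2 * s) (ℕₚ.+-monoʳ-≤ (s * (h * h)) (ℕₚ.*-monoʳ-≤ s s≤hh))) (ℕₚ.*-monoʳ-≤ 2 (ℕₚ.*-monoˡ-≤ h h≤s)) ⟩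
      s * (h * h) + s * (h * h) + 2 * s + 2 * (s * h)
        ≡⟨ solve 2 (λ s h → s :* (h :* h) :+ s :* (h :* h) :+ con 2 :* s :+ con 2 :* (s :* h) := con 2 :* (s :* (h :* h)) :+ con 2 :* s :+ con 2 :* (s :* h)) ≡.refl s h ⟩
      R + 2 * (s * h) ∎)) (ℕₚ.<⇒≱ (ℕₚ.*-monoˡ-< (s * h) {{ℕ.>-nonZero (ℕₚ.*-mono-≤ (ℕₚ.≤-trans h≥1 h≤s) h≥1)}} {2} {4} (s≤s (s≤s (s≤s z≤n)))))
    where
    R = 2 * (s * (h * h)) + 2 * s

module EightPowers {c ℓ} (F : CommutativeRing c ℓ) {q : ℕ} (isFF : IsFiniteField F q) (k-1 : ℕ) where
  open CommutativeRing F using (Carrier; _≈_; 0#; 1#; -_; refl; sym; trans; commutativeSemiring; ring)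
    renaming (_+_ to _⊕_; _*_ to _⊛_)
  open IsFiniteField isFF
  open FiniteField F isFF
  open Roots F using (power-fibre)
  open Moments F isFF k-1
  open TwoPowers F isFF k-1 using (Σ-cauchy-supported)
  open import Algebra.Properties.CommutativeSemiring.Exp commutativeSemiring renaming (_^_ to _↑_)
  open import Algebra.Properties.Ring ring using (x∙y⁻¹≈ε⇒x≈y; -1*x≈-x)
  open import Data.Nat using (_+_; _*_)
  open ℕₚ.≤-Reasoning

  data Sum⁺ : ℕ → Carrier → Set (c ⊔ ℓ) where
    nil  : ∀ {t} → t ≈ 0# → Sum⁺ 0 t
    cons : ∀ {n a t t′} → Pow a → ¬ a ≈ 0# → Sum⁺ n t → a ⊕ t ≈ t′ → Sum⁺ (suc n) t′

  Sum⁺-resp : ∀ {n x y} → x ≈ y → Sum⁺ n x → Sum⁺ n y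
  Sum⁺-resp x≈y (nil x≈0) = nil (trans (sym x≈y) x≈0)
  Sum⁺-resp x≈y (cons pa a≉0 ps eq) = cons pa a≉0 ps (trans eq x≈y)

  Sum⁺-+ : ∀ {m n x y} → Sum⁺ m x → Sum⁺ n y → Sum⁺ (m + n) (x ⊕ y)
  Sum⁺-+ (nil x≈0) qs = Sum⁺-resp (sym (trans (F.+-congʳ x≈0) (F.+-identityˡ _))) qs
  Sum⁺-+ (cons pa a≉0 ps eq) qs = cons pa a≉0 (Sum⁺-+ ps qs) (trans (sym (F.+-assoc _ _ _)) (F.+-congʳ eq))

  Sum≤ : ℕ → Carrier → Set (c ⊔ ℓ)
  Sum≤ n t = ∃ λ j → j ≤ n × Sum⁺ j t

  Pow⇒Sum≤ : ∀ {a} → Pow a → Sum≤ 1 a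
  Pow⇒Sum≤ {a} pa with a ≟ 0#
  ... | yes a≈0 = 0 , z≤n , nil a≈0
  ... | no a≉0 = 1 , ℕₚ.≤-refl , cons pa a≉0 (nil refl) (F.+-identityʳ a)

  Sum≤-+ : ∀ {m n x y} → Sum≤ m x → Sum≤ n y → Sum≤ (m + n) (x ⊕ y)
  Sum≤-+ (i , i≤m , ps) (j , j≤n , qs) = i + j , ℕₚ.+-mono-≤ i≤m j≤n , Sum⁺-+ ps qs

  Sum≤-resp : ∀ {n x y} → x ≈ y → Sum≤ n x → Sum≤ n y
  Sum≤-resp x≈y (j , j≤n , ps) = j , j≤n , Sum⁺-resp x≈y ps

  -- Membership in Y = H₀ - m H₀, where H₀ = H ∪ 0: the line y = mx + b meets the grid.
  InY : Carrier → Carrier → Set _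
  InY m b = ∃ λ α → Pow α × Pow (m ⊛ α ⊕ b)

  InY-resp : ∀ m {b b′} → b ≈ b′ → InY m b → InY m b′
  InY-resp m b≈b′ (α , p , p′) = α , p , Pow-resp (F.+-congˡ b≈b′) p′

  InY? : ∀ m b → Dec (InY m b)
  InY? m b = search (λ x≈y (p , p′) → Pow-resp x≈y p , Pow-resp (F.+-congʳ (F.*-congˡ x≈y)) p′) (λ α → Pow? α ×-dec Pow? (m ⊛ α ⊕ b))

  T-resp : Respects T
  T-resp x≈y = Σ-cong (λ b → ≡.cong₂ _*_ (N≡ b) (N≡ b))
    where
    N≡ : ∀ b → N _ b ≡ N _ b
    N≡ b = Σ-cong (λ α → ≡.cong (χ α *_) (χ-resp (F.+-congʳ (F.*-congʳ x≈y))))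

  -- Translating b by mα + mα′ exchanges the two factors of `pairs`. The argument needs large sets Y
  -- for both slopes m and -m.
  T-neg : ∀ m → T (- m) ≡ T m
  T-neg m = ≡.trans (T-pairs (- m)) (≡.trans (Σ-cong (λ α → Σ-cong (λ α′ → ≡.cong (χ α * χ α′ *_) (pairs-neg α α′)))) (≡.sym (T-pairs m)))
    where
    pairs-neg : ∀ α α′ → pairs (- m) α α′ ≡ pairs m α α′
    pairs-neg α α′ = ≡.trans (≡.sym (Σ-shift (λ x≈y → ≡.cong₂ _*_ (χ-resp (F.+-congˡ x≈y)) (χ-resp (F.+-congˡ x≈y))) (m ⊛ α ⊕ m ⊛ α′)))
      (Σ-cong (λ b → ≡.trans (ℕₚ.*-comm (χ (- m ⊛ α ⊕ (m ⊛ α ⊕ m ⊛ α′ ⊕ b))) _) (≡.cong₂ _*_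
        (χ-resp (FS.solve 4 (λ m a a′ b → FS.:- m FS.:* a′ FS.:+ (m FS.:* a FS.:+ m FS.:* a′ FS.:+ b) FS.:= m FS.:* a FS.:+ b) refl m α α′ b))
        (χ-resp (FS.solve 4 (λ m a a′ b → FS.:- m FS.:* a FS.:+ (m FS.:* a FS.:+ m FS.:* a′ FS.:+ b) FS.:= m FS.:* a′ FS.:+ b) refl m α α′ b)))))

  ∣Y∣ : Carrier → ℕ
  ∣Y∣ m = Σ (λ b → ⟦ InY? m b ⟧)

  ∣Y∣-bound : ∀ m → h₀ * h₀ * (h₀ * h₀) ≤ ∣Y∣ m * T m
  ∣Y∣-bound m = ≡.subst (λ n → n * n ≤ ∣Y∣ m * T m) (ΣN m) (Σ-cauchy-supported (λ b → ⟦ InY? m b ⟧) (N m) (λ b → ⟦⟧-idem (InY? m b)) supp)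
    where
    supp : ∀ b → ⟦ InY? m b ⟧ * N m b ≡ N m b
    supp b with InY? m b
    ... | yes _ = ℕₚ.*-identityˡ _
    ... | no ∉Y = ≡.sym (≡.trans (Σ-cong pointwise) (≡.trans (Σ-const 0) (ℕₚ.*-zeroʳ q)))
      where
      pointwise : ∀ α → χ α * χ (m ⊛ α ⊕ b) ≡ 0
      pointwise α with Pow? α | Pow? (m ⊛ α ⊕ b)
      ... | no _ | _ = ≡.refl
      ... | yes _ | no _ = ≡.refl
      ... | yes p | yes p′ = contradiction (α , p , p′) ∉Y

  1≤s : 1 ≤ s
  1≤s = ℕₚ.≤-trans h≥1 (ℕₚ.m≤m+n h g)

  -- By `ΣT` this is the sum of `T` over the s nonzero slopes, so some slope satisfies s T ≤ B by
  -- averaging.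
  B : ℕ
  B = h₀ * h₀ * (h * h + s)

  ΣT : Σ T ≡ h₀ * (h₀ * h₀) + B
  ΣT = ℕₚ.+-cancelʳ-≡ (h₀ * (h₀ * h₀)) _ _ (≡.trans second-moment
    (solve 2 (λ h s → let h₀ = con 1 :+ h in h₀ :* h₀ :* (h₀ :* h₀) :+ h₀ :* ((con 1 :+ s) :* h₀)
      := h₀ :* (h₀ :* h₀) :+ h₀ :* h₀ :* (h :* h :+ s) :+ h₀ :* (h₀ :* h₀)) ≡.refl h s))
    where open +-*-Solver using (solve; _:+_; _:*_; _:=_; con)

  slope : ∃ λ m → ¬ m ≈ 0# × s * T m ≤ B
  slope with search {P = λ m → ¬ m ≈ 0# × s * T m ≤ B}
                    (λ x≈y (≉0 , le) → (λ y≈0 → ≉0 (trans x≈y y≈0)) , ℕₚ.≤-trans (ℕₚ.≤-reflexive (≡.cong (s *_) (≡.sym (T-resp x≈y)))) le)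
                    (λ m → ¬? (m ≟ 0#) ×-dec (s * T m ℕ.≤? B))
  ... | yes found = found
  ... | no none = contradiction total (ℕₚ.<⇒≱ (ℕₚ.m<m+n _ 1≤s))
    where
    row : ∀ m → δ m * (s * (h₀ * (h₀ * h₀))) + ε m * suc B ≤ s * T m
    row m with m ≟ 0#
    ... | yes m≈0 = ℕₚ.≤-reflexive (≡.trans (≡.trans (ℕₚ.+-identityʳ _) (ℕₚ.*-identityˡ _)) (≡.cong (s *_) (≡.sym (T-slope-0 m≈0))))
    ... | no m≉0 = ℕₚ.≤-trans (ℕₚ.≤-reflexive (ℕₚ.*-identityˡ _)) (ℕₚ.≰⇒> λ le → none (m , m≉0 , le))
    total : s * Σ T + s ≤ s * Σ T
    total = begin
      s * Σ T + s ≡⟨ ≡.cong (λ n → s * n + s) ΣT ⟩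
      s * (h₀ * (h₀ * h₀) + B) + s
        ≡⟨ solve 3 (λ s a b → s :* (a :+ b) :+ s := con 1 :* (s :* a) :+ s :* (con 1 :+ b)) ≡.refl s (h₀ * (h₀ * h₀)) B ⟩
      1 * (s * (h₀ * (h₀ * h₀))) + s * suc B ≡⟨ ≡.cong₂ (λ a b → a * (s * (h₀ * (h₀ * h₀))) + b * suc B) Σδ≡1 Σε≡s ⟨
      Σ δ * (s * (h₀ * (h₀ * h₀))) + Σ ε * suc B ≡⟨ ≡.trans (Σ-+ _ _) (≡.cong₂ _+_ (Σ-*ʳ _ δ) (Σ-*ʳ _ ε)) ⟨
      Σ (λ m → δ m * (s * (h₀ * (h₀ * h₀))) + ε m * suc B) ≤⟨ Σ-mono row ⟩
      Σ (λ m → s * T m) ≡⟨ Σ-*ˡ s T ⟩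
      s * Σ T ∎
      where open +-*-Solver using (solve; _:+_; _:*_; _:=_; con)

  Y-large : s ≤ h * h → ∀ m → s * T m ≤ B → suc q < ∣Y∣ m + ∣Y∣ m
  Y-large s≤hh m le = ≡.subst (λ n → suc n < ∣Y∣ m + ∣Y∣ m) (≡.sym q≡1+s)
    (LargeSubsets.more-than-half h s (∣Y∣ m) h≥1 (ℕₚ.m≤m+n h g) s≤hh (ℕₚ.*-cancelˡ-≤ (h₀ * h₀) (begin
      h₀ * h₀ * (s * (h₀ * h₀)) ≡⟨ solve 2 (λ a s → a :* (s :* a) := s :* (a :* a)) ≡.refl (h₀ * h₀) s ⟩
      s * (h₀ * h₀ * (h₀ * h₀)) ≤⟨ ℕₚ.*-monoʳ-≤ s (∣Y∣-bound m) ⟩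
      s * (∣Y∣ m * T m) ≡⟨ solve 3 (λ s y t → s :* (y :* t) := y :* (s :* t)) ≡.refl s (∣Y∣ m) (T m) ⟩
      ∣Y∣ m * (s * T m) ≤⟨ ℕₚ.*-monoʳ-≤ (∣Y∣ m) le ⟩
      ∣Y∣ m * B ≡⟨ solve 3 (λ y a b → y :* (a :* b) := a :* (y :* b)) ≡.refl (∣Y∣ m) (h₀ * h₀) (h * h + s) ⟩
      h₀ * h₀ * (∣Y∣ m * (h * h + s)) ∎)))
    where open +-*-Solver using (solve; _:*_; _:=_)

  -- The sizes of Y and t - Y add up to at least q + 2, so these sets share two elements, and one of
  -- them is nonzero. The surplus matters for t = 0, where y = 0 would carry no information.
  Y+Y : ∀ m → suc q < ∣Y∣ m + ∣Y∣ m → ∀ t → ∃ λ y → ¬ y ≈ 0# × InY m y × InY m (t F.- y)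
  Y+Y m large t with search {P = λ y → ¬ y ≈ 0# × InY m y × InY m (t F.- y)}
      (λ x≈y (≉0 , p , p′) → (λ y≈0 → ≉0 (trans x≈y y≈0)) , InY-resp m x≈y p , InY-resp m (F.+-congˡ (F.-‿cong x≈y)) p′)
      (λ y → ¬? (y ≟ 0#) ×-dec (InY? m y ×-dec InY? m (t F.- y)))
  ... | yes found = found
  ... | no none = contradiction large (ℕₚ.≤⇒≯ (begin
    ∣Y∣ m + ∣Y∣ m ≡⟨ ≡.cong (∣Y∣ m +_) (≡.sym (≡.trans (Σ-neg (λ x≈y → f-resp (F.+-congˡ x≈y))) (Σ-shift {f} f-resp t))) ⟩
    Σ f + Σ (λ y → f (t F.- y)) ≡⟨ Σ-+ _ _ ⟨
    Σ (λ y → f y + f (t F.- y)) ≤⟨ Σ-mono row ⟩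
    Σ (λ y → δ y + 1) ≡⟨ Σ-+ δ (λ _ → 1) ⟩
    Σ δ + Σ (λ _ → 1) ≡⟨ ≡.cong₂ _+_ Σδ≡1 (≡.trans (Σ-const 1) (ℕₚ.*-identityʳ q)) ⟩
    suc q ∎))
    where
    f : Carrier → ℕ
    f y = ⟦ InY? m y ⟧
    f-resp : Respects f
    f-resp x≈y = ⟦⟧-⇔ (InY? m _) (InY? m _) (InY-resp m x≈y) (InY-resp m (sym x≈y))
    row : ∀ y → f y + f (t F.- y) ≤ δ y + 1
    row y with InY? m y | InY? m (t F.- y) | y ≟ 0#
    ... | yes _ | yes _ | yes _ = s≤s (s≤s z≤n)
    ... | yes p | yes p′ | no y≉0 = contradiction (y , y≉0 , p , p′) none
    ... | yes _ | no _ | yes _ = s≤s z≤n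
    ... | yes _ | no _ | no _ = s≤s z≤n
    ... | no _ | yes _ | yes _ = s≤s z≤n
    ... | no _ | yes _ | no _ = s≤s z≤n
    ... | no _ | no _ | _ = z≤n

  -- States m = (β + β′)/(α + α′) without division.
  Relation : Carrier → Set _
  Relation m = ∃₂ λ α α′ → ∃₂ λ β β′ → (Pow α × Pow α′ × Pow β × Pow β′) × ¬ α ⊕ α′ ≈ 0# × β ⊕ β′ ≈ m ⊛ (α ⊕ α′)

  Collision : Carrier → Carrier → Carrier → Carrier → Set _
  Collision m α α′ b = (¬ α ≈ α′) × Pow α × Pow α′ × Pow (m ⊛ α ⊕ b) × Pow (m ⊛ α′ ⊕ b)

  -- The grid has h₀² > q points, but there are only q lines of slope m. If none held two points,
  -- `T m` would equal h₀², against the Cauchy-Schwarz bound.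
  collision : s ≤ h * h → ∀ m → ∃ λ α → ∃ λ α′ → ∃ λ b → Collision m α α′ b
  collision s≤hh m with search (λ x≈y (α′ , b , p) → α′ , b , resp x≈y refl refl p)
                   (λ α → search (λ x≈y (b , p) → b , resp refl x≈y refl p)
                   (λ α′ → search (λ x≈y → resp refl refl x≈y)
                   (λ b → ¬? (α ≟ α′) ×-dec (Pow? α ×-dec (Pow? α′ ×-dec (Pow? (m ⊛ α ⊕ b) ×-dec Pow? (m ⊛ α′ ⊕ b)))))))
    where
    resp : ∀ {α α₁ α′ α₁′ b b₁} → α ≈ α₁ → α′ ≈ α₁′ → b ≈ b₁ → Collision m α α′ b → Collision m α₁ α₁′ b₁
    resp e e′ e″ (≉ , p , p′ , r , r′) = (λ eq → ≉ (trans e (trans eq (sym e′)))) , Pow-resp e p , Pow-resp e′ p′ ,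
      Pow-resp (F.+-cong (F.*-congˡ e) e″) r , Pow-resp (F.+-cong (F.*-congˡ e′) e″) r′
  ... | yes found = found
  ... | no none = contradiction (ℕₚ.*-cancelˡ-≤ (h₀ * h₀) (begin
      h₀ * h₀ * (h₀ * h₀) ≤⟨ ∣Y∣-bound m ⟩
      ∣Y∣ m * T m ≡⟨ ≡.cong (∣Y∣ m *_) T≡h₀² ⟩
      ∣Y∣ m * (h₀ * h₀) ≤⟨ ℕₚ.*-monoˡ-≤ (h₀ * h₀) ∣Y∣≤q ⟩
      q * (h₀ * h₀) ≡⟨ ℕₚ.*-comm q _ ⟩
      h₀ * h₀ * q ∎)) (ℕₚ.<⇒≱ (begin-strict
      q ≡⟨ q≡1+s ⟩
      suc s ≤⟨ s≤s s≤hh ⟩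
      suc (h * h) <⟨ s≤s (ℕₚ.m<n+m (h * h) {h + h} (ℕₚ.≤-trans h≥1 (ℕₚ.m≤m+n h h))) ⟩
      suc (h + h + h * h) ≡⟨ solve 1 (λ h → con 1 :+ (h :+ h :+ h :* h) := (con 1 :+ h) :* (con 1 :+ h)) ≡.refl h ⟩
      h₀ * h₀ ∎))
    where
    open +-*-Solver using (solve; _:+_; _:*_; _:=_; con)
    ∣Y∣≤q : ∣Y∣ m ≤ q
    ∣Y∣≤q = ℕₚ.≤-trans (Σ-mono (λ b → ≤1 (InY? m b))) (ℕₚ.≤-reflexive (≡.trans (Σ-const 1) (ℕₚ.*-identityʳ q)))
      where
      ≤1 : ∀ {a} {P : Set a} (d : Dec P) → ⟦ d ⟧ ≤ 1
      ≤1 (yes _) = s≤s z≤n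
      ≤1 (no _) = z≤n
    pointwise : ∀ α α′ → χ α * χ α′ * pairs m α α′ ≡ ⟦ α′ ≟ α ⟧ * (χ α * χ α′ * h₀)
    pointwise α α′ with α′ ≟ α
    ... | yes eq = ≡.trans (≡.cong (χ α * χ α′ *_) (pairs-diagonal m (sym eq))) (≡.sym (ℕₚ.*-identityˡ _))
    ... | no neq with Pow? α | Pow? α′
    ...   | no _ | _ = ≡.refl
    ...   | yes _ | no _ = ≡.refl
    ...   | yes p | yes p′ = ≡.trans (ℕₚ.*-identityˡ _) (≡.trans (Σ-cong zero-at) (≡.trans (Σ-const 0) (ℕₚ.*-zeroʳ q)))
      where
      zero-at : ∀ b → χ (m ⊛ α ⊕ b) * χ (m ⊛ α′ ⊕ b) ≡ 0
      zero-at b with Pow? (m ⊛ α ⊕ b) | Pow? (m ⊛ α′ ⊕ b)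
      ... | no _ | _ = ≡.refl
      ... | yes _ | no _ = ≡.refl
      ... | yes r | yes r′ = contradiction (α , α′ , b , (neq ∘ sym) , p , p′ , r , r′) none
    T≡h₀² : T m ≡ h₀ * h₀
    T≡h₀² = ≡.trans (T-pairs m) (≡.trans (Σ-cong (λ α → ≡.trans (Σ-cong (pointwise α))
      (≡.trans (Σ-single (λ x≈y → ≡.cong (λ z → χ α * z * h₀) (χ-resp x≈y)) α) (≡.cong (_* h₀) (⟦⟧-idem (Pow? α))))))
      (≡.trans (Σ-*ʳ h₀ χ) (≡.cong (_* h₀) Σχ≡h₀)))

  -- If −1 is a k-th power this is a collision of two points on a line of slope m;
  -- otherwise it is a nonzero element of Y ∩ −Y.
  relation : s ≤ h * h → ∀ m → suc q < ∣Y∣ m + ∣Y∣ m → Relation m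
  relation s≤hh m large with Pow? (- 1#)
  ... | yes P-1 with collision s≤hh m
  ...   | α , α′ , b , α≉α′ , p , p′ , r , r′ = α , - 1# ⊛ α′ , m ⊛ α ⊕ b , - 1# ⊛ (m ⊛ α′ ⊕ b) ,
          (p , Pow-* P-1 p′ , r , Pow-* P-1 r′) ,
          (λ eq → α≉α′ (x∙y⁻¹≈ε⇒x≈y α α′ (trans (F.+-congˡ (sym (-1*x≈-x α′))) eq))) ,
          FS.solve 4 (λ m a a′ b → m FS.:* a FS.:+ b FS.:+ FS.:- FS.con (1 , 0) FS.:* (m FS.:* a′ FS.:+ b) FS.:= m FS.:* (a FS.:+ FS.:- FS.con (1 , 0) FS.:* a′)) refl m α α′ b
  relation s≤hh m large | no ¬P-1 with Y+Y m large 0#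
  ... | y , y≉0 , (α , p , r) , (α′ , p′ , r′) = α , α′ , m ⊛ α ⊕ y , m ⊛ α′ ⊕ (0# F.- y) , (p , p′ , r , r′) ,
          (λ eq → y≉0 (trans (sym (trans (F.+-congʳ (trans (F.*-congˡ (antisymmetric p p′ eq)) (F.zeroʳ m))) (F.+-identityˡ y)))
            (antisymmetric r r′ (trans (β-sum y α α′) (trans (F.*-congˡ eq) (F.zeroʳ m)))))) ,
          β-sum y α α′
    where
    β-sum : ∀ y α α′ → m ⊛ α ⊕ y ⊕ (m ⊛ α′ ⊕ (0# F.- y)) ≈ m ⊛ (α ⊕ α′)
    β-sum y α α′ = FS.solve 4 (λ m a a′ y → m FS.:* a FS.:+ y FS.:+ (m FS.:* a′ FS.:+ (FS.con (0 , 0) FS.:- y)) FS.:= m FS.:* (a FS.:+ a′)) refl m α α′ y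
    antisymmetric : ∀ {x y} → Pow x → Pow y → x ⊕ y ≈ 0# → x ≈ 0#
    antisymmetric {x} {y} px py x+y≈0 = decidable-stable (x ≟ 0#) λ x≉0 → ¬P-1 (Pow-cancel px x≉0 (Pow-resp
      (trans (FS.solve 2 (λ x y → y FS.:= x FS.:+ y FS.:+ x FS.:* (FS.:- FS.con (1 , 0))) refl x y) (trans (F.+-congʳ x+y≈0) (F.+-identityˡ _))) py))

  -- With slope -m, y = b + ma for powers a and b. Multiplying by α + α′ absorbs m: the result is (α
  -- + α′) b + (β + β′) a, four products of powers.
  four-powers : ∀ m {α α′ β β′} → Pow α → Pow α′ → Pow β → Pow β′ → β ⊕ β′ ≈ m ⊛ (α ⊕ α′) →
                ∀ y → InY (- m) y → Sum≤ 4 ((α ⊕ α′) ⊛ y)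
  four-powers m {α} {α′} {β} {β′} pα pα′ pβ pβ′ eq y (a , pa , pb) = Sum≤-resp
    (trans (F.+-cong (sym (F.distribʳ _ α α′)) (sym (F.distribʳ a β β′))) (trans (F.+-congˡ (F.*-congʳ eq))
      (FS.solve 4 (λ v m a y → v FS.:* (FS.:- m FS.:* a FS.:+ y) FS.:+ m FS.:* v FS.:* a FS.:= v FS.:* y) refl (α ⊕ α′) m a y)))
    (Sum≤-+ (Sum≤-+ (Pow⇒Sum≤ (Pow-* pα pb)) (Pow⇒Sum≤ (Pow-* pα′ pb))) (Sum≤-+ (Pow⇒Sum≤ (Pow-* pβ pa)) (Pow⇒Sum≤ (Pow-* pβ′ pa))))

  -- Split t/v, with v = α + α′, into two elements of Y for the slope -m; multiplying back by v
  -- costs four powers for each.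
  relation⇒eight-powers : ∀ m → suc q < ∣Y∣ (- m) + ∣Y∣ (- m) → Relation m → ∀ t → Sum≤ 8 t
  relation⇒eight-powers m large (α , α′ , β , β′ , (pα , pα′ , pβ , pβ′) , v≉0 , eq) t =
    divide-by (inverse v v≉0)
    where
    v = α ⊕ α′
    divide-by : (∃ λ v⁻¹ → v ⊛ v⁻¹ ≈ 1#) → Sum≤ 8 t
    divide-by (v⁻¹ , vv⁻¹≈1) = add (Y+Y (- m) large (v⁻¹ ⊛ t))
      where
      add : (∃ λ y → ¬ y ≈ 0# × InY (- m) y × InY (- m) (v⁻¹ ⊛ t F.- y)) → Sum≤ 8 t
      add (y , _ , ∈Y , ∈Y′) = Sum≤-resp
        (trans (FS.solve 4 (λ v y i t → v FS.:* y FS.:+ v FS.:* (i FS.:* t FS.:- y) FS.:= v FS.:* i FS.:* t) refl v y v⁻¹ t)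
          (trans (F.*-congʳ vv⁻¹≈1) (F.*-identityˡ t)))
        (Sum≤-+ (four-powers m pα pα′ pβ pβ′ eq y ∈Y) (four-powers m pα pα′ pβ pβ′ eq (v⁻¹ ⊛ t F.- y) ∈Y′))

  eight-powers : s ≤ h * h → ∀ t → Sum≤ 8 t
  eight-powers s≤hh = from-slope slope
    where
    from-slope : (∃ λ m → ¬ m ≈ 0# × s * T m ≤ B) → ∀ t → Sum≤ 8 t
    from-slope (m , _ , sT≤B) = relation⇒eight-powers m
      (Y-large s≤hh (- m) (ℕₚ.≤-trans (ℕₚ.≤-reflexive (≡.cong (s *_) (T-neg m))) sT≤B)) (relation s≤hh m (Y-large s≤hh m sT≤B))

  ^s≈1 : ∀ {x} → ¬ x ≈ 0# → x ↑ s ≈ 1#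
  ^s≈1 {x} x≉0 = *-cancelˡ x≉0 (trans (trans (^-congʳ x (≡.sym q≡1+s)) (^-fixed x)) (sym (F.*-identityʳ x)))

  -- By Bézout the exponent gcd(k, s) is a combination of k and s, and s-th powers of nonzero
  -- elements are 1. This sharpens the bound for the fibres of x^k from k to gcd(k, q - 1).
  same-power : ∀ {x y} → ¬ x ≈ 0# → ¬ y ≈ 0# → x ↑ k ≈ y ↑ k → x ↑ gcd k s ≈ y ↑ gcd k s
  same-power {x} {y} x≉0 y≉0 eq = from-Bézout (gcd k s) (Bézout.identity (gcd-GCD k s))
    where
    multiple : ∀ a → x ↑ (a * k) ≈ y ↑ (a * k)
    multiple a = trans (^-congʳ x (ℕₚ.*-comm a k)) (trans (sym (^-assocʳ x k a))
      (trans (^-congˡ a eq) (trans (^-assocʳ y k a) (^-congʳ y (ℕₚ.*-comm k a)))))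
    ^-multiple-s : ∀ z b → ¬ z ≈ 0# → z ↑ (b * s) ≈ 1#
    ^-multiple-s z b z≉0 = trans (^-congʳ z (ℕₚ.*-comm b s)) (trans (sym (^-assocʳ z s b)) (trans (^-congˡ b (^s≈1 z≉0)) (1^n≈1 b)))
    from-Bézout : ∀ d → Bézout.Identity d k s → x ↑ d ≈ y ↑ d
    from-Bézout d (Bézout.+- a b d+bs≡ak) = trans (sym (absorb x x≉0)) (trans (multiple a) (absorb y y≉0))
      where
      absorb : ∀ z → ¬ z ≈ 0# → z ↑ (a * k) ≈ z ↑ d
      absorb z z≉0 = trans (^-congʳ z (≡.sym d+bs≡ak)) (trans (^-homo-* z d (b * s)) (trans (F.*-congˡ (^-multiple-s z b z≉0)) (F.*-identityʳ _)))
    from-Bézout d (Bézout.-+ a b d+ak≡bs) = *-cancelˡ (^-nonzero (a * k) x≉0)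
      (trans (F.*-comm _ _) (trans (product x x≉0) (trans (sym (product y y≉0)) (trans (F.*-comm _ _) (F.*-congʳ (sym (multiple a)))))))
      where
      product : ∀ z → ¬ z ≈ 0# → z ↑ d ⊛ z ↑ (a * k) ≈ 1#
      product z z≉0 = trans (sym (^-homo-* z d (a * k))) (trans (^-congʳ z d+ak≡bs) (^-multiple-s z b z≉0))

  -- From d² ≤ s ≤ dh follows d ≤ h, and then s ≤ dh ≤ h².
  s≤h² : gcd k s * gcd k s < q → s ≤ h * h
  s≤h² d²<q = ℕₚ.≤-trans s≤dh (ℕₚ.*-monoˡ-≤ h (ℕₚ.*-cancelˡ-≤ d {{ℕ.>-nonZero d≥1}} (ℕₚ.≤-trans (ℕₚ.≤-pred (≡.subst (d * d <_) q≡1+s d²<q)) s≤dh)))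
    where
    d = gcd k s
    d≥1 : 1 ≤ d
    d≥1 = ℕₚ.n≢0⇒n>0 λ d≡0 → contradiction (gcd[m,n]≡0⇒m≡0 {k} {s} d≡0) λ ()
    s≤dh : s ≤ d * h
    s≤dh = fibre-bound d λ a → count-≤ (λ x → ¬? (x ≟ 0#) ×-dec (x ↑ k ≟ a)) d λ (f , inj , P) →
      too-many d d≥1 f inj λ i → same-power (proj₁ (P i)) (proj₁ (P zero)) (trans (proj₂ (P i)) (sym (proj₂ (P zero))))
      where
      too-many : ∀ d → 1 ≤ d → (f : Fin (suc d) → Carrier) → (∀ i j → f i ≈ f j → i ≡ j) → ¬ (∀ i → f i ↑ d ≈ f zero ↑ d)
      too-many (suc d) _ f inj eq = power-fibre noZeroDivisors 1≉0 d (f zero ↑ suc d) f inj eq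

-- Extensions of finite fields

module Frobenius {c ℓ} (R : CommutativeRing c ℓ) where
  open CommutativeRing R hiding (zero)
  open Solver R
  open import Algebra.Properties.CommutativeSemiring.Exp commutativeSemiring
  open import Algebra.Properties.Semiring.Mult semiring using () renaming (_×_ to _·_)

  Additive : ℕ → Set _
  Additive n = ∀ x y → (x + y) ^ n ≈ x ^ n + y ^ n

  additive-1 : Additive 1
  additive-1 x y = trans (*-identityʳ _) (sym (+-cong (*-identityʳ x) (*-identityʳ y)))

  additive-* : ∀ {m n} → Additive m → Additive n → Additive (m ℕ.* n)
  additive-* {m} {n} hm hn x y = trans (sym (^-assocʳ _ m n)) (trans (^-congˡ n (hm x y))
    (trans (hn _ _) (+-cong (^-assocʳ x m n) (^-assocʳ y m n))))

  additive-^ : ∀ {m} → Additive m → ∀ n → Additive (m ℕ.^ n)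
  additive-^ hm zero = additive-1
  additive-^ {m} hm (suc n) = additive-* {m} hm (additive-^ hm n)

  additive-2 : 2 · 1# ≈ 0# → Additive 2
  additive-2 2≈0 x y = trans
    (solve 2 (λ x y → (x :+ y) :* ((x :+ y) :* con (1 , 0)) :=
       x :* (x :* con (1 , 0)) :+ y :* (y :* con (1 , 0)) :+ (con (1 , 0) :+ (con (1 , 0) :+ con (0 , 0))) :* (x :* y)) refl x y)
    (trans (+-congˡ (trans (*-congʳ 2≈0) (zeroˡ _))) (+-identityʳ _))

  additive-3 : 3 · 1# ≈ 0# → Additive 3
  additive-3 3≈0 x y = trans
    (solve 2 (λ x y → let o = con (1 , 0) in (x :+ y) :* ((x :+ y) :* ((x :+ y) :* o)) :=
       x :* (x :* (x :* o)) :+ y :* (y :* (y :* o)) :+ (o :+ (o :+ (o :+ con (0 , 0)))) :* (x :* x :* y :+ x :* y :* y)) refl x y)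
    (trans (+-congˡ (trans (*-congʳ 3≈0) (zeroˡ _))) (+-identityʳ _))

-- A polynomial, given by its list of coefficients, acts on a sequence with X acting
-- as the shift.  The polynomials modulo the annihilator of a fixed sequence u form a ring.
module SequenceRing {c ℓ} (F : CommutativeRing c ℓ) where
  open CommutativeRing F hiding (zero)
  open Solver F
  open import Relation.Binary.Reasoning.Setoid setoid

  Poly : Set c
  Poly = List Carrier

  Seq : Set c
  Seq = ℕ → Carrier

  act : Poly → Seq → Seq
  act [] v i = 0#
  act (a ∷ p) v i = a * v i + act p v (suc i)

  infixl 6 _⊞_
  infixl 7 _⊠_
  _⊞_ _⊠_ : Poly → Poly → Poly
  [] ⊞ q = q
  (a ∷ p) ⊞ [] = a ∷ p
  (a ∷ p) ⊞ (b ∷ q) = (a + b) ∷ (p ⊞ q)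
  [] ⊠ q = []
  (a ∷ p) ⊠ q = map (a *_) q ⊞ (0# ∷ (p ⊠ q))

  const : Carrier → Poly
  const a = a ∷ []

  one X : Poly
  one = const 1#
  X = 0# ∷ 1# ∷ []

  act-cong : ∀ p {v w : Seq} → (∀ i → v i ≈ w i) → ∀ i → act p v i ≈ act p w i
  act-cong [] eq i = refl
  act-cong (a ∷ p) eq i = +-cong (*-congˡ (eq i)) (act-cong p eq (suc i))

  act-⊞ : ∀ p q v i → act (p ⊞ q) v i ≈ act p v i + act q v i
  act-⊞ [] q v i = sym (+-identityˡ _)
  act-⊞ (a ∷ p) [] v i = sym (+-identityʳ _)
  act-⊞ (a ∷ p) (b ∷ q) v i = trans (+-congˡ (act-⊞ p q v (suc i)))
    (solve 5 (λ a b x y z → (a :+ b) :* x :+ (y :+ z) := a :* x :+ y :+ (b :* x :+ z)) refl a b (v i) _ _)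

  act-neg : ∀ p v i → act (map (-_) p) v i ≈ - act p v i
  act-neg [] v i = solve 0 (con (0 , 0) := :- con (0 , 0)) refl
  act-neg (a ∷ p) v i = trans (+-congˡ (act-neg p v (suc i)))
    (solve 3 (λ a x y → :- a :* x :+ :- y := :- (a :* x :+ y)) refl a (v i) _)

  act-scale : ∀ a p v i → act (map (a *_) p) v i ≈ a * act p v i
  act-scale a [] v i = sym (zeroʳ a)
  act-scale a (b ∷ p) v i = trans (+-congˡ (act-scale a p v (suc i)))
    (solve 4 (λ a b x y → a :* b :* x :+ a :* y := a :* (b :* x :+ y)) refl a b (v i) _)

  act-⊠ : ∀ p q v i → act (p ⊠ q) v i ≈ act p (act q v) i
  act-⊠ [] q v i = refl
  act-⊠ (a ∷ p) q v i = begin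
    act (map (a *_) q ⊞ (0# ∷ (p ⊠ q))) v i ≈⟨ act-⊞ (map (a *_) q) _ v i ⟩
    act (map (a *_) q) v i + (0# * v i + act (p ⊠ q) v (suc i)) ≈⟨ +-cong (act-scale a q v i) (trans (+-congʳ (zeroˡ _)) (+-identityˡ _)) ⟩
    a * act q v i + act (p ⊠ q) v (suc i) ≈⟨ +-congˡ (act-⊠ p q v (suc i)) ⟩
    a * act q v i + act p (act q v) (suc i) ∎

  act-zero : ∀ p {v} → (∀ i → v i ≈ 0#) → ∀ i → act p v i ≈ 0#
  act-zero [] eq i = refl
  act-zero (a ∷ p) eq i = trans (+-cong (trans (*-congˡ (eq i)) (zeroʳ a)) (act-zero p eq (suc i))) (+-identityʳ 0#)

  act-+ : ∀ p v w i → act p (λ i → v i + w i) i ≈ act p v i + act p w i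
  act-+ [] v w i = sym (+-identityʳ 0#)
  act-+ (a ∷ p) v w i = trans (+-congˡ (act-+ p v w (suc i)))
    (solve 5 (λ a x y z t → a :* (x :+ y) :+ (z :+ t) := a :* x :+ z :+ (a :* y :+ t)) refl a (v i) (w i) _ _)

  act-* : ∀ p a v i → act p (λ i → a * v i) i ≈ a * act p v i
  act-* [] a v i = sym (zeroʳ a)
  act-* (b ∷ p) a v i = trans (+-congˡ (act-* p a v (suc i)))
    (solve 4 (λ a b x y → b :* (a :* x) :+ a :* y := a :* (b :* x :+ y)) refl a b (v i) _)

  act-shift : ∀ p v i → act p (v ∘ suc) i ≈ act p v (suc i)
  act-shift [] v i = refl
  act-shift (a ∷ p) v i = +-congˡ (act-shift p v (suc i))

  act-comm : ∀ p q v i → act p (act q v) i ≈ act q (act p v) i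
  act-comm [] q v i = sym (act-zero q (λ _ → refl) i)
  act-comm (a ∷ p) q v i = begin
    a * act q v i + act p (act q v) (suc i)
      ≈⟨ +-cong (sym (act-* q a v i)) (trans (act-comm p q v (suc i)) (sym (act-shift q (act p v) i))) ⟩
    act q (λ i → a * v i) i + act q (λ i → act p v (suc i)) i ≈⟨ act-+ q _ _ i ⟨
    act q (act (a ∷ p) v) i ∎

  act-const : ∀ a v i → act (const a) v i ≈ a * v i
  act-const a v i = +-identityʳ _

  act-one : ∀ v i → act one v i ≈ v i
  act-one v i = trans (act-const 1# v i) (*-identityˡ _)

  act-X : ∀ v i → act X v i ≈ v (suc i)
  act-X v i = solve 2 (λ x y → con (0 , 0) :* x :+ (con (1 , 0) :* y :+ con (0 , 0)) := y) refl (v i) (v (suc i))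

  -- A record, so that p and q can be inferred from a proof of Same u p q.
  record Same (u : Seq) (p q : Poly) : Set ℓ where
    constructor same
    field at : ∀ i → act p u i ≈ act q u i
  open Same public

  ringOf : Seq → CommutativeRing c ℓ
  ringOf u = record
    { Carrier = Poly
    ; _≈_ = Same u
    ; _+_ = _⊞_
    ; _*_ = _⊠_
    ; -_ = map (-_)
    ; 0# = []
    ; 1# = one
    ; isCommutativeRing = record
      { isRing = record
        { +-isAbelianGroup = record
          { isGroup = record
            { isMonoid = record
              { isSemigroup = record
                { isMagma = record
                  { isEquivalence = record
                    { refl = same λ i → refl
                    ; sym = λ eq → same λ i → sym (at eq i)
                    ; trans = λ eq eq′ → same λ i → trans (at eq i) (at eq′ i)
                    }
                  ; ∙-cong = λ {p} {p′} {q} {q′} eq eq′ → same λ i →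
                      trans (act-⊞ p q u i) (trans (+-cong (at eq i) (at eq′ i)) (sym (act-⊞ p′ q′ u i)))
                  }
                ; assoc = λ p q r → same λ i → trans (trans (act-⊞ (p ⊞ q) r u i) (+-congʳ (act-⊞ p q u i)))
                    (trans (+-assoc _ _ _) (sym (trans (act-⊞ p (q ⊞ r) u i) (+-congˡ (act-⊞ q r u i)))))
                }
              ; identity = (λ p → same λ i → refl) , (λ p → same λ i → trans (act-⊞ p [] u i) (+-identityʳ _))
              }
            ; inverse = (λ p → same λ i → trans (act-⊞ (map (-_) p) p u i) (trans (+-congʳ (act-neg p u i)) (-‿inverseˡ _)))
                      , (λ p → same λ i → trans (act-⊞ p (map (-_) p) u i) (trans (+-congˡ (act-neg p u i)) (-‿inverseʳ _)))
            ; ⁻¹-cong = λ {p} {q} eq → same λ i → trans (act-neg p u i) (trans (-‿cong (at eq i)) (sym (act-neg q u i)))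
            }
          ; comm = λ p q → same λ i → trans (act-⊞ p q u i) (trans (+-comm _ _) (sym (act-⊞ q p u i)))
          }
        ; *-cong = λ {p} {p′} {q} {q′} eq eq′ → same λ i → begin
            act (p ⊠ q) u i ≈⟨ act-⊠ p q u i ⟩
            act p (act q u) i ≈⟨ act-cong p (at eq′) i ⟩
            act p (act q′ u) i ≈⟨ act-comm p q′ u i ⟩
            act q′ (act p u) i ≈⟨ act-cong q′ (at eq) i ⟩
            act q′ (act p′ u) i ≈⟨ act-comm p′ q′ u i ⟨
            act p′ (act q′ u) i ≈⟨ act-⊠ p′ q′ u i ⟨
            act (p′ ⊠ q′) u i ∎
        ; *-assoc = λ p q r → same λ i → trans (act-⊠ (p ⊠ q) r u i) (trans (act-⊠ p q (act r u) i)
            (sym (trans (act-⊠ p (q ⊠ r) u i) (act-cong p (act-⊠ q r u) i))))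
        ; *-identity = (λ p → same λ i → trans (act-⊠ one p u i) (act-one (act p u) i))
                     , (λ p → same λ i → trans (act-⊠ p one u i) (act-cong p (act-one u) i))
        ; distrib = (λ p q r → same λ i → trans (act-⊠ p (q ⊞ r) u i) (trans (act-cong p (act-⊞ q r u) i) (trans (act-+ p _ _ i)
                        (sym (trans (act-⊞ (p ⊠ q) (p ⊠ r) u i) (+-cong (act-⊠ p q u i) (act-⊠ p r u i)))))))
                  , (λ p q r → same λ i → trans (act-⊠ (q ⊞ r) p u i) (trans (act-⊞ q r (act p u) i)
                        (sym (trans (act-⊞ (q ⊠ p) (r ⊠ p) u i) (+-cong (act-⊠ q p u i) (act-⊠ r p u i))))))
        }
      ; *-comm = λ p q → same λ i → trans (act-⊠ p q u i) (trans (act-comm p q u i) (sym (act-⊠ q p u i)))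
      }
    }

  pow : Poly → ℕ → Poly
  pow p zero = one
  pow p (suc n) = p ⊠ pow p n

  pow-X : ∀ n v i → act (pow X n) v i ≈ v (n ℕ.+ i)
  pow-X zero v i = act-one v i
  pow-X (suc n) v i = trans (act-⊠ X (pow X n) v i) (trans (act-X (act (pow X n) v) i)
    (trans (pow-X n v (suc i)) (reflexive (≡.cong v (ℕₚ.+-suc n i)))))

  Periodic : ℕ → Seq → Set ℓ
  Periodic N u = ∀ i → u (N ℕ.+ i) ≈ u i

  act-periodic : ∀ {N u} → Periodic N u → ∀ p → Periodic N (act p u)
  act-periodic per [] i = refl
  act-periodic {N} {u} per (a ∷ p) i = +-cong (*-congˡ (per i))
    (trans (reflexive (≡.cong (act p u) (≡.sym (ℕₚ.+-suc N i)))) (act-periodic per p (suc i)))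

-- Cutting the polynomial ring of a periodic sequence down to a field

module SequenceField {c ℓ} (F : CommutativeRing c ℓ) {q : ℕ} (isFF : IsFiniteField F q) (M : ℕ) where
  open CommutativeRing F hiding (zero)
  open IsFiniteField isFF
  open FiniteField F isFF
  open SequenceRing F
  open Solver F
  open import Relation.Binary.Reasoning.Setoid setoid
  module ΣF = MonoidSum +-commutativeMonoid

  N : ℕ
  N = suc M

  periodic-mod : ∀ {u} → Periodic N u → ∀ i → u i ≈ u (i % N)
  periodic-mod {u} per i = trans (reflexive (≡.cong u (≡.trans (m≡m%n+[m/n]*n i N) (ℕₚ.+-comm (i % N) _)))) (many (i / N))
    where
    many : ∀ t → u (t ℕ.* N ℕ.+ i % N) ≈ u (i % N)
    many zero = refl
    many (suc t) = trans (reflexive (≡.cong u (ℕₚ.+-assoc N (t ℕ.* N) (i % N)))) (trans (per _) (many t))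

  same-on-period : ∀ {u v : Seq} → Periodic N u → Periodic N v → (∀ (i : Fin N) → u (toℕ i) ≈ v (toℕ i)) → ∀ i → u i ≈ v i
  same-on-period {u} {v} pu pv eq i = begin
    u i ≈⟨ periodic-mod pu i ⟩
    u (i % N) ≡⟨ ≡.cong u (toℕ-fromℕ< (m%n<n i N)) ⟨
    u (toℕ (fromℕ< (m%n<n i N))) ≈⟨ eq (fromℕ< (m%n<n i N)) ⟩
    v (toℕ (fromℕ< (m%n<n i N))) ≡⟨ ≡.cong v (toℕ-fromℕ< (m%n<n i N)) ⟩
    v (i % N) ≈⟨ periodic-mod pv i ⟨
    v i ∎

  same? : ∀ {u} → Periodic N u → ∀ p q → Dec (Same u p q)
  same? {u} per p q = map′ (λ eq → same (same-on-period (act-periodic per p) (act-periodic per q) eq)) (λ eq i → at eq (toℕ i))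
    (all? (λ i → act p u (toℕ i) ≟ act q u (toℕ i)))

  act-tabulate : ∀ {m} (f : Fin m → Carrier) v j → act (tabulate f) v j ≈ ΣF.sum (λ i → f i * v (toℕ i ℕ.+ j))
  act-tabulate {zero} f v j = refl
  act-tabulate {suc m} f v j = +-congˡ (trans (act-tabulate (f ∘ suc) v (suc j))
    (ΣF.sum-cong-≋ {m} (λ i → *-congˡ (reflexive (≡.cong v (ℕₚ.+-suc (toℕ i) j))))))

  -- X^N acts as 1 on a sequence of period N, so multiplication by X moves the last of N
  -- coefficients to the front, where it joins a.
  cover : ∀ {u} → Periodic N u → ∀ y → ∃ λ (f : Fin N → Carrier) → Same u y (tabulate f)
  cover {u} per [] = (λ _ → 0#) , same λ i → sym (trans (act-tabulate {N} (λ _ → 0#) u i)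
    (trans (ΣF.sum-cong-≋ {N} (λ j → zeroˡ (u (toℕ j ℕ.+ i)))) (ΣF.sum-replicate-zero N)))
  cover {u} per (a ∷ y) with cover per y
  ... | f , eq = f′ , same λ i → begin
    a * u i + act y u (suc i)
      ≈⟨ +-congˡ (trans (at eq (suc i)) (trans (act-tabulate f u (suc i)) (ΣF.sum-init-last (λ j → f j * u (toℕ j ℕ.+ suc i))))) ⟩
    a * u i + (ΣF.sum {M} (λ j → f (inject₁ j) * u (toℕ (inject₁ j) ℕ.+ suc i)) + f (fromℕ M) * u (toℕ (fromℕ M) ℕ.+ suc i))
      ≈⟨ +-congˡ (+-cong (ΣF.sum-cong-≋ {M} (λ j → *-congˡ (reflexive (≡.cong u (≡.trans (≡.cong (ℕ._+ suc i) (toℕ-inject₁ j)) (ℕₚ.+-suc (toℕ j) i))))))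
           (*-congˡ (trans (reflexive (≡.cong u (≡.trans (≡.cong (ℕ._+ suc i) (toℕ-fromℕ M)) (ℕₚ.+-suc M i)))) (per i)))) ⟩
    a * u i + (ΣF.sum {M} (λ j → f (inject₁ j) * u (suc (toℕ j) ℕ.+ i)) + f (fromℕ M) * u i)
      ≈⟨ solve 4 (λ a b x S → a :* x :+ (S :+ b :* x) := (a :+ b) :* x :+ S) refl a (f (fromℕ M)) (u i) _ ⟩
    (a + f (fromℕ M)) * u i + ΣF.sum {M} (λ j → f (inject₁ j) * u (suc (toℕ j) ℕ.+ i)) ≈⟨ act-tabulate f′ u i ⟨
    act (tabulate f′) u i ∎
    where
    f′ : Fin N → Carrier
    f′ zero = a + f (fromℕ M)
    f′ (suc j) = f (inject₁ j)

  words : Fin (q ℕ.^ N) → Poly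
  words j = tabulate (enum ∘ finToFun {q} {N} j)

  words-cover : ∀ {u} → Periodic N u → ∀ y → ∃ λ j → Same u y (words j)
  words-cover {u} per y with cover per y
  ... | f , eq = funToFin (index ∘ f) , same λ i → begin
    act y u i ≈⟨ trans (at eq i) (act-tabulate f u i) ⟩
    ΣF.sum {N} (λ j → f j * u (toℕ j ℕ.+ i))
      ≈⟨ ΣF.sum-cong-≋ {N} (λ j → *-congʳ {u (toℕ j ℕ.+ i)} (trans (sym (enum-index (f j))) (reflexive (≡.cong enum (≡.sym (finToFun-funToFin {N} {q} (index ∘ f) j)))))) ⟩
    ΣF.sum {N} (λ j → enum (finToFun {q} {N} (funToFin (index ∘ f)) j) * u (toℕ j ℕ.+ i))
      ≈⟨ act-tabulate {N} (enum ∘ finToFun {q} {N} (funToFin (index ∘ f))) u i ⟨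
    act (words (funToFin (index ∘ f))) u i ∎

  -- Required for all periodic u at once, because sifting keeps replacing the sequence.
  Fixes : Set _
  Fixes = ∀ {u} → Periodic N u → ∀ y → Same u (y ⊠ pow y N) y

  -- In the ring of u the idempotent y^N is 1 or 0, so y is a unit or zero.
  Decided : Seq → Poly → Set _
  Decided u y = (∀ i → act (pow y N) u i ≈ u i) ⊎ (∀ i → act (pow y N) u i ≈ 0#)

  Decided-act : ∀ {u} e {y} → Decided u y → Decided (act e u) y
  Decided-act {u} e {y} (inj₁ eq) = inj₁ λ i → trans (act-comm (pow y N) e u i) (act-cong e eq i)
  Decided-act {u} e {y} (inj₂ eq) = inj₂ λ i → trans (act-comm (pow y N) e u i) (act-zero e eq i)

  module Sift (fixes : Fixes) (s : Poly) where

    -- Regroup y^N y^N as y^(N-1) y^(N+1) and replace y^(N+1) by y.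
    pow-N-idem : ∀ y {u} → Periodic N u → ∀ i → act (pow y N) (act (pow y N) u) i ≈ act (pow y N) u i
    pow-N-idem y {u} per i = begin
      act (y ⊠ pow y M) (act (pow y N) u) i ≈⟨ act-⊠ y (pow y M) (act (pow y N) u) i ⟩
      act y (act (pow y M) (act (pow y N) u)) i ≈⟨ act-comm y (pow y M) _ i ⟩
      act (pow y M) (act y (act (pow y N) u)) i ≈⟨ act-cong (pow y M) (λ i → trans (sym (act-⊠ y (pow y N) u i)) (at (fixes per y) i)) i ⟩
      act (pow y M) (act y u) i ≈⟨ act-comm (pow y M) y u i ⟩
      act y (act (pow y M) u) i ≈⟨ act-⊠ y (pow y M) u i ⟨
      act (pow y N) u i ∎

    -- The idempotent y^N splits u into the parts y^N u and (1 − y^N) u; keep one on which s is nonzero.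
    split : ∀ {u} → Periodic N u → ¬ (∀ i → act s u i ≈ 0#) → ∀ y →
            ∃ λ e → ¬ (∀ i → act s (act e u) i ≈ 0#) × Decided (act e u) y
    split {u} per su≉0 y with same? per (s ⊠ pow y N) []
    ... | no ≉0 = pow y N , (λ eq → ≉0 (same λ i → trans (act-⊠ s (pow y N) u i) (eq i))) , inj₁ (pow-N-idem y per)
    ... | yes ≈0 = e , (λ eq → su≉0 λ i → trans (sym (s-e i)) (eq i)) , inj₂ y^N-e
      where
      e = one ⊞ map (-_) (pow y N)
      act-e : ∀ v i → act e v i ≈ v i - act (pow y N) v i
      act-e v i = trans (act-⊞ one (map (-_) (pow y N)) v i) (+-cong (act-one v i) (act-neg (pow y N) v i))
      s-e : ∀ i → act s (act e u) i ≈ act s u i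
      s-e i = begin
        act s (act e u) i ≈⟨ act-comm s e u i ⟩
        act e (act s u) i ≈⟨ act-e (act s u) i ⟩
        act s u i - act (pow y N) (act s u) i
          ≈⟨ +-congˡ (-‿cong (trans (act-comm (pow y N) s u i) (trans (sym (act-⊠ s (pow y N) u i)) (at ≈0 i)))) ⟩
        act s u i - 0# ≈⟨ solve 1 (λ x → x :- con (0 , 0) := x) refl _ ⟩
        act s u i ∎
      y^N-e : ∀ i → act (pow y N) (act e u) i ≈ 0#
      y^N-e i = begin
        act (pow y N) (act e u) i ≈⟨ act-comm (pow y N) e u i ⟩
        act e (act (pow y N) u) i ≈⟨ act-e _ i ⟩
        act (pow y N) u i - act (pow y N) (act (pow y N) u) i ≈⟨ +-congˡ (-‿cong (pow-N-idem y per i)) ⟩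
        act (pow y N) u i - act (pow y N) u i ≈⟨ -‿inverseʳ _ ⟩
        0# ∎

    -- Passing from u to e u undoes no earlier decision (`Decided-act`), so a single pass settles
    -- the whole list while s stays nonzero.
    sift : ∀ {m} (L : Fin m → Poly) {u} → Periodic N u → ¬ (∀ i → act s u i ≈ 0#) →
           ∃ λ v → Periodic N v × ¬ (∀ i → act s v i ≈ 0#) × (∀ y → Decided u y → Decided v y) × (∀ j → Decided v (L j))
    sift {zero} L {u} per su≉0 = u , per , su≉0 , (λ _ → id) , λ ()
    sift {suc m} L {u} per su≉0 with split per su≉0 (L zero)
    ... | e , su′≉0 , d₀ with sift (L ∘ suc) (act-periodic per e) su′≉0
    ... | v , per′ , sv≉0 , keep , ds = v , per′ , sv≉0 , (λ y d → keep y (Decided-act e {y} d)) , decided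
      where
      decided : ∀ j → Decided v (L j)
      decided zero = keep (L zero) d₀
      decided (suc j) = ds j

    -- The finite list `words` represents every class for every sequence of period N. Hence it may
    -- be sifted before the final v is known and still decides all polynomials.
    field-sequence : ∀ {u} → Periodic N u → ¬ (∀ i → act s u i ≈ 0#) →
      ∃ λ v → Periodic N v × ¬ (∀ i → act s v i ≈ 0#) × (∀ y → Same v (pow y N) one ⊎ Same v y [])
    field-sequence per su≉0 with sift words per su≉0
    ... | v , per′ , sv≉0 , _ , ds = v , per′ , sv≉0 , unit-or-zero
      where
      module V = CommutativeRing (ringOf v)
      pow-cong : ∀ n {y z} → Same v y z → Same v (pow y n) (pow z n)
      pow-cong zero eq = V.refl
      pow-cong (suc n) eq = V.*-cong eq (pow-cong n eq)
      unit-or-zero : ∀ y → Same v (pow y N) one ⊎ Same v y []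
      unit-or-zero y with words-cover per′ y
      ... | j , y≈w with ds j
      ...   | inj₁ eq = inj₁ (V.trans (pow-cong N y≈w) (same λ i → trans (eq i) (sym (act-one v i))))
      ...   | inj₂ eq = inj₂ (V.trans (V.sym (fixes per′ y)) (V.trans (V.*-cong {y} {y} {pow y N} {[]} V.refl (V.trans (pow-cong N y≈w) y^N≈0)) (V.zeroʳ y)))
        where
        y^N≈0 : Same v (pow (words j) N) []
        y^N≈0 = same eq

-- Neither the order of K nor a minimal polynomial of x is recorded. The order q^n will follow from
-- `^-fixed` and `x-generates`.
record PrimitiveExtension {c ℓ} (F : CommutativeRing c ℓ) (q n-1 : ℕ) : Set (lsuc (c ⊔ ℓ)) where
  private
    module F = CommutativeRing F
  field
    K : CommutativeRing c ℓ
  open CommutativeRing K using (Carrier; _≈_; _+_; _*_; 0#; 1#)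
  open Exp (CommutativeRing.commutativeSemiring K) using (_^_)
  field
    ι : F.Carrier → Carrier
    ι-cong : ∀ {a b} → a F.≈ b → ι a ≈ ι b
    ι-+ : ∀ a b → ι (a F.+ b) ≈ ι a + ι b
    ι-* : ∀ a b → ι (a F.* b) ≈ ι a * ι b
    ι-0 : ι F.0# ≈ 0#
    ι-1 : ι F.1# ≈ 1#
    ι-zero : ∀ {a} → ι a ≈ 0# → a F.≈ F.0#
    1≉0 : ¬ 1# ≈ 0#
    _≟_ : ∀ x y → Dec (x ≈ y)
    inverse : ∀ x → ¬ x ≈ 0# → ∃ λ y → x * y ≈ 1#
    ^-fixed : ∀ y → y ^ (q ℕ.^ suc n-1) ≈ y
    additive : Frobenius.Additive K q
    x : Carrier
    x-generates : ∀ m → 1 ≤ m → m ≤ n-1 → ¬ x ^ (q ℕ.^ m) ≈ x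

-- An extension in which X has n distinct conjugates

module Extension {c ℓ} (F : CommutativeRing c ℓ) {q : ℕ} (isFF : IsFiniteField F q) where
  open CommutativeRing F hiding (zero)
  open IsFiniteField isFF
  open FiniteField F isFF
  open SequenceRing F
  open import Algebra.Properties.CommutativeSemiring.Exp commutativeSemiring using (_^_; ^-congʳ; ^-congˡ; ^-assocʳ)
  open import Algebra.Properties.Semiring.Mult semiring using (×1-homo-*) renaming (_×_ to _·_)

  q≥2 : 2 ≤ q
  q≥2 = two (index 0#) (index 1#) λ eq → nontrivial (trans (sym (enum-index 0#)) (trans (reflexive (≡.cong enum eq)) (enum-index 1#)))
    where
    two : ∀ {q} (i j : Fin q) → i ≢ j → 2 ≤ q
    two {suc zero} zero zero i≢j = contradiction ≡.refl i≢j
    two {suc (suc q)} i j i≢j = s≤s (s≤s z≤n)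

  ^q^n-fixed : ∀ n x → x ^ (q ℕ.^ n) ≈ x
  ^q^n-fixed zero x = *-identityʳ x
  ^q^n-fixed (suc n) x = trans (sym (^-assocʳ x q (q ℕ.^ n))) (trans (^-congˡ (q ℕ.^ n) (^-fixed x)) (^q^n-fixed n x))

  -- Otherwise p^l · 1 would be a product of nonzero elements, although it is q · 1 = 0.
  characteristic : ∀ p l → q ≡ p ℕ.^ l → p · 1# ≈ 0#
  characteristic p l q≡p^l with p · 1# ≟ 0#
  ... | yes eq = eq
  ... | no neq = contradiction (trans (sym (reflexive (≡.cong (_· 1#) q≡p^l))) q·1≈0) (power l)
    where
    power : ∀ l → ¬ (p ℕ.^ l) · 1# ≈ 0#
    power zero eq = 1≉0 (trans (sym (+-identityʳ 1#)) eq)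
    power (suc l) eq = *-nonzero neq (power l) (trans (sym (×1-homo-* p (p ℕ.^ l))) eq)

  module _ (u : Seq) where
    private module R = CommutativeRing (ringOf u)
    open import Algebra.Properties.CommutativeSemiring.Exp R.commutativeSemiring using () renaming (_^_ to _^ᴿ_)
    open import Algebra.Properties.Semiring.Mult R.semiring using () renaming (_×_ to _·ᴿ_)
    open Frobenius (ringOf u)

    pow≡^ : ∀ p n → pow p n ≡ p ^ᴿ n
    pow≡^ p zero = ≡.refl
    pow≡^ p (suc n) = ≡.cong (p ⊠_) (pow≡^ p n)

    const-+ : ∀ a b → const (a + b) R.≈ const a ⊞ const b
    const-+ a b = R.refl

    const-* : ∀ a b → const (a * b) R.≈ const a ⊠ const b
    const-* a b = same λ i → trans (act-const (a * b) u i) (trans (*-assoc a b (u i))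
      (sym (trans (act-⊠ (const a) (const b) u i) (trans (act-const a (act (const b) u) i) (*-congˡ (act-const b u i))))))

    const-cong : ∀ {a b} → a ≈ b → const a R.≈ const b
    const-cong a≈b = same λ i → +-congʳ (*-congʳ a≈b)

    const-0 : const 0# R.≈ []
    const-0 = same λ i → trans (act-const 0# u i) (zeroˡ _)

    const-· : ∀ m → m ·ᴿ one R.≈ const (m · 1#)
    const-· zero = R.sym const-0
    const-· (suc m) = R.trans (R.+-congˡ (const-· m)) (R.sym (const-+ 1# (m · 1#)))

    const-^ : ∀ a m → const a ^ᴿ m R.≈ const (a ^ m)
    const-^ a zero = R.refl
    const-^ a (suc m) = R.trans (R.*-congˡ {const a} (const-^ a m)) (R.sym (const-* a (a ^ m)))

    cons : ∀ a p → (a ∷ p) R.≈ const a ⊞ X ⊠ p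
    cons a p = same λ i → sym (trans (act-⊞ (const a) (X ⊠ p) u i) (+-cong (act-const a u i) (trans (act-⊠ X p u i) (act-X (act p u) i))))

    frobenius : ∀ p l → q ≡ p ℕ.^ l → (p ≡ 2 ⊎ p ≡ 3) → Additive q
    frobenius p l q≡p^l 2∨3 = ≡.subst Additive (≡.sym q≡p^l) (additive-^ {p} (additive-p 2∨3) l)
      where
      char : p ·ᴿ one R.≈ []
      char = R.trans (const-· p) (R.trans (const-cong (characteristic p l q≡p^l)) const-0)
      additive-p : p ≡ 2 ⊎ p ≡ 3 → Additive p
      additive-p (inj₁ ≡.refl) = additive-2 char
      additive-p (inj₂ ≡.refl) = additive-3 char

  factor : ℕ → Poly
  factor m = pow X (q ℕ.^ m) ⊞ map (-_) X

  -- The product of X^(q^i) - X for 1 ≤ i ≤ m. In a field where it is nonzero, none of these powers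
  -- of Frobenius fixes X.
  separator : ℕ → Poly
  separator zero = one
  separator (suc m) = separator m ⊠ factor (suc m)

  degree : ℕ → ℕ
  degree zero = 0
  degree (suc m) = degree m ℕ.+ q ℕ.^ suc m

  -- The 2 places the degree of the separator strictly below the period q^n - 1.
  degree-bound : ∀ m → 2 ℕ.+ degree m ≤ q ℕ.^ suc m
  degree-bound zero = ℕₚ.≤-trans q≥2 (ℕₚ.≤-reflexive (≡.sym (ℕₚ.*-identityʳ q)))
  degree-bound (suc m) = begin
    2 ℕ.+ degree m ℕ.+ q ℕ.^ suc m ≤⟨ ℕₚ.+-monoˡ-≤ (q ℕ.^ suc m) (degree-bound m) ⟩
    q ℕ.^ suc m ℕ.+ q ℕ.^ suc m ≡⟨ ≡.cong (q ℕ.^ suc m ℕ.+_) (ℕₚ.+-identityʳ _) ⟨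
    2 ℕ.* q ℕ.^ suc m ≤⟨ ℕₚ.*-monoˡ-≤ (q ℕ.^ suc m) q≥2 ⟩
    q ℕ.* q ℕ.^ suc m ∎
    where open ℕₚ.≤-Reasoning

  -- "p is monic of degree D", phrased through the action.
  Leading : ℕ → Poly → Set _
  Leading D p = ∀ v i → (∀ j → j < D → v (j ℕ.+ i) ≈ 0#) → act p v i ≈ v (D ℕ.+ i)

  Leading-⊠ : ∀ {D E p p′} → Leading D p → Leading E p′ → Leading (D ℕ.+ E) (p ⊠ p′)
  Leading-⊠ {D} {E} {p} {p′} lp lp′ v i vanish = trans (act-⊠ p p′ v i)
    (trans (lp (act p′ v) i λ j j<D → trans (lp′ v (j ℕ.+ i) (λ t t<E → trans (reflexive (≡.cong v (shuffle t j)))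
              (vanish (j ℕ.+ t) (ℕₚ.+-mono-<-≤ j<D (ℕₚ.<⇒≤ t<E)))))
              (trans (reflexive (≡.cong v (shuffle E j))) (vanish (j ℕ.+ E) (ℕₚ.+-monoˡ-< E j<D))))
    (trans (lp′ v (D ℕ.+ i) (λ t t<E → trans (reflexive (≡.cong v (shuffle t D))) (vanish (D ℕ.+ t) (ℕₚ.+-monoʳ-< D t<E))))
      (reflexive (≡.cong v (shuffle E D)))))
    where
    shuffle : ∀ a b → a ℕ.+ (b ℕ.+ i) ≡ b ℕ.+ a ℕ.+ i
    shuffle a b = ≡.trans (≡.sym (ℕₚ.+-assoc a b i)) (≡.cong (ℕ._+ i) (ℕₚ.+-comm a b))

  Leading-factor : ∀ m → Leading (q ℕ.^ suc m) (factor (suc m))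
  Leading-factor m v i vanish = trans (act-⊞ (pow X (q ℕ.^ suc m)) (map (-_) X) v i)
    (trans (+-cong (pow-X (q ℕ.^ suc m) v i) (trans (act-neg X v i) (-‿cong (trans (act-X v i) (vanish 1 1<q^[m+1])))))
    (Solver.solve F 1 (λ x → x :- con (0 , 0) := x) refl _))
    where
    open Solver F using (_:-_; _:=_; con)
    1<q^[m+1] : 1 < q ℕ.^ suc m
    1<q^[m+1] = ℕₚ.≤-trans (ℕₚ.m≤m+n 2 (degree m)) (degree-bound m)

  Leading-separator : ∀ m → Leading (degree m) (separator m)
  Leading-separator zero v i _ = act-one v i
  Leading-separator (suc m) = Leading-⊠ {degree m} {q ℕ.^ suc m} {separator m} {factor (suc m)} (Leading-separator m) (Leading-factor m)

  module _ (p l : ℕ) (q≡p^l : q ≡ p ℕ.^ l) (2∨3 : p ≡ 2 ⊎ p ≡ 3) (n-1 : ℕ) where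

    M : ℕ
    M = q ℕ.^ suc n-1 ℕ.∸ 2

    2+M≡q^n : suc (suc M) ≡ q ℕ.^ suc n-1
    2+M≡q^n = ℕₚ.m+[n∸m]≡n (ℕₚ.≤-trans (ℕₚ.m≤m+n 2 (degree n-1)) (degree-bound n-1))

    open SequenceField F isFF M

    -- The q^n-th power map is additive and multiplicative, and it fixes constants and X (as X^N
    -- acts as 1), hence every polynomial.
    fixes : Fixes
    fixes {u} per [] = CommutativeRing.refl (ringOf u)
    fixes {u} per (a ∷ y) = begin
      pow (a ∷ y) Q ≡⟨ pow≡^ u (a ∷ y) Q ⟩
      (a ∷ y) ^ᴿ Q ≈⟨ ^ᴿ-congˡ Q (cons u a y) ⟩
      (const a ⊞ X ⊠ y) ^ᴿ Q ≈⟨ ≡.subst Additive (≡.sym 2+M≡q^n) (additive-^ {q} (frobenius u p l q≡p^l 2∨3) (suc n-1)) (const a) (X ⊠ y) ⟩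
      const a ^ᴿ Q ⊞ (X ⊠ y) ^ᴿ Q ≈⟨ R.+-cong const-fixed (R.trans (^ᴿ-distrib-* X y Q) (R.*-cong X-fixed y-fixed)) ⟩
      const a ⊞ X ⊠ y ≈⟨ cons u a y ⟨
      a ∷ y ∎
      where
      Q = suc N
      module R = CommutativeRing (ringOf u)
      open import Relation.Binary.Reasoning.Setoid R.setoid
      open import Algebra.Properties.CommutativeSemiring.Exp R.commutativeSemiring
        renaming (_^_ to _^ᴿ_; ^-congˡ to ^ᴿ-congˡ; ^-distrib-* to ^ᴿ-distrib-*) using ()
      open Frobenius (ringOf u) using (Additive; additive-^)
      const-fixed : const a ^ᴿ Q R.≈ const a
      const-fixed = R.trans (const-^ u a Q) (const-cong u (trans (^-congʳ a 2+M≡q^n) (^q^n-fixed (suc n-1) a)))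
      X-fixed : X ^ᴿ Q R.≈ X
      X-fixed = R.trans (R.reflexive (≡.sym (pow≡^ u X Q))) (same λ i → trans (pow-X Q u i)
        (trans (reflexive (≡.cong u (≡.sym (ℕₚ.+-suc N i)))) (trans (per (suc i)) (sym (act-X u i)))))
      y-fixed : y ^ᴿ Q R.≈ y
      y-fixed = R.trans (R.reflexive (≡.sym (pow≡^ u y Q))) (fixes per y)

    at-residue : ℕ → Carrier
    at-residue zero = 1#
    at-residue (suc _) = 0#

    pulse : Seq
    pulse i = at-residue (i % N)

    pulse-periodic : Periodic N pulse
    pulse-periodic i = reflexive (≡.cong at-residue (≡.trans (≡.cong (_% N) (ℕₚ.+-comm N i)) ([m+n]%n≡m%n i N)))

    -- Read the result at N - D: the D entries of the pulse from there up to N - 1 are 0, so only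
    -- the leading coefficient contributes, and it meets the 1 at N.
    separator-pulse : ¬ (∀ i → act (separator n-1) pulse i ≈ 0#)
    separator-pulse eq = 1≉0 (trans (sym pulse-N) (trans (sym (Leading-separator n-1 pulse i₀ vanish)) (eq i₀)))
      where
      D = degree n-1
      D<N : D < N
      D<N = ℕₚ.≤-pred (ℕₚ.≤-trans (degree-bound n-1) (ℕₚ.≤-reflexive (≡.sym 2+M≡q^n)))
      i₀ = N ℕ.∸ D
      D+i₀≡N : D ℕ.+ i₀ ≡ N
      D+i₀≡N = ℕₚ.m+[n∸m]≡n (ℕₚ.<⇒≤ D<N)
      pulse-N : pulse (D ℕ.+ i₀) ≈ 1#
      pulse-N = reflexive (≡.cong at-residue (≡.trans (≡.cong (_% N) D+i₀≡N) (n%n≡0 N)))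
      at-positive : ∀ {r} → 0 < r → at-residue r ≈ 0#
      at-positive (s≤s _) = refl
      vanish : ∀ j → j < D → pulse (j ℕ.+ i₀) ≈ 0#
      vanish j j<D = trans (reflexive (≡.cong at-residue (m<n⇒m%n≡m (≡.subst (j ℕ.+ i₀ <_) D+i₀≡N (ℕₚ.+-monoˡ-< i₀ j<D)))))
        (at-positive (ℕₚ.≤-trans (ℕₚ.m<n⇒0<n∸m D<N) (ℕₚ.m≤n+m i₀ j)))

    extension : PrimitiveExtension F q n-1
    extension = from-sequence (Sift.field-sequence fixes (separator n-1) pulse-periodic separator-pulse)
      where
      from-sequence : (∃ λ v → Periodic N v × ¬ (∀ i → act (separator n-1) v i ≈ 0#) × (∀ y → Same v (pow y N) one ⊎ Same v y [])) →
                      PrimitiveExtension F q n-1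
      from-sequence (v , per , sv≉0 , unit-or-zero) = record
        { K = ringOf v
        ; ι = const
        ; ι-cong = const-cong v
        ; ι-+ = const-+ v
        ; ι-* = const-* v
        ; ι-0 = const-0 v
        ; ι-1 = V.refl
        ; ι-zero = const-zero
        ; 1≉0 = one≉0
        ; _≟_ = same? per
        ; inverse = λ y y≉0 → pow y M , [ id , (λ y≈0 → contradiction y≈0 y≉0) ] (unit-or-zero y)
        ; ^-fixed = λ y → V.trans (V.reflexive (≡.trans (≡.cong (y ^ⱽ_) (≡.sym 2+M≡q^n)) (≡.sym (pow≡^ v y (suc N))))) (fixes per y)
        ; additive = frobenius v p l q≡p^l 2∨3
        ; x = X
        ; x-generates = moves
        }
        where
        module V = CommutativeRing (ringOf v)
        open import Algebra.Properties.CommutativeSemiring.Exp V.commutativeSemiring using () renaming (_^_ to _^ⱽ_)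
        one≉0 : ¬ Same v one []
        one≉0 eq = sv≉0 (act-zero (separator n-1) (λ i → trans (sym (act-one v i)) (at eq i)))
        const-zero : ∀ {a} → Same v (const a) [] → a ≈ 0#
        const-zero {a} eq with a ≟ 0#
        ... | yes a≈0 = a≈0
        ... | no a≉0 with inverse a a≉0
        ... | b , ab≈1 = contradiction (V.trans (V.sym (const-cong v ab≈1)) (V.trans (const-* v a b) (V.trans (V.*-congʳ {const b} eq) (V.zeroˡ (const b))))) one≉0
        separator-zero : ∀ m → 1 ≤ m → Same v (factor m) [] → ∀ n → m ≤ n → Same v (separator n) []
        separator-zero (suc m) _ eq (suc n) (s≤s m≤n) with ℕₚ.m≤n⇒m<n∨m≡n m≤n
        ... | inj₁ m<n = V.trans (V.*-congʳ {factor (suc n)} (separator-zero (suc m) (s≤s z≤n) eq n m<n)) (V.zeroˡ (factor (suc n)))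
        ... | inj₂ ≡.refl = V.trans (V.*-congˡ {separator n} eq) (V.zeroʳ (separator n))
        moves : ∀ m → 1 ≤ m → m ≤ n-1 → ¬ Same v (X ^ⱽ (q ℕ.^ m)) X
        moves m 1≤m m≤n-1 eq = sv≉0 (at (separator-zero m 1≤m
          (V.trans (V.+-congʳ {map (-_) X} (V.trans (V.reflexive (pow≡^ v X (q ℕ.^ m))) eq)) (V.-‿inverseʳ X)) n-1 m≤n-1))

-- The regular representation of an extension

∑≡sum : ∀ {c ℓ} (R : CommutativeRing c ℓ) n f → Matrices.∑ R n f ≡ SemiringSum.sum (CommutativeRing.semiring R) f
∑≡sum R zero f = ≡.refl
∑≡sum R (suc n) f = ≡.cong (CommutativeRing._+_ R (f zero)) (∑≡sum R n (f ∘ suc))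

module Identity {c ℓ} (R : CommutativeRing c ℓ) where
  open CommutativeRing R using (0#; 1#)
  open Matrices R

  idM-diagonal : ∀ {n} (i : Fin n) → idM i i ≡ 1#
  idM-diagonal zero = ≡.refl
  idM-diagonal (suc i) = idM-diagonal i

  idM-off : ∀ {n} (i j : Fin n) → i ≢ j → idM i j ≡ 0#
  idM-off zero zero i≢j = contradiction ≡.refl i≢j
  idM-off zero (suc j) i≢j = ≡.refl
  idM-off (suc i) zero i≢j = ≡.refl
  idM-off (suc i) (suc j) i≢j = idM-off i j (i≢j ∘ ≡.cong suc)

funToFin-cong : ∀ {m n} {f g : Fin m → Fin n} → (∀ i → f i ≡ g i) → funToFin f ≡ funToFin g
funToFin-cong {zero} eq = ≡.refl
funToFin-cong {suc m} eq = ≡.cong₂ combine (eq zero) (funToFin-cong (eq ∘ suc))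

module Representation {c ℓ} (F : CommutativeRing c ℓ) {q : ℕ} (isFF : IsFiniteField F q) {n-1 : ℕ} (E : PrimitiveExtension F q n-1) where
  module F = CommutativeRing F
  module FF = IsFiniteField isFF
  open FiniteField F isFF using (index) renaming (^-fixed to ^q-fixed)
  open PrimitiveExtension E
  open CommutativeRing K hiding (zero)
  module ΣK = SemiringSum semiring
  module ΣF = SemiringSum F.semiring
  module ExpF = Exp F.commutativeSemiring
  open Solver K
  open Exp commutativeSemiring
  open Roots K
  open Frobenius K using (Additive; additive-^)
  open Matrices F
  open Identity F
  open import Algebra.Properties.Ring ring using (x∙y⁻¹≈ε⇒x≈y)
  open import Relation.Binary.Reasoning.Setoid setoid

  n : ℕ
  n = suc n-1

  noZeroDivisors : ∀ {x y} → x * y ≈ 0# → ¬ x ≈ 0# → y ≈ 0#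
  noZeroDivisors = inverses⇒noZeroDivisors K inverse

  ^-zero : ∀ m {y} → y ^ m ≈ 0# → y ≈ 0#
  ^-zero zero eq = contradiction eq 1≉0
  ^-zero (suc m) {y} eq with y ≟ 0#
  ... | yes y≈0 = y≈0
  ... | no y≉0 = ^-zero m (noZeroDivisors eq y≉0)

  ι-sum : ∀ {m} (f : Fin m → F.Carrier) → ι (ΣF.sum f) ≈ ΣK.sum (ι ∘ f)
  ι-sum {zero} f = ι-0
  ι-sum {suc m} f = trans (ι-+ _ _) (+-congˡ (ι-sum (f ∘ suc)))

  ι-^ : ∀ a m → ι (a ExpF.^ m) ≈ ι a ^ m
  ι-^ a zero = ι-1
  ι-^ a (suc m) = trans (ι-* _ _) (*-congˡ (ι-^ a m))

  combination : ∀ {m} → (Fin m → F.Carrier) → Carrier → Carrier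
  combination f y = ΣK.sum (λ i → ι (f i) * y ^ toℕ i)

  word : (Fin n → F.Carrier) → Carrier
  word f = combination f x

  eval-combination : ∀ {m} (f : Fin m → F.Carrier) y → eval (map ι (tabulate f)) y ≈ combination f y
  eval-combination {zero} f y = refl
  eval-combination {suc m} f y = +-cong (sym (*-identityʳ _)) (begin
    y * eval (map ι (tabulate (f ∘ suc))) y ≈⟨ *-congˡ (eval-combination (f ∘ suc) y) ⟩
    y * combination (f ∘ suc) y ≈⟨ ΣK.*-distribˡ-sum y (λ i → ι (f (suc i)) * y ^ toℕ i) ⟩
    ΣK.sum (λ i → y * (ι (f (suc i)) * y ^ toℕ i))
      ≈⟨ ΣK.sum-cong-≋ {m} (λ i → solve 3 (λ y a z → y :* (a :* z) := a :* (y :* z)) refl y (ι (f (suc i))) (y ^ toℕ i)) ⟩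
    ΣK.sum (λ i → ι (f (suc i)) * y ^ suc (toℕ i)) ∎)

  -- The coefficients come from F and are their own q-th powers.
  eval-frobenius : ∀ p y → eval (map ι p) y ^ q ≈ eval (map ι p) (y ^ q)
  eval-frobenius [] y = 0^q q (index F.0#)
    where
    0^q : ∀ m → Fin m → 0# ^ m ≈ 0#
    0^q (suc m) _ = zeroˡ _
  eval-frobenius (a ∷ p) y = trans (additive (ι a) (y * eval (map ι p) y))
    (+-cong (trans (sym (ι-^ a q)) (ι-cong (^q-fixed a))) (trans (^-distrib-* y _ q) (*-congˡ (eval-frobenius p y))))

  eval-conjugate : ∀ p m → eval (map ι p) x ≈ 0# → eval (map ι p) (x ^ (q ℕ.^ m)) ≈ 0#
  eval-conjugate p zero eq = trans (eval-cong (map ι p) (*-identityʳ x)) eq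
  eval-conjugate p (suc m) eq = begin
    eval (map ι p) (x ^ (q ℕ.* q ℕ.^ m)) ≈⟨ eval-cong (map ι p) (trans (^-congʳ x (ℕₚ.*-comm q (q ℕ.^ m))) (sym (^-assocʳ x (q ℕ.^ m) q))) ⟩
    eval (map ι p) ((x ^ (q ℕ.^ m)) ^ q) ≈⟨ eval-frobenius p _ ⟨
    eval (map ι p) (x ^ (q ℕ.^ m)) ^ q ≈⟨ ^-congˡ q (eval-conjugate p m eq) ⟩
    0# ^ q ≈⟨ eval-frobenius [] x ⟩
    0# ∎

  additive-injective : ∀ {m} → Additive m → ∀ {y z} → y ^ m ≈ z ^ m → y ≈ z
  additive-injective {m} add {y} {z} eq = x∙y⁻¹≈ε⇒x≈y y z (^-zero m (begin
    (y - z) ^ m ≈⟨ solve 2 (λ a b → a := a :+ b :- b) refl ((y - z) ^ m) (z ^ m) ⟩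
    (y - z) ^ m + z ^ m - z ^ m ≈⟨ +-congʳ (add (y - z) z) ⟨
    (y - z + z) ^ m - z ^ m ≈⟨ +-congʳ (^-congˡ m (solve 2 (λ y z → y :- z :+ z := y) refl y z)) ⟩
    y ^ m - z ^ m ≈⟨ +-congʳ eq ⟩
    z ^ m - z ^ m ≈⟨ -‿inverseʳ _ ⟩
    0# ∎))

  -- The q^i-th power map is injective; cancelling it from a coincidence leaves x = x^(q^(j-i)) with
  -- 0 < j - i < n.
  conjugates-ordered : ∀ i j → i < j → j < n → ¬ x ^ (q ℕ.^ i) ≈ x ^ (q ℕ.^ j)
  conjugates-ordered i j i<j j<n eq = x-generates e (ℕₚ.m<n⇒0<n∸m i<j) (ℕₚ.≤-trans (ℕₚ.m∸n≤m j i) (ℕₚ.≤-pred j<n))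
    (sym (additive-injective {q ℕ.^ i} (additive-^ {q} additive i) (begin
      x ^ (q ℕ.^ i) ≈⟨ eq ⟩
      x ^ (q ℕ.^ j) ≈⟨ ^-congʳ x (≡.trans (≡.cong (q ℕ.^_) (≡.sym (ℕₚ.m∸n+n≡m (ℕₚ.<⇒≤ i<j)))) (ℕₚ.^-distribˡ-+-* q e i)) ⟩
      x ^ (q ℕ.^ e ℕ.* q ℕ.^ i) ≈⟨ ^-assocʳ x (q ℕ.^ e) (q ℕ.^ i) ⟨
      (x ^ (q ℕ.^ e)) ^ (q ℕ.^ i) ∎)))
    where
    e = j ℕ.∸ i

  conjugates-distinct : ∀ (i j : Fin n) → x ^ (q ℕ.^ toℕ i) ≈ x ^ (q ℕ.^ toℕ j) → i ≡ j
  conjugates-distinct i j eq with ℕₚ.<-cmp (toℕ i) (toℕ j)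
  ... | tri≈ _ i≡j _ = toℕ-injective i≡j
  ... | tri< i<j _ _ = contradiction eq (conjugates-ordered _ _ i<j (toℕ<n j))
  ... | tri> _ _ j<i = contradiction (sym eq) (conjugates-ordered _ _ j<i (toℕ<n i))

  -- This is the independence of 1, x, ..., x^(n-1) over F: a polynomial with n coefficients in F
  -- that kills x kills its n conjugates as well.
  word-zero : ∀ f → word f ≈ 0# → ∀ i → f i F.≈ F.0#
  word-zero f eq i = ι-zero (tabulate⁻ {f = f} (map⁻ (roots⇒zero noZeroDivisors (map ι (tabulate f))
    (≡.trans (length-map ι (tabulate f)) (length-tabulate f)) (λ m → x ^ (q ℕ.^ toℕ m)) conjugates-distinct
    (λ m → eval-conjugate (tabulate f) (toℕ m) (trans (eval-combination f x) eq)))) i)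

  word-cong : ∀ {f g} → (∀ i → f i F.≈ g i) → word f ≈ word g
  word-cong eq = ΣK.sum-cong-≋ {n} (λ i → *-congʳ {x ^ toℕ i} (ι-cong (eq i)))

  word-+ : ∀ f g → word (λ i → f i F.+ g i) ≈ word f + word g
  word-+ f g = trans (ΣK.sum-cong-≋ {n} (λ i → trans (*-congʳ {x ^ toℕ i} (ι-+ (f i) (g i))) (distribʳ _ _ _)))
    (ΣK.∑-distrib-+ {n} (λ i → ι (f i) * x ^ toℕ i) (λ i → ι (g i) * x ^ toℕ i))

  word-scale : ∀ a f → word (λ i → a F.* f i) ≈ ι a * word f
  word-scale a f = trans (ΣK.sum-cong-≋ {n} (λ i → trans (*-congʳ {x ^ toℕ i} (ι-* a (f i))) (*-assoc _ _ _)))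
    (sym (ΣK.*-distribˡ-sum {n} (ι a) (λ i → ι (f i) * x ^ toℕ i)))

  word-injective : ∀ {f g : Fin n → F.Carrier} → word f ≈ word g → ∀ i → f i F.≈ g i
  word-injective {f} {g} eq i = F-Ring.x∙y⁻¹≈ε⇒x≈y (f i) (g i) (F.trans (F.+-congˡ (F.sym (F-Ring.-1*x≈-x (g i)))) (word-zero d d≈0 i))
    where
    module F-Ring = Algebra.Properties.Ring F.ring
    d : Fin n → F.Carrier
    d i = f i F.+ F.- F.1# F.* g i
    d≈0 : word d ≈ 0#
    d≈0 = begin
      word d ≈⟨ word-+ f (λ i → F.- F.1# F.* g i) ⟩
      word f + word (λ i → F.- F.1# F.* g i) ≈⟨ +-cong eq (word-scale (F.- F.1#) g) ⟩
      word g + ι (F.- F.1#) * word g ≈⟨ +-congʳ (trans (sym (*-identityˡ _)) (*-congʳ (sym ι-1))) ⟩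
      ι F.1# * word g + ι (F.- F.1#) * word g ≈⟨ distribʳ _ _ _ ⟨
      (ι F.1# + ι (F.- F.1#)) * word g ≈⟨ *-congʳ (trans (sym (ι-+ _ _)) (trans (ι-cong (F.-‿inverseʳ F.1#)) ι-0)) ⟩
      0# * word g ≈⟨ zeroˡ _ ⟩
      0# ∎

  digits : Fin (q ℕ.^ n) → Fin n → F.Carrier
  digits j = FF.enum ∘ finToFun {q} {n} j

  enumK : Fin (q ℕ.^ n) → Carrier
  enumK j = word (digits j)

  enumK-injective : ∀ i j → enumK i ≈ enumK j → i ≡ j
  enumK-injective i j eq = ≡.trans (≡.sym (funToFin-finToFin {n} {q} i)) (≡.trans
    (funToFin-cong {n} {q} {finToFun i} {finToFun j} (λ t → FF.enum-inj _ _ (word-injective {digits i} {digits j} eq t))) (funToFin-finToFin {n} {q} j))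

  -- Otherwise y and the enumerated elements would be q^n + 1 roots of Y^(q^n) − Y.
  enumK-surjective : ∀ y → ∃ λ j → enumK j ≈ y
  enumK-surjective y with any? (λ j → enumK j ≟ y)
  ... | yes found = found
  ... | no missing = contradiction roots (monic-roots noZeroDivisors 1≉0 p (≡.cong (λ m → suc m) (≡.sym length-p)) f f-injective)
    where
    M = q ℕ.^ n ℕ.∸ 2
    2+M≡q^n : suc (suc M) ≡ q ℕ.^ n
    2+M≡q^n = ℕₚ.m+[n∸m]≡n (ℕₚ.≤-trans (ℕₚ.m≤m+n 2 (Extension.degree F isFF n-1)) (Extension.degree-bound F isFF n-1))
    p = 0# ∷ - 1# ∷ replicate M 0#
    length-p : length p ≡ q ℕ.^ n
    length-p = ≡.trans (≡.cong (λ m → suc (suc m)) (length-replicate M)) 2+M≡q^n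
    f : Fin (suc (q ℕ.^ n)) → Carrier
    f zero = y
    f (suc j) = enumK j
    f-injective : ∀ i j → f i ≈ f j → i ≡ j
    f-injective zero zero eq = ≡.refl
    f-injective zero (suc j) eq = contradiction (j , sym eq) missing
    f-injective (suc i) zero eq = contradiction (i , eq) missing
    f-injective (suc i) (suc j) eq = ≡.cong suc (enumK-injective i j eq)
    roots : ∀ i → eval p (f i) + f i ^ length p ≈ 0#
    roots i = begin
      0# + z * (- 1# + z * eval (replicate M 0#) z) + z ^ length p
        ≈⟨ +-cong (+-congˡ (*-congˡ (+-congˡ (*-congˡ (eval-zeros M z))))) (trans (^-congʳ z length-p) (^-fixed z)) ⟩
      0# + z * (- 1# + z * 0#) + z ≈⟨ solve 1 (λ z → con (0 , 0) :+ z :* (:- con (1 , 0) :+ z :* con (0 , 0)) :+ z := con (0 , 0)) refl z ⟩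
      0# ∎
      where z = f i

  isFiniteField : IsFiniteField K (q ℕ.^ n)
  isFiniteField = record
    { nontrivial = 1≉0 ∘ sym
    ; inverse = inverse
    ; enum = enumK
    ; enum-inj = enumK-injective
    ; enum-surj = enumK-surjective
    }

  coordinates : Carrier → Fin n → F.Carrier
  coordinates y = digits (proj₁ (enumK-surjective y))

  word-coordinates : ∀ y → word (coordinates y) ≈ y
  word-coordinates y = proj₂ (enumK-surjective y)

  -- Every law of ρ reduces to this: the expected entries need only be checked to spell the right
  -- element of K.
  coordinates-unique : ∀ {y} f → word f ≈ y → ∀ i → coordinates y i F.≈ f i
  coordinates-unique {y} f eq = word-injective {coordinates y} {f} (trans (word-coordinates y) (sym eq))

  -- The matrix of multiplication by y in the basis 1, x, …, x^(n−1).
  ρ : Carrier → Mat n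
  ρ y i j = coordinates (y * x ^ toℕ j) i

  ρ-cong : ∀ {y z} → y ≈ z → ρ y ≈M ρ z
  ρ-cong {y} {z} y≈z i j = coordinates-unique (λ i → ρ z i j) (trans (word-coordinates _) (*-congʳ (sym y≈z))) i

  ρ-+ : ∀ y z → ρ (y + z) ≈M (ρ y +M ρ z)
  ρ-+ y z i j = coordinates-unique (λ i → ρ y i j F.+ ρ z i j) (trans (word-+ (λ i → ρ y i j) (λ i → ρ z i j))
    (trans (+-cong (word-coordinates _) (word-coordinates _)) (sym (distribʳ _ _ _)))) i

  word-idM : ∀ j → word (λ i → idM i j) ≈ x ^ toℕ j
  word-idM j = trans (sum-single +-commutativeMonoid (λ i → ι (idM i j) * x ^ toℕ i) j
      (λ i i≢j → trans (*-congʳ (trans (reflexive (≡.cong ι (idM-off i j i≢j))) ι-0)) (zeroˡ _)))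
    (trans (*-congʳ (trans (reflexive (≡.cong ι (idM-diagonal j))) ι-1)) (*-identityˡ _))

  ρ-ι : ∀ a → ρ (ι a) ≈M (λ i j → a F.* idM i j)
  ρ-ι a i j = coordinates-unique (λ i → a F.* idM i j) (trans (word-scale a (λ i → idM i j)) (*-congˡ (word-idM j))) i

  word-sum : ∀ {m} (f : Fin n → Fin m → F.Carrier) → word (λ i → ΣF.sum (f i)) ≈ ΣK.sum (λ t → word (λ i → f i t))
  word-sum {m} f = trans (ΣK.sum-cong-≋ {n} (λ i → trans (*-congʳ {x ^ toℕ i} (ι-sum (f i))) (ΣK.*-distribʳ-sum {m} (x ^ toℕ i) (ι ∘ f i))))
    (ΣK.∑-comm {n} {m} (λ i t → ι (f i t) * x ^ toℕ i))

  ρ-* : ∀ y z → ρ (y * z) ≈M (ρ y *M ρ z)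
  ρ-* y z i j = coordinates-unique (λ i → (ρ y *M ρ z) i j) (begin
    word (λ i → ∑ n (λ t → ρ y i t F.* ρ z t j))
      ≈⟨ word-cong {λ i → ∑ n (λ t → ρ y i t F.* ρ z t j)} {λ i → ΣF.sum {n} (λ t → ρ z t j F.* ρ y i t)} (λ i → F.trans (F.reflexive (∑≡sum F n (λ t → ρ y i t F.* ρ z t j))) (ΣF.sum-cong-≋ {n} (λ t → F.*-comm (ρ y i t) (ρ z t j)))) ⟩
    word (λ i → ΣF.sum {n} (λ t → ρ z t j F.* ρ y i t)) ≈⟨ word-sum (λ i t → ρ z t j F.* ρ y i t) ⟩
    ΣK.sum {n} (λ t → word (λ i → ρ z t j F.* ρ y i t))
      ≈⟨ ΣK.sum-cong-≋ {n} (λ t → trans (word-scale (ρ z t j) (λ i → ρ y i t)) (trans (*-congˡ (word-coordinates (y * x ^ toℕ t)))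
           (solve 3 (λ a y x → a :* (y :* x) := y :* (a :* x)) refl (ι (ρ z t j)) y (x ^ toℕ t)))) ⟩
    ΣK.sum {n} (λ t → y * (ι (ρ z t j) * x ^ toℕ t)) ≈⟨ ΣK.*-distribˡ-sum {n} y (λ t → ι (ρ z t j) * x ^ toℕ t) ⟨
    y * word (λ t → ρ z t j) ≈⟨ *-congˡ (word-coordinates _) ⟩
    y * (z * x ^ toℕ j) ≈⟨ *-assoc _ _ _ ⟨
    y * z * x ^ toℕ j ∎) i

  ρ-^ : ∀ y m → ρ (y ^ m) ≈M (ρ y ^M m)
  ρ-^ y zero i j = F.trans (ρ-cong (sym ι-1) i j) (F.trans (ρ-ι F.1# i j) (F.*-identityˡ _))
  ρ-^ y (suc m) i j = F.trans (ρ-* y (y ^ m) i j) (F.trans (F.reflexive (∑≡sum F n (λ t → ρ y i t F.* ρ (y ^ m) t j)))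
    (F.trans (ΣF.sum-cong-≋ {n} (λ t → F.*-congˡ {ρ y i t} (ρ-^ y m t j))) (F.reflexive (≡.sym (∑≡sum F n (λ t → ρ y i t F.* (ρ y ^M m) t j))))))

  scalar-sum : ∀ k-1 → k-1 ℕ.* k-1 ℕ.* (k-1 ℕ.* k-1) < q ℕ.^ n → ∀ a →
               ∃₂ λ (A B : Mat n) → ((A ^M suc k-1) +M (B ^M suc k-1)) ≈M (λ i j → a F.* idM i j)
  scalar-sum k-1 k-1⁴<q^n a = from-K (TwoPowers.two-powers K isFiniteField k-1 k-1⁴<q^n (ι a))
    where
    from-K : (∃₂ λ y z → y ^ suc k-1 + z ^ suc k-1 ≈ ι a) → ∃₂ λ (A B : Mat n) → ((A ^M suc k-1) +M (B ^M suc k-1)) ≈M (λ i j → a F.* idM i j)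
    from-K (y , z , eq) = ρ y , ρ z , λ i j → F.trans (F.sym (F.+-cong (ρ-^ y (suc k-1) i j) (ρ-^ z (suc k-1) i j)))
      (F.trans (F.sym (ρ-+ (y ^ suc k-1) (z ^ suc k-1) i j)) (F.trans (ρ-cong eq i j) (ρ-ι a i j)))

-- Matrices and similarity

module MatrixAlgebra {c ℓ} (R : CommutativeRing c ℓ) where
  open CommutativeRing R hiding (zero)
  open Matrices R
  open Identity R
  open Solver R
  open import Relation.Binary.Reasoning.Setoid setoid

  ∑-cong : ∀ n {f g : Fin n → Carrier} → (∀ i → f i ≈ g i) → ∑ n f ≈ ∑ n g
  ∑-cong zero eq = refl
  ∑-cong (suc n) eq = +-cong (eq zero) (∑-cong n (eq ∘ suc))

  ∑-zero : ∀ n {f : Fin n → Carrier} → (∀ i → f i ≈ 0#) → ∑ n f ≈ 0#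
  ∑-zero zero eq = refl
  ∑-zero (suc n) eq = trans (+-cong (eq zero) (∑-zero n (eq ∘ suc))) (+-identityʳ 0#)

  ∑-+ : ∀ n (f g : Fin n → Carrier) → ∑ n (λ i → f i + g i) ≈ ∑ n f + ∑ n g
  ∑-+ zero f g = sym (+-identityʳ 0#)
  ∑-+ (suc n) f g = trans (+-congˡ (∑-+ n (f ∘ suc) (g ∘ suc)))
    (solve 4 (λ a b x y → a :+ b :+ (x :+ y) := a :+ x :+ (b :+ y)) refl _ _ _ _)

  ∑-*ˡ : ∀ n a (f : Fin n → Carrier) → ∑ n (λ i → a * f i) ≈ a * ∑ n f
  ∑-*ˡ zero a f = sym (zeroʳ a)
  ∑-*ˡ (suc n) a f = trans (+-congˡ (∑-*ˡ n a (f ∘ suc))) (sym (distribˡ _ _ _))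

  ∑-*ʳ : ∀ n a (f : Fin n → Carrier) → ∑ n (λ i → f i * a) ≈ ∑ n f * a
  ∑-*ʳ n a f = trans (∑-cong n (λ i → *-comm _ _)) (trans (∑-*ˡ n a f) (*-comm _ _))

  ∑-swap : ∀ m n (f : Fin m → Fin n → Carrier) → ∑ m (λ i → ∑ n (f i)) ≈ ∑ n (λ j → ∑ m (λ i → f i j))
  ∑-swap zero n f = sym (∑-zero n (λ _ → refl))
  ∑-swap (suc m) n f = trans (+-congˡ (∑-swap m n (f ∘ suc))) (sym (∑-+ n (f zero) _))

  ∑-single : ∀ n (f : Fin n → Carrier) i → (∀ j → j ≢ i → f j ≈ 0#) → ∑ n f ≈ f i
  ∑-single n f i eq = trans (reflexive (∑≡sum R n f)) (sum-single +-commutativeMonoid f i eq)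

  ∑-idˡ : ∀ n i (f : Fin n → Carrier) → ∑ n (λ t → idM i t * f t) ≈ f i
  ∑-idˡ n i f = trans (∑-single n _ i (λ j j≢i → trans (*-congʳ (reflexive (idM-off i j (j≢i ∘ ≡.sym)))) (zeroˡ _)))
    (trans (*-congʳ (reflexive (idM-diagonal i))) (*-identityˡ _))

  ∑-idʳ : ∀ n j (f : Fin n → Carrier) → ∑ n (λ t → f t * idM t j) ≈ f j
  ∑-idʳ n j f = trans (∑-single n _ j (λ i i≢j → trans (*-congˡ (reflexive (idM-off i j i≢j))) (zeroʳ _)))
    (trans (*-congˡ (reflexive (idM-diagonal j))) (*-identityʳ _))

  module _ {n : ℕ} where
    ≈M-refl : {A : Mat n} → A ≈M A
    ≈M-refl i j = refl

    ≈M-sym : {A B : Mat n} → A ≈M B → B ≈M A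
    ≈M-sym eq i j = sym (eq i j)

    ≈M-trans : {A B C : Mat n} → A ≈M B → B ≈M C → A ≈M C
    ≈M-trans eq eq′ i j = trans (eq i j) (eq′ i j)

    *M-cong : {A A′ B B′ : Mat n} → A ≈M A′ → B ≈M B′ → (A *M B) ≈M (A′ *M B′)
    *M-cong eq eq′ i j = ∑-cong n (λ t → *-cong (eq i t) (eq′ t j))

    *M-assoc : (A B C : Mat n) → ((A *M B) *M C) ≈M (A *M (B *M C))
    *M-assoc A B C i j = begin
      ∑ n (λ t → ∑ n (λ r → A i r * B r t) * C t j)
        ≈⟨ ∑-cong n (λ t → trans (sym (∑-*ʳ n (C t j) _)) (∑-cong n (λ r → *-assoc (A i r) (B r t) (C t j)))) ⟩
      ∑ n (λ t → ∑ n (λ r → A i r * (B r t * C t j))) ≈⟨ ∑-swap n n _ ⟩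
      ∑ n (λ r → ∑ n (λ t → A i r * (B r t * C t j))) ≈⟨ ∑-cong n (λ r → ∑-*ˡ n (A i r) _) ⟩
      ∑ n (λ r → A i r * ∑ n (λ t → B r t * C t j)) ∎

    *M-identityˡ : (A : Mat n) → (idM *M A) ≈M A
    *M-identityˡ A i j = ∑-idˡ n i (λ t → A t j)

    *M-identityʳ : (A : Mat n) → (A *M idM) ≈M A
    *M-identityʳ A i j = ∑-idʳ n j (A i)

    *M-distribˡ : (A B C : Mat n) → (A *M (B +M C)) ≈M ((A *M B) +M (A *M C))
    *M-distribˡ A B C i j = trans (∑-cong n (λ t → distribˡ _ _ _)) (∑-+ n _ _)

    *M-distribʳ : (A B C : Mat n) → ((A +M B) *M C) ≈M ((A *M C) +M (B *M C))
    *M-distribʳ A B C i j = trans (∑-cong n (λ t → distribʳ _ _ _)) (∑-+ n _ _)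

    ^M-comm : (A : Mat n) → ∀ k → (A *M (A ^M k)) ≈M ((A ^M k) *M A)
    ^M-comm A zero = ≈M-trans (*M-identityʳ A) (≈M-sym (*M-identityˡ A))
    ^M-comm A (suc k) = ≈M-trans (*M-cong (≈M-refl {A}) (^M-comm A k)) (≈M-sym (*M-assoc A (A ^M k) A))

    _ᵀ : Mat n → Mat n
    (A ᵀ) i j = A j i

    ᵀ-* : (A B : Mat n) → ((A *M B) ᵀ) ≈M ((B ᵀ) *M (A ᵀ))
    ᵀ-* A B i j = ∑-cong n (λ t → *-comm _ _)

    idM-sym : ((idM {n}) ᵀ) ≈M idM
    idM-sym i j with i Fin.≟ j
    ... | yes ≡.refl = refl
    ... | no i≢j = reflexive (≡.trans (idM-off j i (i≢j ∘ ≡.sym)) (≡.sym (idM-off i j i≢j)))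

    ᵀ-^ : (A : Mat n) → ∀ k → ((A ᵀ) ^M k) ≈M ((A ^M k) ᵀ)
    ᵀ-^ A zero = ≈M-sym idM-sym
    ᵀ-^ A (suc k) = ≈M-trans (*M-cong (≈M-refl {A ᵀ}) (ᵀ-^ A k))
      (≈M-trans (≈M-sym (ᵀ-* (A ^M k) A)) (λ i j → sym (^M-comm A k j i)))

    tr : Mat n → Carrier
    tr A = ∑ n (λ i → A i i)

    tr-cong : {A B : Mat n} → A ≈M B → tr A ≈ tr B
    tr-cong eq = ∑-cong n (λ i → eq i i)

    tr-* : (A B : Mat n) → tr (A *M B) ≈ tr (B *M A)
    tr-* A B = trans (∑-swap n n _) (∑-cong n (λ i → ∑-cong n (λ j → *-comm _ _)))

  record Invertible (n : ℕ) : Set (c ⊔ ℓ) where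
    field
      P P⁻¹ : Mat n
      PP⁻¹ : (P *M P⁻¹) ≈M idM
      P⁻¹P : (P⁻¹ *M P) ≈M idM

  module _ {n : ℕ} where
    open Invertible

    conj : Invertible n → Mat n → Mat n
    conj T C = (P T *M C) *M P⁻¹ T

    inv : Invertible n → Invertible n
    inv T = record { P = P⁻¹ T ; P⁻¹ = P T ; PP⁻¹ = P⁻¹P T ; P⁻¹P = PP⁻¹ T }

    conj-cong : ∀ T {C D : Mat n} → C ≈M D → conj T C ≈M conj T D
    conj-cong T eq = *M-cong (*M-cong (≈M-refl {A = P T}) eq) (≈M-refl {A = P⁻¹ T})

    conj-inv : ∀ T C → conj (inv T) (conj T C) ≈M C
    conj-inv T C = ≈M-trans (*M-assoc P′ ((Q *M C) *M P′) Q) (≈M-trans (*M-cong (≈M-refl {A = P′})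
        (≈M-trans (*M-assoc (Q *M C) P′ Q) (≈M-trans (*M-cong (≈M-refl {A = Q *M C}) (P⁻¹P T)) (*M-identityʳ (Q *M C)))))
      (≈M-trans (≈M-sym (*M-assoc P′ Q C)) (≈M-trans (*M-cong (P⁻¹P T) (≈M-refl {A = C})) (*M-identityˡ C))))
      where
      Q = P T
      P′ = P⁻¹ T

    conj-+ : ∀ T C D → conj T (C +M D) ≈M (conj T C +M conj T D)
    conj-+ T C D = ≈M-trans (*M-cong (*M-distribˡ (P T) C D) (≈M-refl {A = P⁻¹ T})) (*M-distribʳ (P T *M C) (P T *M D) (P⁻¹ T))

    conj-* : ∀ T C D → (conj T C *M conj T D) ≈M conj T (C *M D)
    conj-* T C D = ≈M-trans (*M-assoc (Q *M C) P′ ((Q *M D) *M P′)) (≈M-trans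
      (*M-cong (≈M-refl {A = Q *M C}) (≈M-trans (≈M-sym (*M-assoc P′ (Q *M D) P′)) (*M-cong
        (≈M-trans (≈M-sym (*M-assoc P′ Q D)) (≈M-trans (*M-cong (P⁻¹P T) (≈M-refl {A = D})) (*M-identityˡ D))) (≈M-refl {A = P′}))))
      (≈M-trans (≈M-sym (*M-assoc (Q *M C) D P′)) (*M-cong (*M-assoc Q C D) (≈M-refl {A = P′}))))
      where
      Q = P T
      P′ = P⁻¹ T

    conj-^ : ∀ T C k → (conj T C ^M k) ≈M conj T (C ^M k)
    conj-^ T C zero = ≈M-sym (≈M-trans (*M-cong (*M-identityʳ (P T)) (≈M-refl {A = P⁻¹ T})) (PP⁻¹ T))
    conj-^ T C (suc k) = ≈M-trans (*M-cong (≈M-refl {A = conj T C}) (conj-^ T C k)) (conj-* T C (C ^M k))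

    tr-conj : ∀ T C → tr (conj T C) ≈ tr C
    tr-conj T C = trans (tr-* (P T *M C) (P⁻¹ T)) (tr-cong (≈M-trans (≈M-sym (*M-assoc (P⁻¹ T) (P T) C))
      (≈M-trans (*M-cong (P⁻¹P T) (≈M-refl {A = C})) (*M-identityˡ C))))

    identity : Invertible n
    identity = record { P = idM ; P⁻¹ = idM ; PP⁻¹ = *M-identityˡ idM ; P⁻¹P = *M-identityˡ idM }

    Similar : Mat n → Mat n → Set _
    Similar C D = ∃ λ T → conj T C ≈M D

    Similar-refl : ∀ {C} → Similar C C
    Similar-refl {C} = identity , ≈M-trans (*M-identityʳ (idM *M C)) (*M-identityˡ C)

    Similar-trans : ∀ {C D E} → Similar C D → Similar D E → Similar C E
    Similar-trans {C} (S , eq) (T , eq′) = composite , ≈M-trans (≈M-trans (≈M-trans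
        (*M-cong (*M-assoc (P T) (P S) C) (≈M-refl {A = P⁻¹ S *M P⁻¹ T}))
        (≈M-trans (≈M-sym (*M-assoc (P T *M (P S *M C)) (P⁻¹ S) (P⁻¹ T))) (*M-cong (*M-assoc (P T) (P S *M C) (P⁻¹ S)) (≈M-refl {A = P⁻¹ T}))))
        (conj-cong T eq)) eq′
      where
      cancel : ∀ (A B C D : Mat n) → (B *M C) ≈M idM → (A *M D) ≈M idM → ((A *M B) *M (C *M D)) ≈M idM
      cancel A B C D BC AD = ≈M-trans (*M-assoc A B (C *M D)) (≈M-trans (*M-cong (≈M-refl {A = A})
        (≈M-trans (≈M-sym (*M-assoc B C D)) (≈M-trans (*M-cong BC (≈M-refl {A = D})) (*M-identityˡ D)))) AD)
      composite : Invertible n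
      composite = record { P = P T *M P S ; P⁻¹ = P⁻¹ S *M P⁻¹ T
        ; PP⁻¹ = cancel (P T) (P S) (P⁻¹ S) (P⁻¹ T) (PP⁻¹ S) (PP⁻¹ T)
        ; P⁻¹P = cancel (P⁻¹ S) (P⁻¹ T) (P T) (P S) (P⁻¹P T) (P⁻¹P S) }

    Similar-tr : ∀ {C D} → Similar C D → tr D ≈ tr C
    Similar-tr {C} (T , eq) = trans (sym (tr-cong eq)) (tr-conj T C)

    -- The matrix I + e_a wᵀ. When w a = 0, negating w gives the inverse.
    transvection : Fin n → (Fin n → Carrier) → Mat n
    transvection a w i j = idM i j + idM i a * w j

    *M-transvection : ∀ X a w i j → (X *M transvection a w) i j ≈ X i j + X i a * w j
    *M-transvection X a w i j = begin
      ∑ n (λ t → X i t * (idM t j + idM t a * w j))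
        ≈⟨ ∑-cong n (λ t → solve 4 (λ x y z w → x :* (y :+ z :* w) := x :* y :+ x :* z :* w) refl (X i t) (idM t j) (idM t a) (w j)) ⟩
      ∑ n (λ t → X i t * idM t j + X i t * idM t a * w j) ≈⟨ ∑-+ n _ _ ⟩
      ∑ n (λ t → X i t * idM t j) + ∑ n (λ t → X i t * idM t a * w j)
        ≈⟨ +-cong (∑-idʳ n j (X i)) (trans (∑-*ʳ n (w j) _) (*-congʳ (∑-idʳ n a (X i)))) ⟩
      X i j + X i a * w j ∎

    transvection-*M : ∀ C a w i j → (transvection a w *M C) i j ≈ C i j + idM i a * ∑ n (λ t → w t * C t j)
    transvection-*M C a w i j = begin
      ∑ n (λ t → (idM i t + idM i a * w t) * C t j)
        ≈⟨ ∑-cong n (λ t → solve 4 (λ x y z w → (x :+ y :* z) :* w := x :* w :+ y :* (z :* w)) refl (idM i t) (idM i a) (w t) (C t j)) ⟩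
      ∑ n (λ t → idM i t * C t j + idM i a * (w t * C t j)) ≈⟨ ∑-+ n _ _ ⟩
      ∑ n (λ t → idM i t * C t j) + ∑ n (λ t → idM i a * (w t * C t j))
        ≈⟨ +-cong (∑-idˡ n i (λ t → C t j)) (∑-*ˡ n (idM i a) _) ⟩
      C i j + idM i a * ∑ n (λ t → w t * C t j) ∎

    shear : ∀ a w → w a ≈ 0# → Invertible n
    shear a w wa≈0 = record { P = transvection a w ; P⁻¹ = transvection a (λ j → - w j)
      ; PP⁻¹ = cancel w (λ j → - w j) wa≈0 (λ j → -‿inverseʳ (w j))
      ; P⁻¹P = cancel (λ j → - w j) w (trans (-‿cong wa≈0) (solve 0 (:- con (0 , 0) := con (0 , 0)) refl)) (λ j → -‿inverseˡ (w j)) }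
      where
      cancel : ∀ v w → v a ≈ 0# → (∀ j → v j + w j ≈ 0#) → (transvection a v *M transvection a w) ≈M idM
      cancel v w va≈0 eq i j = begin
        (transvection a v *M transvection a w) i j ≈⟨ *M-transvection (transvection a v) a w i j ⟩
        idM i j + idM i a * v j + (idM i a + idM i a * v a) * w j ≈⟨ +-congˡ (*-congʳ (+-congˡ (*-congˡ va≈0))) ⟩
        idM i j + idM i a * v j + (idM i a + idM i a * 0#) * w j
          ≈⟨ solve 4 (λ x y v w → x :+ y :* v :+ (y :+ y :* con (0 , 0)) :* w := x :+ y :* (v :+ w)) refl (idM i j) (idM i a) (v j) (w j) ⟩
        idM i j + idM i a * (v j + w j) ≈⟨ +-congˡ (trans (*-congˡ (eq j)) (zeroʳ _)) ⟩
        idM i j + 0# ≈⟨ +-identityʳ _ ⟩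
        idM i j ∎

    shear-entry : ∀ a w wa≈0 C i j → conj (shear a w wa≈0) C i j ≈
      C i j + idM i a * ∑ n (λ t → w t * C t j) - (C i a + idM i a * ∑ n (λ t → w t * C t a)) * w j
    shear-entry a w wa≈0 C i j = trans (*M-transvection (transvection a w *M C) a (λ j → - w j) i j)
      (trans (+-cong (transvection-*M C a w i j) (*-congʳ (transvection-*M C a w i a)))
        (solve 3 (λ x y w → x :+ y :* (:- w) := x :- y :* w) refl _ _ (w j)))

  minor : ∀ {n} → Mat (suc n) → Mat n
  minor C i j = C (suc i) (suc j)

  1⊕ : ∀ {n} → Mat n → Mat (suc n)
  1⊕ A zero zero = 1#
  1⊕ A zero (suc j) = 0#
  1⊕ A (suc i) zero = 0#
  1⊕ A (suc i) (suc j) = A i j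

  module _ {n : ℕ} where
    1⊕-*M-zero : ∀ (A : Mat n) C j → (1⊕ A *M C) zero j ≈ C zero j
    1⊕-*M-zero A C j = trans (+-cong (*-identityˡ _) (∑-zero n (λ t → zeroˡ _))) (+-identityʳ _)

    1⊕-*M-suc : ∀ (A : Mat n) C i j → (1⊕ A *M C) (suc i) j ≈ ∑ n (λ t → A i t * C (suc t) j)
    1⊕-*M-suc A C i j = trans (+-congʳ (zeroˡ _)) (+-identityˡ _)

    *M-1⊕-zero : ∀ C (A : Mat n) i → (C *M 1⊕ A) i zero ≈ C i zero
    *M-1⊕-zero C A i = trans (+-cong (*-identityʳ _) (∑-zero n (λ t → zeroʳ _))) (+-identityʳ _)

    *M-1⊕-suc : ∀ C (A : Mat n) i j → (C *M 1⊕ A) i (suc j) ≈ ∑ n (λ t → C i (suc t) * A t j)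
    *M-1⊕-suc C A i j = trans (+-congʳ (zeroʳ _)) (+-identityˡ _)

    1⊕-cancel : ∀ {A B : Mat n} → (A *M B) ≈M idM → (1⊕ A *M 1⊕ B) ≈M idM
    1⊕-cancel {A} {B} eq zero zero = 1⊕-*M-zero A (1⊕ B) zero
    1⊕-cancel {A} {B} eq zero (suc j) = 1⊕-*M-zero A (1⊕ B) (suc j)
    1⊕-cancel {A} {B} eq (suc i) zero = *M-1⊕-zero (1⊕ A) B (suc i)
    1⊕-cancel {A} {B} eq (suc i) (suc j) = trans (1⊕-*M-suc A (1⊕ B) i (suc j)) (eq i j)

    1⊕-invertible : Invertible n → Invertible (suc n)
    1⊕-invertible T = record { P = 1⊕ (P T) ; P⁻¹ = 1⊕ (P⁻¹ T) ; PP⁻¹ = 1⊕-cancel (PP⁻¹ T) ; P⁻¹P = 1⊕-cancel (P⁻¹P T) }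
      where open Invertible

    conj-1⊕-corner : ∀ T C → conj (1⊕-invertible T) C zero zero ≈ C zero zero
    conj-1⊕-corner T C = trans (*M-1⊕-zero (1⊕ (P T) *M C) (P⁻¹ T) zero) (1⊕-*M-zero (P T) C zero)
      where open Invertible

    conj-1⊕-minor : ∀ T C → minor (conj (1⊕-invertible T) C) ≈M conj T (minor C)
    conj-1⊕-minor T C i j = trans (*M-1⊕-suc (1⊕ (P T) *M C) (P⁻¹ T) (suc i) j) (∑-cong n (λ t → *-congʳ (1⊕-*M-suc (P T) C i (suc t))))
      where open Invertible

-- Similar matrices with a prescribed diagonal

module PrescribedDiagonal {c ℓ} (F : CommutativeRing c ℓ) {q : ℕ} (isFF : IsFiniteField F q) where
  open CommutativeRing F hiding (zero)
  open IsFiniteField isFF using (inverse)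
  open FiniteField F isFF using (_≟_; 1≉0)
  open Matrices F
  open Identity F
  open MatrixAlgebra F
  open Solver F
  open import Algebra.Properties.Ring ring using (x∙y⁻¹≈ε⇒x≈y)
  open import Relation.Binary.Reasoning.Setoid setoid

  Scalar : ∀ {n} → Mat (suc n) → Set ℓ
  Scalar C = C ≈M (λ i j → C zero zero * idM i j)

  -- The nonzero entry is the pivot: a multiple of its row, added to row 0, gives the corner any
  -- prescribed value.
  Active : ∀ {n} → Mat (suc n) → Set _
  Active {n} C = ∃ λ D → Similar C D × ∃ λ (j : Fin n) → ¬ D (suc j) zero ≈ 0#

  module _ {n : ℕ} where
    -- Conjugation by it adds row 0 to row l + 1 and subtracts column l + 1 from column 0, so it
    -- brings other entries into column 0.
    add-row₀ : Fin n → Invertible (suc n)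
    add-row₀ l = shear (suc l) (idM zero) refl

    add-row₀-entry : ∀ l (C : Mat (suc n)) i → conj (add-row₀ l) C (suc i) zero ≈
      C (suc i) zero + idM i l * C zero zero - (C (suc i) (suc l) + idM i l * C zero (suc l))
    add-row₀-entry l C i = trans (shear-entry (suc l) (idM zero) refl C (suc i) zero)
      (+-cong (+-congˡ (*-congˡ (∑-idˡ (suc n) zero (λ t → C t zero))))
        (-‿cong (trans (*-identityʳ _) (+-congˡ (*-congˡ (∑-idˡ (suc n) zero (λ t → C t (suc l))))))))

    add-row₀-off : ∀ (C : Mat (suc n)) i l → i ≢ l → conj (add-row₀ l) C (suc i) zero ≈ C (suc i) zero - C (suc i) (suc l)
    add-row₀-off C i l i≢l = trans (add-row₀-entry l C i)
      (trans (+-cong (+-congˡ (*-congʳ (reflexive (idM-off i l i≢l)))) (-‿cong (+-congˡ (*-congʳ (reflexive (idM-off i l i≢l))))))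
        (solve 4 (λ a x b y → a :+ con (0 , 0) :* x :- (b :+ con (0 , 0) :* y) := a :- b) refl _ _ _ _))

    add-row₀-diagonal : ∀ (C : Mat (suc n)) l → conj (add-row₀ l) C (suc l) zero ≈ C (suc l) zero + C zero zero - (C (suc l) (suc l) + C zero (suc l))
    add-row₀-diagonal C l = trans (add-row₀-entry l C l)
      (trans (+-cong (+-congˡ (*-congʳ (reflexive (idM-diagonal l)))) (-‿cong (+-congˡ (*-congʳ (reflexive (idM-diagonal l))))))
        (solve 4 (λ a x b y → a :+ con (1 , 0) :* x :- (b :+ con (1 , 0) :* y) := a :+ x :- (b :+ y)) refl _ _ _ _))

    add-row : Fin n → Invertible (suc n)
    add-row l = shear zero (idM (suc l)) refl

    add-row-entry : ∀ l (C : Mat (suc n)) i j → conj (add-row l) C i j ≈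
      C i j + idM i zero * C (suc l) j - (C i zero + idM i zero * C (suc l) zero) * idM (suc l) j
    add-row-entry l C i j = trans (shear-entry zero (idM (suc l)) refl C i j)
      (+-cong (+-congˡ (*-congˡ (∑-idˡ (suc n) (suc l) (λ t → C t j))))
        (-‿cong (*-congʳ (+-congˡ (*-congˡ (∑-idˡ (suc n) (suc l) (λ t → C t zero)))))))

    -- Suppose column 0 vanishes below its corner c. Then `add-row₀ l` puts -C(i,l) there for
    -- off-diagonal places of the minor and c - d - b for i = l, where d and b are the diagonal
    -- entry and the top entry of column l + 1. If all these vanish while some b ≠ 0, `add-row l`
    -- first clears b, keeping c and d, and the new entry is then c - d = b. If every b vanishes
    -- too, C is scalar.
    activate : ∀ (C : Mat (suc n)) → ¬ Scalar C → Active C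
    activate C nonscalar with any? (λ j → ¬? (C (suc j) zero ≟ 0#))
    ... | yes (j , ≉0) = C , Similar-refl , j , ≉0
    ... | no col₀ with any? (λ i → any? (λ l → ¬? (i Fin.≟ l) ×-dec ¬? (C (suc i) (suc l) ≟ 0#)))
    ...   | yes (i , l , i≢l , ≉0) = conj (add-row₀ l) C , (add-row₀ l , ≈M-refl) , i , λ eq → ≉0 (begin
            C (suc i) (suc l) ≈⟨ solve 2 (λ a b → b := a :- (a :- b)) refl (C (suc i) zero) _ ⟩
            C (suc i) zero - (C (suc i) zero - C (suc i) (suc l))
              ≈⟨ +-cong (decidable-stable (_ ≟ 0#) (λ ≉ → col₀ (i , ≉))) (-‿cong (trans (sym (add-row₀-off C i l i≢l)) eq)) ⟩
            0# - 0# ≈⟨ -‿inverseʳ 0# ⟩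
            0# ∎)
    ...   | no off with any? (λ l → ¬? (C zero zero ≟ C (suc l) (suc l) + C zero (suc l)))
    ...     | yes (l , ≉) = conj (add-row₀ l) C , (add-row₀ l , ≈M-refl) , l , λ eq → ≉ (x∙y⁻¹≈ε⇒x≈y _ _ (begin
              C zero zero - (C (suc l) (suc l) + C zero (suc l)) ≈⟨ +-congʳ (+-identityˡ _) ⟨
              0# + C zero zero - (C (suc l) (suc l) + C zero (suc l))
                ≈⟨ +-congʳ (+-congʳ (decidable-stable (_ ≟ 0#) (λ ≉ → col₀ (l , ≉)))) ⟨
              C (suc l) zero + C zero zero - (C (suc l) (suc l) + C zero (suc l)) ≈⟨ add-row₀-diagonal C l ⟨
              conj (add-row₀ l) C (suc l) zero ≈⟨ eq ⟩
              0# ∎))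
    ...     | no corner with any? (λ l → ¬? (C zero (suc l) ≟ 0#))
    ...       | yes (l , ≉0) = conj (add-row₀ l) D , Similar-trans {C = C} {D} (add-row l , ≈M-refl) (add-row₀ l , ≈M-refl) , l , λ eq → ≉0 (begin
                b ≈⟨ solve 4 (λ a b c d → b := c :- d :- (c :- (d :+ b))) refl a b c′ d ⟩
                c′ - d - (c′ - (d + b))
                  ≈⟨ +-cong (trans (sym (+-cong D00 (-‿cong Ddd))) D-value) (-‿cong (trans (+-congʳ c≈d+b) (-‿inverseʳ (d + b)))) ⟩
                conj (add-row₀ l) D (suc l) zero - 0# ≈⟨ +-congʳ eq ⟩
                0# - 0# ≈⟨ -‿inverseʳ 0# ⟩
                0# ∎)
      where
      D = conj (add-row l) C
      a = C (suc l) zero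
      b = C zero (suc l)
      c′ = C zero zero
      d = C (suc l) (suc l)
      a≈0 : a ≈ 0#
      a≈0 = decidable-stable (_ ≟ 0#) (λ ≉ → col₀ (l , ≉))
      c≈d+b : c′ ≈ d + b
      c≈d+b = decidable-stable (_ ≟ _) (λ ≉ → corner (l , ≉))
      D00 : D zero zero ≈ c′
      D00 = trans (add-row-entry l C zero zero) (trans (solve 2 (λ a c → c :+ con (1 , 0) :* a :- (c :+ con (1 , 0) :* a) :* con (0 , 0) := c :+ a) refl a c′)
        (trans (+-congˡ a≈0) (+-identityʳ c′)))
      Ddd : D (suc l) (suc l) ≈ d
      Ddd = trans (add-row-entry l C (suc l) (suc l)) (trans (+-congˡ (-‿cong (*-cong (trans (+-cong a≈0 (zeroˡ _)) (+-identityʳ 0#)) refl)))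
        (solve 3 (λ a d i → d :+ con (0 , 0) :* d :- con (0 , 0) :* i := d) refl a d _))
      Da : D (suc l) zero ≈ 0#
      Da = trans (add-row-entry l C (suc l) zero) (trans (solve 1 (λ a → a :+ con (0 , 0) :* a :- (a :+ con (0 , 0) :* a) :* con (0 , 0) := a) refl a) a≈0)
      Db : D zero (suc l) ≈ 0#
      Db = trans (add-row-entry l C zero (suc l)) (trans (+-congˡ (-‿cong (*-cong (trans (+-congˡ (trans (*-identityˡ a) a≈0)) (+-identityʳ c′)) (reflexive (idM-diagonal l)))))
        (trans (solve 3 (λ b d c → b :+ con (1 , 0) :* d :- c :* con (1 , 0) := d :+ b :- c) refl b d c′) (trans (+-congˡ (-‿cong c≈d+b)) (-‿inverseʳ _))))
      D-value : D zero zero - D (suc l) (suc l) ≈ conj (add-row₀ l) D (suc l) zero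
      D-value = sym (trans (add-row₀-diagonal D l) (trans (+-cong (trans (+-congʳ Da) (+-identityˡ _)) (-‿cong (trans (+-congˡ Db) (+-identityʳ _)))) refl))
    ...       | no row₀ = contradiction scalar nonscalar
      where
      scalar : Scalar C
      scalar zero zero = sym (*-identityʳ _)
      scalar zero (suc l) = trans (decidable-stable (_ ≟ 0#) (λ ≉ → row₀ (l , ≉))) (sym (zeroʳ _))
      scalar (suc i) zero = trans (decidable-stable (_ ≟ 0#) (λ ≉ → col₀ (i , ≉))) (sym (zeroʳ _))
      scalar (suc i) (suc l) with i Fin.≟ l
      ... | yes ≡.refl = begin
        C (suc i) (suc i) ≈⟨ +-identityʳ _ ⟨
        C (suc i) (suc i) + 0# ≈⟨ +-congˡ (decidable-stable (_ ≟ 0#) (λ ≉ → row₀ (i , ≉))) ⟨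
        C (suc i) (suc i) + C zero (suc i) ≈⟨ decidable-stable (_ ≟ _) (λ ≉ → corner (i , ≉)) ⟨
        C zero zero ≈⟨ trans (*-congˡ (reflexive (idM-diagonal i))) (*-identityʳ _) ⟨
        C zero zero * idM i i ∎
      ... | no i≢l = trans (decidable-stable (_ ≟ 0#) (λ ≉ → off (i , l , i≢l , ≉))) (sym (trans (*-congˡ (reflexive (idM-off i l i≢l))) (zeroʳ _)))

    cons₀ : (Fin n → Carrier) → Fin (suc n) → Carrier
    cons₀ r zero = 0#
    cons₀ r (suc t) = r t

    corner-shear : (Fin n → Carrier) → Invertible (suc n)
    corner-shear r = shear zero (cons₀ r) refl

    corner-shear-corner : ∀ r (C : Mat (suc n)) → conj (corner-shear r) C zero zero ≈ C zero zero + ∑ n (λ t → r t * C (suc t) zero)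
    corner-shear-corner r C = trans (shear-entry zero (cons₀ r) refl C zero zero)
      (solve 4 (λ c S x y → c :+ con (1 , 0) :* (con (0 , 0) :* x :+ S) :- y :* con (0 , 0) := c :+ S) refl _ _ _ _)

    corner-shear-minor : ∀ r (C : Mat (suc n)) i l → minor (conj (corner-shear r) C) i l ≈ C (suc i) (suc l) - C (suc i) zero * r l
    corner-shear-minor r C i l = trans (shear-entry zero (cons₀ r) refl C (suc i) (suc l))
      (solve 5 (λ c x a y r → c :+ con (0 , 0) :* x :- (a :+ con (0 , 0) :* y) :* r := c :- a :* r) refl _ _ _ _ _)

  another : ∀ {n} (j : Fin (suc (suc n))) → ∃ λ l → j ≢ l
  another zero = suc zero , λ ()
  another (suc j) = zero , λ ()

  offdiagonal⇒nonscalar : ∀ {n} {C : Mat (suc n)} {i l} → i ≢ l → ¬ C i l ≈ 0# → ¬ Scalar C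
  offdiagonal⇒nonscalar {i = i} {l} i≢l ≉0 scalar = ≉0 (trans (scalar i l) (trans (*-congˡ (reflexive (idM-off i l i≢l))) (zeroʳ _)))

  -- Choosing the row vector r makes the corner equal to d, and (for size at least 3) some
  -- off-diagonal entry of the minor equal to 1, so that the induction can continue.
  set-corner : ∀ {n} (C : Mat (suc (suc n))) j → ¬ C (suc j) zero ≈ 0# → ∀ d →
    ∃ λ D → Similar C D × D zero zero ≈ d × (n ≡ 0 ⊎ ¬ Scalar (minor D))
  set-corner {zero} C zero y≉0 d with inverse (C (suc zero) zero) y≉0
  ... | y⁻¹ , yy⁻¹≈1 = conj (corner-shear r) C , (corner-shear r , ≈M-refl) , (begin
    conj (corner-shear r) C zero zero ≈⟨ corner-shear-corner r C ⟩
    C zero zero + ((d - C zero zero) * y⁻¹ * C (suc zero) zero + 0#)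
      ≈⟨ solve 4 (λ c d y i → c :+ ((d :- c) :* i :* y :+ con (0 , 0)) := c :+ (d :- c) :* (y :* i)) refl (C zero zero) d (C (suc zero) zero) y⁻¹ ⟩
    C zero zero + (d - C zero zero) * (C (suc zero) zero * y⁻¹) ≈⟨ +-congˡ (*-congˡ yy⁻¹≈1) ⟩
    C zero zero + (d - C zero zero) * 1# ≈⟨ solve 2 (λ c d → c :+ (d :- c) :* con (1 , 0) := d) refl (C zero zero) d ⟩
    d ∎) , inj₁ ≡.refl
    where
    r : Fin 1 → Carrier
    r _ = (d - C zero zero) * y⁻¹
  set-corner {suc n} C j y≉0 d with inverse (C (suc j) zero) y≉0 | another j
  ... | y⁻¹ , yy⁻¹≈1 | l , j≢l = conj (corner-shear r) C , (corner-shear r , ≈M-refl) , corner , inj₂ (offdiagonal⇒nonscalar j≢l λ eq → 1≉0 (trans (sym entry) eq))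
    where
    y = C (suc j) zero
    z = C (suc l) zero
    -- The entry at (j, l) of the new minor sees r only through r l = `s`, so it fixes `s`; `t` then
    -- corrects the corner, to which row l has already contributed s z.
    s = (C (suc j) (suc l) - 1#) * y⁻¹
    t = (d - C zero zero - s * z) * y⁻¹
    r : Fin (suc (suc n)) → Carrier
    r i = t * idM j i + s * idM l i
    corner : conj (corner-shear r) C zero zero ≈ d
    corner = begin
      conj (corner-shear r) C zero zero ≈⟨ corner-shear-corner r C ⟩
      C zero zero + ∑ (suc (suc n)) (λ i → (t * idM j i + s * idM l i) * C (suc i) zero)
        ≈⟨ +-congˡ (trans (∑-cong (suc (suc n)) (λ i → solve 5 (λ t x s y c → (t :* x :+ s :* y) :* c := t :* (x :* c) :+ s :* (y :* c)) refl t (idM j i) s (idM l i) (C (suc i) zero)))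
             (trans (∑-+ (suc (suc n)) (λ i → t * (idM j i * C (suc i) zero)) (λ i → s * (idM l i * C (suc i) zero)))
             (+-cong (trans (∑-*ˡ (suc (suc n)) t (λ i → idM j i * C (suc i) zero)) (*-congˡ (∑-idˡ (suc (suc n)) j (λ i → C (suc i) zero))))
                     (trans (∑-*ˡ (suc (suc n)) s (λ i → idM l i * C (suc i) zero)) (*-congˡ (∑-idˡ (suc (suc n)) l (λ i → C (suc i) zero))))))) ⟩
      C zero zero + (t * y + s * z)
        ≈⟨ solve 5 (λ c D i y S → c :+ (D :* i :* y :+ S) := c :+ (D :* (y :* i) :+ S)) refl (C zero zero) (d - C zero zero - s * z) y⁻¹ y (s * z) ⟩
      C zero zero + ((d - C zero zero - s * z) * (y * y⁻¹) + s * z) ≈⟨ +-congˡ (+-congʳ (*-congˡ yy⁻¹≈1)) ⟩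
      C zero zero + ((d - C zero zero - s * z) * 1# + s * z)
        ≈⟨ solve 3 (λ c d S → c :+ ((d :- c :- S) :* con (1 , 0) :+ S) := d) refl (C zero zero) d (s * z) ⟩
      d ∎
    entry : minor (conj (corner-shear r) C) j l ≈ 1#
    entry = begin
      minor (conj (corner-shear r) C) j l ≈⟨ corner-shear-minor r C j l ⟩
      e - y * (t * idM j l + s * idM l l)
        ≈⟨ +-congˡ (-‿cong (*-congˡ (+-cong (*-congˡ (reflexive (idM-off j l j≢l))) (*-congˡ (reflexive (idM-diagonal l)))))) ⟩
      e - y * (t * 0# + (e - 1#) * y⁻¹ * 1#)
        ≈⟨ solve 4 (λ e y t i → e :- y :* (t :* con (0 , 0) :+ (e :- con (1 , 0)) :* i :* con (1 , 0)) := e :- (e :- con (1 , 0)) :* (y :* i)) refl e y t y⁻¹ ⟩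
      e - (e - 1#) * (y * y⁻¹) ≈⟨ +-congˡ (-‿cong (*-congˡ yy⁻¹≈1)) ⟩
      e - (e - 1#) * 1# ≈⟨ solve 1 (λ e → e :- (e :- con (1 , 0)) :* con (1 , 0) := con (1 , 0)) refl e ⟩
      1# ∎
      where e = C (suc j) (suc l)

  prescribe-diagonal : ∀ n (C : Mat (suc n)) → (n ≡ 0 ⊎ ¬ Scalar C) → ∀ d → ∑ (suc n) d ≈ tr C →
    ∃ λ D → Similar C D × (∀ i → D i i ≈ d i)
  prescribe-diagonal zero C _ d eq = C , Similar-refl , λ { zero → trans (sym (+-identityʳ _)) (trans (sym eq) (+-identityʳ _)) }
  prescribe-diagonal (suc n) C (inj₂ nonscalar) d eq = step (activate C nonscalar)
    where
    Goal : Set _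
    Goal = ∃ λ D → Similar C D × (∀ i → D i i ≈ d i)
    extend : ∀ C₂ → Similar C C₂ → C₂ zero zero ≈ d zero → (∃ λ D → Similar (minor C₂) D × (∀ i → D i i ≈ d (suc i))) → Goal
    extend C₂ sim corner (D , (T , eqT) , diagonal) = conj (1⊕-invertible T) C₂ , Similar-trans {C = C} {C₂} sim (1⊕-invertible T , ≈M-refl) ,
      λ { zero → trans (conj-1⊕-corner T C₂) corner ; (suc i) → trans (conj-1⊕-minor T C₂ i i) (trans (eqT i i) (diagonal i)) }
    step : Active C → Goal
    step (C₁ , sim₁ , j , ≉0) = step₂ (set-corner C₁ j ≉0 (d zero))
      where
      step₂ : (∃ λ D → Similar C₁ D × D zero zero ≈ d zero × (n ≡ 0 ⊎ ¬ Scalar (minor D))) → Goal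
      step₂ (C₂ , sim₂ , corner , nonscalar₂) = extend C₂ sim corner (prescribe-diagonal n (minor C₂) nonscalar₂ (d ∘ suc) trace)
        where
        sim : Similar C C₂
        sim = Similar-trans {C = C} {C₁} sim₁ sim₂
        trace : ∑ (suc n) (d ∘ suc) ≈ tr (minor C₂)
        trace = begin
          S ≈⟨ solve 2 (λ a S → S := a :+ S :- a) refl (d zero) S ⟩
          d zero + S - d zero ≈⟨ +-cong (trans eq (sym (Similar-tr {C = C} sim))) (-‿cong (sym corner)) ⟩
          C₂ zero zero + tr (minor C₂) - C₂ zero zero ≈⟨ solve 2 (λ a S → a :+ S :- a := S) refl (C₂ zero zero) (tr (minor C₂)) ⟩
          tr (minor C₂) ∎
          where S = ∑ (suc n) (d ∘ suc)

-- Roots of triangular matrices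

module TriangularRoots {c ℓ} (F : CommutativeRing c ℓ) {q : ℕ} (isFF : IsFiniteField F q) (k-1 : ℕ) where
  open CommutativeRing F hiding (zero)
  open IsFiniteField isFF using (inverse; enum)
  open FiniteField F isFF
  open Matrices F
  open Identity F
  open MatrixAlgebra F
  open Solver F
  open import Algebra.Properties.CommutativeSemiring.Exp commutativeSemiring
  open import Algebra.Properties.Semiring.Mult semiring using (×-comm-*; ×-assoc-*; ×-congʳ) renaming (_×_ to _·_)
  open import Algebra.Properties.Ring ring using (x∙y⁻¹≈ε⇒x≈y)
  open import Relation.Binary.Reasoning.Setoid setoid

  k : ℕ
  k = suc k-1

  Pow : Carrier → Set _
  Pow x = ∃ λ y → y ^ k ≈ x

  abstract
    rootAt : Fin q → Carrier
    rootAt j with any? (λ i → enum i ^ k ≟ enum j)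
    ... | yes (i , _) = enum i
    ... | no _ = 0#

    rootAt-^ : ∀ j → Pow (enum j) → rootAt j ^ k ≈ enum j
    rootAt-^ j (y , eq) with any? (λ i → enum i ^ k ≟ enum j)
    ... | yes (i , eq′) = eq′
    ... | no none = contradiction (index y , trans (^-congˡ k (enum-index y)) eq) none

  -- A k-th root that depends only on the class of a; it is junk unless a is a k-th power.
  root : Carrier → Carrier
  root a = rootAt (index a)

  root-cong : ∀ {a b} → a ≈ b → root a ≈ root b
  root-cong a≈b = reflexive (≡.cong rootAt (index-cong a≈b))

  root-^ : ∀ {a} → Pow a → root a ^ k ≈ a
  root-^ {a} (y , eq) = trans (rootAt-^ (index a) (y , trans eq (sym (enum-index a)))) (enum-index a)

  Lower : ∀ {n} → Mat n → Set ℓ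
  Lower L = ∀ i j → toℕ i < toℕ j → L i j ≈ 0#

  Lower-* : ∀ {n} {A B : Mat n} → Lower A → Lower B → Lower (A *M B)
  Lower-* {n} {A} {B} lA lB i j i<j = ∑-zero n vanish
    where
    vanish : ∀ t → A i t * B t j ≈ 0#
    vanish t with toℕ i ℕ.<? toℕ t
    ... | yes i<t = trans (*-congʳ (lA i t i<t)) (zeroˡ _)
    ... | no i≮t = trans (*-congˡ (lB t j (ℕₚ.≤-<-trans (ℕₚ.≮⇒≥ i≮t) i<j))) (zeroʳ _)

  Lower-*-diagonal : ∀ {n} {A B : Mat n} → Lower A → Lower B → ∀ i → (A *M B) i i ≈ A i i * B i i
  Lower-*-diagonal {n} {A} {B} lA lB i = ∑-single n (λ t → A i t * B t i) i vanish
    where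
    vanish : ∀ t → t ≢ i → A i t * B t i ≈ 0#
    vanish t t≢i with ℕₚ.<-cmp (toℕ t) (toℕ i)
    ... | tri< t<i _ _ = trans (*-congˡ (lB t i t<i)) (zeroʳ _)
    ... | tri≈ _ t≡i _ = contradiction (toℕ-injective t≡i) t≢i
    ... | tri> _ _ i<t = trans (*-congʳ (lA i t i<t)) (zeroˡ _)

  forward-substitution : ∀ n (S : Mat n) → Lower S → (∀ i → ¬ S i i ≈ 0#) → ∀ (v : Fin n → Carrier) → ∃ λ (w : Fin n → Carrier) → ∀ i → ∑ n (λ j → S i j * w j) ≈ v i
  forward-substitution zero S lS ≉0 v = (λ ()) , λ ()
  forward-substitution (suc n) S lS ≉0 v with inverse (S zero zero) (≉0 zero)
  ... | σ , Sσ≈1 with forward-substitution n (minor S) (λ i j i<j → lS (suc i) (suc j) (s≤s i<j)) (≉0 ∘ suc) (λ i → v (suc i) - S (suc i) zero * (σ * v zero))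
  ... | w , eq = w′ , solves
    where
    w′ : Fin (suc n) → Carrier
    w′ zero = σ * v zero
    w′ (suc i) = w i
    solves : ∀ i → ∑ (suc n) (λ j → S i j * w′ j) ≈ v i
    solves zero = begin
      S zero zero * (σ * v zero) + ∑ n (λ j → S zero (suc j) * w j)
        ≈⟨ +-cong (sym (*-assoc _ _ _)) (∑-zero n (λ j → trans (*-congʳ (lS zero (suc j) (s≤s z≤n))) (zeroˡ _))) ⟩
      S zero zero * σ * v zero + 0# ≈⟨ trans (+-identityʳ _) (trans (*-congʳ Sσ≈1) (*-identityˡ _)) ⟩
      v zero ∎
    solves (suc i) = begin
      S (suc i) zero * (σ * v zero) + ∑ n (λ j → S (suc i) (suc j) * w j) ≈⟨ +-congˡ (eq i) ⟩
      S (suc i) zero * (σ * v zero) + (v (suc i) - S (suc i) zero * (σ * v zero)) ≈⟨ solve 2 (λ a b → a :+ (b :- a) := b) refl _ _ ⟩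
      v (suc i) ∎

  -- σ z x t = z^(t−1) + z^(t−2) x + ⋯ + x^(t−1).
  σ : Carrier → Carrier → ℕ → Carrier
  σ z x zero = 0#
  σ z x (suc t) = x ^ t + z * σ z x t

  σ-telescope : ∀ z x t → (z - x) * σ z x t ≈ z ^ t - x ^ t
  σ-telescope z x zero = solve 2 (λ z x → (z :- x) :* con (0 , 0) := con (1 , 0) :- con (1 , 0)) refl z x
  σ-telescope z x (suc t) = begin
    (z - x) * (x ^ t + z * σ z x t)
      ≈⟨ solve 4 (λ z x X S → (z :- x) :* (X :+ z :* S) := z :* X :- x :* X :+ z :* ((z :- x) :* S)) refl z x (x ^ t) (σ z x t) ⟩
    z * x ^ t - x * x ^ t + z * ((z - x) * σ z x t) ≈⟨ +-congˡ (*-congˡ (σ-telescope z x t)) ⟩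
    z * x ^ t - x * x ^ t + z * (z ^ t - x ^ t)
      ≈⟨ solve 4 (λ z x X Z → z :* X :- x :* X :+ z :* (Z :- X) := z :* Z :- x :* X) refl z x (x ^ t) (z ^ t) ⟩
    z * z ^ t - x * x ^ t ∎

  σ-equal : ∀ {z x} → z ≈ x → ∀ t → z * σ z x t ≈ t · x ^ t
  σ-equal {z} z≈x zero = zeroʳ z
  σ-equal {z} {x} z≈x (suc t) = begin
    z * (x ^ t + z * σ z x t) ≈⟨ *-cong z≈x (+-congˡ (σ-equal z≈x t)) ⟩
    x * (x ^ t + t · x ^ t) ≈⟨ distribˡ _ _ _ ⟩
    x * x ^ t + x * (t · x ^ t) ≈⟨ +-congˡ (×-comm-* t x (x ^ t)) ⟩
    x ^ suc t + t · x ^ suc t ∎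

  -- If σ vanished, telescoping would give z^k = x^k, hence z = x. But then zσ is the k-fold
  -- multiple of x^k, which is nonzero.
  σ-nonzero : ¬ k · 1# ≈ 0# → ∀ {z x} → ¬ z ≈ 0# → (z ^ k ≈ x ^ k → z ≈ x) → ¬ σ z x k ≈ 0#
  σ-nonzero k≉0 {z} {x} z≉0 inj σ≈0 = *-nonzero k≉0 (^-nonzero k x≉0) (begin
    (k · 1#) * x ^ k ≈⟨ ×-assoc-* k 1# (x ^ k) ⟩
    k · (1# * x ^ k) ≈⟨ ×-congʳ k (*-identityˡ _) ⟩
    k · x ^ k ≈⟨ σ-equal z≈x k ⟨
    z * σ z x k ≈⟨ trans (*-congˡ σ≈0) (zeroʳ z) ⟩
    0# ∎)
    where
    z≈x : z ≈ x
    z≈x = inj (x∙y⁻¹≈ε⇒x≈y _ _ (trans (sym (σ-telescope z x k)) (trans (*-congˡ σ≈0) (zeroʳ _))))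
    x≉0 : ¬ x ≈ 0#
    x≉0 x≈0 = z≉0 (trans z≈x x≈0)

  module Bordered {n : ℕ} (X : Mat n) (x : Carrier) (w : Fin n → Carrier) where

    bordered : Mat (suc n)
    bordered zero zero = x
    bordered zero (suc j) = 0#
    bordered (suc i) zero = w i
    bordered (suc i) (suc j) = X i j

    -- The sum of x^(t-1-r) X^r over r < t. The border w enters the t-th power linearly, through
    -- this matrix.
    S : ℕ → Mat n
    S zero i j = 0#
    S (suc t) i j = x ^ t * idM i j + (X *M S t) i j

    ^M-corner : ∀ t → (bordered ^M t) zero zero ≈ x ^ t
    ^M-corner zero = refl
    ^M-corner (suc t) = trans (+-cong (*-congˡ (^M-corner t)) (∑-zero n (λ _ → zeroˡ _))) (+-identityʳ _)

    ^M-row : ∀ t j → (bordered ^M t) zero (suc j) ≈ 0#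
    ^M-row zero j = refl
    ^M-row (suc t) j = trans (+-cong (trans (*-congˡ (^M-row t j)) (zeroʳ x)) (∑-zero n (λ _ → zeroˡ _))) (+-identityʳ 0#)

    ^M-minor : ∀ t i j → (bordered ^M t) (suc i) (suc j) ≈ (X ^M t) i j
    ^M-minor zero i j = refl
    ^M-minor (suc t) i j = trans (+-cong (trans (*-congˡ (^M-row t j)) (zeroʳ _)) (∑-cong n (λ r → *-congˡ (^M-minor t r j)))) (+-identityˡ _)

    ^M-column : ∀ t i → (bordered ^M t) (suc i) zero ≈ ∑ n (λ j → S t i j * w j)
    ^M-column zero i = sym (∑-zero n (λ j → zeroˡ _))
    ^M-column (suc t) i = begin
      w i * (bordered ^M t) zero zero + ∑ n (λ r → X i r * (bordered ^M t) (suc r) zero)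
        ≈⟨ +-cong (*-congˡ (^M-corner t)) (∑-cong n (λ r → trans (*-congˡ (^M-column t r)) (sym (∑-*ˡ n (X i r) _)))) ⟩
      w i * x ^ t + ∑ n (λ r → ∑ n (λ j → X i r * (S t r j * w j))) ≈⟨ +-cong (*-comm _ _) (∑-swap n n (λ r j → X i r * (S t r j * w j))) ⟩
      x ^ t * w i + ∑ n (λ j → ∑ n (λ r → X i r * (S t r j * w j)))
        ≈⟨ +-cong (*-congˡ (sym (∑-idˡ n i w))) (∑-cong n (λ j → trans (∑-cong n (λ r → sym (*-assoc _ _ _))) (∑-*ʳ n (w j) _))) ⟩
      x ^ t * ∑ n (λ j → idM i j * w j) + ∑ n (λ j → (X *M S t) i j * w j) ≈⟨ +-congʳ (∑-*ˡ n (x ^ t) (λ j → idM i j * w j)) ⟨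
      ∑ n (λ j → x ^ t * (idM i j * w j)) + ∑ n (λ j → (X *M S t) i j * w j) ≈⟨ ∑-+ n _ _ ⟨
      ∑ n (λ j → x ^ t * (idM i j * w j) + (X *M S t) i j * w j)
        ≈⟨ ∑-cong n (λ j → trans (+-congʳ (sym (*-assoc _ _ _))) (sym (distribʳ _ _ _))) ⟩
      ∑ n (λ j → S (suc t) i j * w j) ∎

    module _ (lX : Lower X) where
      S-lower : ∀ t → Lower (S t)
      S-lower zero i j i<j = refl
      S-lower (suc t) i j i<j = trans (+-cong (trans (*-congˡ (reflexive (idM-off i j λ { ≡.refl → ℕₚ.<-irrefl ≡.refl i<j }))) (zeroʳ _))
        (Lower-* {A = X} {S t} lX (S-lower t) i j i<j)) (+-identityʳ 0#)

      S-diagonal : ∀ t i → S t i i ≈ σ (X i i) x t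
      S-diagonal zero i = refl
      S-diagonal (suc t) i = +-cong (trans (*-congˡ (reflexive (idM-diagonal i))) (*-identityʳ _))
        (trans (Lower-*-diagonal {A = X} {S t} lX (S-lower t) i) (*-congˡ (S-diagonal t i)))

  module _ (k≉0 : ¬ k · 1# ≈ 0#) where

    -- A root of the minor is bordered by a column w that solves the triangular system S w = (first
    -- column of L), whose diagonal consists of values of σ. These are nonzero since equal diagonal
    -- entries receive equal roots. A zero is harmless only as the corner x; the minor must have a
    -- nonzero diagonal.
    lower-root : ∀ n (L : Mat n) → Lower L → (∀ i → Pow (L i i)) → (∀ i → 0 < toℕ i → ¬ L i i ≈ 0#) →
      ∃ λ X → Lower X × (∀ i → X i i ≈ root (L i i)) × (X ^M k) ≈M L
    lower-root zero L lL pow ≉0 = L , lL , (λ ()) , λ ()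
    lower-root (suc n) L lL pow ≉0 = border (lower-root n (minor L) (λ i j i<j → lL (suc i) (suc j) (s≤s i<j)) (pow ∘ suc) (λ i _ → ≉0 (suc i) (s≤s z≤n)))
      where
      x = root (L zero zero)
      border : (∃ λ X → Lower X × (∀ i → X i i ≈ root (L (suc i) (suc i))) × (X ^M k) ≈M minor L) →
               ∃ λ X → Lower X × (∀ i → X i i ≈ root (L i i)) × (X ^M k) ≈M L
      border (X , lX , dX , X^k) = assemble (forward-substitution n S₀ (B₀.S-lower lX k) S₀≉0 (λ i → L (suc i) zero))
        where
        -- The system has to be formed before w is known. As `S` does not depend on w, the zero
        -- column serves as a placeholder.
        module B₀ = Bordered X x (λ _ → 0#)
        S₀ = B₀.S k
        S₀≉0 : ∀ i → ¬ S₀ i i ≈ 0#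
        S₀≉0 i eq = σ-nonzero k≉0 {X i i} {x} X≉0 same-root (trans (sym (B₀.S-diagonal lX k i)) eq)
          where
          X^k≈ : X i i ^ k ≈ L (suc i) (suc i)
          X^k≈ = trans (^-congˡ k (dX i)) (root-^ (pow (suc i)))
          X≉0 : ¬ X i i ≈ 0#
          X≉0 X≈0 = ≉0 (suc i) (s≤s z≤n) (trans (sym X^k≈) (trans (*-congʳ X≈0) (zeroˡ _)))
          same-root : X i i ^ k ≈ x ^ k → X i i ≈ x
          same-root eq = trans (dX i) (root-cong (trans (sym X^k≈) (trans eq (root-^ (pow zero)))))
        S-independent : ∀ w t i j → Bordered.S X x w t i j ≈ B₀.S t i j
        S-independent w zero i j = refl
        S-independent w (suc t) i j = +-congˡ (∑-cong n (λ r → *-congˡ (S-independent w t r j)))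
        assemble : (∃ λ (w : Fin n → Carrier) → ∀ i → ∑ n (λ j → S₀ i j * w j) ≈ L (suc i) zero) →
                   ∃ λ X → Lower X × (∀ i → X i i ≈ root (L i i)) × (X ^M k) ≈M L
        assemble (w , solves) = bordered , lower , diagonal , power
          where
          open Bordered X x w
          lower : Lower bordered
          lower zero (suc j) _ = refl
          lower (suc i) (suc j) (s≤s i<j) = lX i j i<j
          diagonal : ∀ i → bordered i i ≈ root (L i i)
          diagonal zero = refl
          diagonal (suc i) = dX i
          power : (bordered ^M k) ≈M L
          power zero zero = trans (^M-corner k) (root-^ (pow zero))
          power zero (suc j) = trans (^M-row k j) (sym (lL zero (suc j) (s≤s z≤n)))
          power (suc i) zero = trans (^M-column k i) (trans (∑-cong n (λ j → *-congʳ (S-independent w k i j))) (solves i))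
          power (suc i) (suc j) = trans (^M-minor k i j) (X^k i j)

-- Nonscalar matrices

module Nonscalar {c ℓ} (F : CommutativeRing c ℓ) {q : ℕ} (isFF : IsFiniteField F q) (k-1 : ℕ) where
  open CommutativeRing F hiding (zero)
  open FiniteField F isFF using (1≉0)
  open Moments F isFF k-1 using (k; Pow; Pow-0; Pow-1; Pow-resp; s; h)
  open EightPowers F isFF k-1 using (Sum⁺; nil; cons; Sum⁺-resp; Sum⁺-+; eight-powers)
  open TriangularRoots F isFF k-1 using (Lower; lower-root)
  open PrescribedDiagonal F isFF using (Scalar; prescribe-diagonal)
  open Matrices F
  open MatrixAlgebra F
  open Solver F
  open import Algebra.Properties.Semiring.Mult semiring using (×-homo-+; ×1-homo-*) renaming (_×_ to _·_)
  open import Relation.Binary.Reasoning.Setoid setoid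

  -- Reduce k modulo p. The remainder is 1 or 2, and 1 + 1 = 0 together with 1 + 1 + 1 = 0 would
  -- give 1 = 0.
  multiple-nonzero : ∀ p → p ≡ 2 ⊎ p ≡ 3 → p · 1# ≈ 0# → ∀ k → ¬ p ∣ k → ¬ k · 1# ≈ 0#
  multiple-nonzero p 2∨3 p≈0 k p∤k k≈0 = by-cases 2∨3
    where
    residue : ∀ p .{{_ : ℕ.NonZero p}} → p · 1# ≈ 0# → (k % p) · 1# ≈ 0#
    residue p p≈0 = begin
      (k % p) · 1# ≈⟨ +-identityʳ _ ⟨
      (k % p) · 1# + 0# ≈⟨ +-congˡ (trans (×1-homo-* (k / p) p) (trans (*-congˡ p≈0) (zeroʳ _))) ⟨
      (k % p) · 1# + (k / p ℕ.* p) · 1# ≈⟨ ×-homo-+ 1# (k % p) (k / p ℕ.* p) ⟨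
      (k % p ℕ.+ k / p ℕ.* p) · 1# ≡⟨ ≡.cong (_· 1#) (m≡m%n+[m/n]*n k p) ⟨
      k · 1# ≈⟨ k≈0 ⟩
      0# ∎
    small : ∀ r → r < 3 → 3 · 1# ≈ 0# → r · 1# ≈ 0# → r ≡ 0
    small 0 _ _ _ = ≡.refl
    small 1 _ _ r≈0 = contradiction (trans (sym (+-identityʳ 1#)) r≈0) 1≉0
    small 2 _ 3≈0 r≈0 = contradiction (trans (sym (trans (+-congˡ r≈0) (+-identityʳ 1#))) 3≈0) 1≉0
    small (suc (suc (suc r))) (s≤s (s≤s (s≤s ()))) _ _
    even : ∀ r → r < 2 → r · 1# ≈ 0# → r ≡ 0
    even 0 _ _ = ≡.refl
    even 1 _ r≈0 = contradiction (trans (sym (+-identityʳ 1#)) r≈0) 1≉0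
    even (suc (suc r)) (s≤s (s≤s ())) _
    by-cases : p ≡ 2 ⊎ p ≡ 3 → _
    by-cases (inj₁ ≡.refl) = p∤k (m%n≡0⇒n∣m k 2 (even (k % 2) (m%n<n k 2) (residue 2 p≈0)))
    by-cases (inj₂ ≡.refl) = p∤k (m%n≡0⇒n∣m k 3 (small (k % 3) (m%n<n k 3) p≈0 (residue 3 p≈0)))

  ones : ∀ m → Sum⁺ m (m · 1#)
  ones zero = nil refl
  ones (suc m) = cons Pow-1 1≉0 (ones m) refl

  -- The terms a and b, which may be 0, become the corners of the two triangular summands.
  Ends : ℕ → Carrier → Set _
  Ends m t = ∃₂ λ a b → Pow a × Pow b × ∃ λ r → Sum⁺ m r × a + (b + r) ≈ t

  ends : ∀ m t j gap → gap ≤ 2 → j ℕ.+ gap ≡ 2 ℕ.+ m → Sum⁺ j t → Ends m t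
  ends m t j 0 _ eq ps with ≡.trans (≡.sym (ℕₚ.+-identityʳ j)) eq
  ends m t .(suc (suc m)) 0 _ eq (cons {a = a} pa _ (cons {a = b} pb _ qs eq″) eq′) | ≡.refl =
    a , b , pa , pb , _ , qs , trans (+-congˡ eq″) eq′
  ends m t j 1 _ eq ps with ℕₚ.suc-injective (≡.trans (≡.sym (ℕₚ.+-comm j 1)) eq)
  ends m t .(suc m) 1 _ eq (cons {a = a} pa _ qs eq′) | ≡.refl = a , 0# , pa , Pow-0 , _ , qs , trans (+-congˡ (+-identityˡ _)) eq′
  ends m t j 2 _ eq ps with ℕₚ.suc-injective (ℕₚ.suc-injective (≡.trans (≡.sym (ℕₚ.+-comm j 2)) eq))
  ... | ≡.refl = 0# , 0# , Pow-0 , Pow-0 , t , ps , trans (+-identityˡ _) (+-identityˡ _)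
  ends m t j (suc (suc (suc gap))) (s≤s (s≤s ())) _ _

  split : ∀ m {m′ t} → Sum⁺ (m ℕ.+ m′) t → ∃₂ λ t₁ t₂ → Sum⁺ m t₁ × Sum⁺ m′ t₂ × t₁ + t₂ ≈ t
  split zero {t = t} ps = 0# , t , nil refl , ps , +-identityˡ t
  split (suc m) (cons {a = a} pa a≉0 ps eq) = let t₁ , t₂ , ps₁ , ps₂ , eq′ = split m ps in
    a + t₁ , t₂ , cons pa a≉0 ps₁ refl , ps₂ , trans (+-assoc _ _ _) (trans (+-congˡ eq′) eq)

  Terms : ℕ → Carrier → Set _
  Terms m t = ∃ λ (f : Fin m → Carrier) → (∀ i → Pow (f i)) × (∀ i → ¬ f i ≈ 0#) × ∑ m f ≈ t

  terms : ∀ {m t} → Sum⁺ m t → Terms m t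
  terms (nil t≈0) = (λ ()) , (λ ()) , (λ ()) , sym t≈0
  terms (cons {n = m} {a = a} pa a≉0 ps eq) = let f , pf , f≉0 , ∑f = terms ps in
    (λ { zero → a ; (suc i) → f i }) , (λ { zero → pa ; (suc i) → pf i }) , (λ { zero → a≉0 ; (suc i) → f≉0 i }) , trans (+-congˡ ∑f) eq

  Diagonals : ℕ → Carrier → Set _
  Diagonals m t = ∃₂ λ (λs μs : Fin (suc m) → Carrier) → (∀ i → Pow (λs i)) × (∀ i → Pow (μs i)) ×
    (∀ i → 0 < toℕ i → ¬ λs i ≈ 0#) × (∀ i → 0 < toℕ i → ¬ μs i ≈ 0#) × ∑ (suc m) (λ i → λs i + μs i) ≈ t

  module _ (p : ℕ) (2∨3 : p ≡ 2 ⊎ p ≡ 3) (p≈0 : p · 1# ≈ 0#) where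

    pad-once : ∀ {j t} → Sum⁺ j t → Sum⁺ (p ℕ.+ j) t
    pad-once ps = Sum⁺-resp (trans (+-congʳ p≈0) (+-identityˡ _)) (Sum⁺-+ (ones p) ps)

    Padded : ℕ → Carrier → Set _
    Padded total t = ∃₂ λ j gap → gap ≤ 2 × j ℕ.+ gap ≡ total × Sum⁺ j t

    -- While the gap is at least 3, p more ones fit in without overshooting; the process stops at a
    -- gap of at most 2, to be filled by zeros.
    pad : ∀ gap {j t} → Sum⁺ j t → Padded (j ℕ.+ gap) t
    pad 0 {j} ps = j , 0 , z≤n , ≡.refl , ps
    pad 1 {j} ps = j , 1 , s≤s z≤n , ≡.refl , ps
    pad 2 {j} ps = j , 2 , s≤s (s≤s z≤n) , ≡.refl , ps
    pad (suc (suc (suc gap))) {j} {t} ps = by-cases 2∨3 (pad (suc gap)) (pad gap)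
      where
      move : ∀ p g → p ℕ.+ j ℕ.+ g ≡ j ℕ.+ (p ℕ.+ g)
      move p g = ≡.trans (≡.cong (ℕ._+ g) (ℕₚ.+-comm p j)) (ℕₚ.+-assoc j p g)
      by-cases : p ≡ 2 ⊎ p ≡ 3 → (∀ {j} → Sum⁺ j t → Padded (j ℕ.+ suc gap) t) → (∀ {j} → Sum⁺ j t → Padded (j ℕ.+ gap) t) →
                 Padded (j ℕ.+ (3 ℕ.+ gap)) t
      by-cases (inj₁ ≡.refl) pad₂ _ = ≡.subst (λ total → Padded total t) (move 2 (suc gap)) (pad₂ (pad-once ps))
      by-cases (inj₂ ≡.refl) _ pad₃ = ≡.subst (λ total → Padded total t) (move 3 gap) (pad₃ (pad-once ps))

    diagonals : s ≤ h ℕ.* h → ∀ m → 3 ≤ m → ∀ t → Diagonals m t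
    diagonals s≤hh m 3≤m t = from-sum (eight-powers s≤hh t)
      where
      from-terms : ∀ {a b r₁ r₂} → Pow a → Pow b → Terms m r₁ → Terms m r₂ → a + (b + (r₁ + r₂)) ≈ t → Diagonals m t
      from-terms {a} {b} {r₁} {r₂} pa pb (f , pf , f≉0 , ∑f) (g , pg , g≉0 , ∑g) eq =
        λs , μs , (λ { zero → pa ; (suc i) → pf i }) , (λ { zero → pb ; (suc i) → pg i }) ,
        (λ { (suc i) _ → f≉0 i }) , (λ { (suc i) _ → g≉0 i }) , (begin
          a + b + ∑ m (λ i → f i + g i) ≈⟨ +-congˡ (trans (∑-+ m f g) (+-cong ∑f ∑g)) ⟩
          a + b + (r₁ + r₂) ≈⟨ trans (+-assoc _ _ _) eq ⟩
          t ∎)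
        where
        λs μs : Fin (suc m) → Carrier
        λs zero = a
        λs (suc i) = f i
        μs zero = b
        μs (suc i) = g i
      from-ends : Ends (m ℕ.+ m) t → Diagonals m t
      from-ends (a , b , pa , pb , r , ps , eq) = let r₁ , r₂ , ps₁ , ps₂ , eq′ = split m ps in
        from-terms pa pb (terms ps₁) (terms ps₂) (trans (+-congˡ (+-congˡ eq′)) eq)
      from-sum : (∃ λ j → j ≤ 8 × Sum⁺ j t) → Diagonals m t
      from-sum (j , j≤8 , ps) = let j′ , gap , gap≤2 , eq , ps′ = pad (2 ℕ.+ (m ℕ.+ m) ℕ.∸ j) ps in
        -- Both diagonals together have 2 + 2m ≥ 8 places, so eight terms always fit. This is where
        -- the size must exceed 3.
        from-ends (ends (m ℕ.+ m) t j′ gap gap≤2 (≡.trans eq (ℕₚ.m+[n∸m]≡n (ℕₚ.≤-trans j≤8 (s≤s (s≤s (ℕₚ.+-mono-≤ 3≤m 3≤m)))))) ps′)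

  -- Write D = L + Uᵀ with L and U both lower triangular, the diagonal being shared as λ + μ.
  -- Transposition commutes with powers, so lower triangular roots suffice.
  prescribed-sum : ¬ k · 1# ≈ 0# → ∀ {n} (D : Mat n) (λs μs : Fin n → Carrier) → (∀ i → Pow (λs i)) → (∀ i → Pow (μs i)) →
    (∀ i → 0 < toℕ i → ¬ λs i ≈ 0#) → (∀ i → 0 < toℕ i → ¬ μs i ≈ 0#) → (∀ i → D i i ≈ λs i + μs i) →
    ∃₂ λ (A B : Mat n) → ((A ^M k) +M (B ^M k)) ≈M D
  prescribed-sum k≉0 {n} D λs μs pλ pμ λ≉0 μ≉0 diagonal = add-roots
    (lower-root k≉0 n L L-lower (λ i → Pow-resp (sym (L-diagonal i)) (pλ i)) (λ i 0<i eq → λ≉0 i 0<i (trans (sym (L-diagonal i)) eq)))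
    (lower-root k≉0 n U U-lower (λ i → Pow-resp (sym (U-diagonal i)) (pμ i)) (λ i 0<i eq → μ≉0 i 0<i (trans (sym (U-diagonal i)) eq)))
    where
    L U : Mat n
    L i j with ℕₚ.<-cmp (toℕ i) (toℕ j)
    ... | tri< _ _ _ = 0#
    ... | tri≈ _ _ _ = λs i
    ... | tri> _ _ _ = D i j
    U i j = D j i - L j i
    L-lower : Lower L
    L-lower i j i<j with ℕₚ.<-cmp (toℕ i) (toℕ j)
    ... | tri< _ _ _ = refl
    ... | tri≈ i≮j _ _ = contradiction i<j i≮j
    ... | tri> i≮j _ _ = contradiction i<j i≮j
    L-diagonal : ∀ i → L i i ≈ λs i
    L-diagonal i with ℕₚ.<-cmp (toℕ i) (toℕ i)
    ... | tri< _ i≢i _ = contradiction ≡.refl i≢i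
    ... | tri≈ _ _ _ = refl
    ... | tri> _ i≢i _ = contradiction ≡.refl i≢i
    U-lower : Lower U
    U-lower i j i<j with ℕₚ.<-cmp (toℕ j) (toℕ i)
    ... | tri< _ _ i≮j = contradiction i<j i≮j
    ... | tri≈ _ _ i≮j = contradiction i<j i≮j
    ... | tri> _ _ _ = -‿inverseʳ _
    U-diagonal : ∀ i → U i i ≈ μs i
    U-diagonal i = trans (+-cong (diagonal i) (-‿cong (L-diagonal i))) (solve 2 (λ a b → a :+ b :- a := b) refl (λs i) (μs i))
    add-roots : (∃ λ X → Lower X × _ × (X ^M k) ≈M L) → (∃ λ Y → Lower Y × _ × (Y ^M k) ≈M U) →
              ∃₂ λ (A B : Mat n) → ((A ^M k) +M (B ^M k)) ≈M D
    add-roots (X , _ , _ , X^k) (Y , _ , _ , Y^k) = X , (Y ᵀ) , λ i j → begin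
      (X ^M k) i j + ((Y ᵀ) ^M k) i j ≈⟨ +-cong (X^k i j) (trans (ᵀ-^ Y k i j) (Y^k j i)) ⟩
      L i j + (D i j - L i j) ≈⟨ solve 2 (λ l d → l :+ (d :- l) := d) refl (L i j) (D i j) ⟩
      D i j ∎

  similar-sum : ∀ {n} {C D : Mat n} → Similar C D → (∃₂ λ (A B : Mat n) → ((A ^M k) +M (B ^M k)) ≈M D) →
    ∃₂ λ (A B : Mat n) → ((A ^M k) +M (B ^M k)) ≈M C
  similar-sum {C = C} {D} (T , eq) (A , B , sum) = conj (inv T) A , conj (inv T) B , λ i j → begin
    (conj (inv T) A ^M k) i j + (conj (inv T) B ^M k) i j ≈⟨ +-cong (conj-^ (inv T) A k i j) (conj-^ (inv T) B k i j) ⟩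
    conj (inv T) (A ^M k) i j + conj (inv T) (B ^M k) i j ≈⟨ conj-+ (inv T) (A ^M k) (B ^M k) i j ⟨
    conj (inv T) ((A ^M k) +M (B ^M k)) i j ≈⟨ conj-cong (inv T) (≈M-trans sum (≈M-sym eq)) i j ⟩
    conj (inv T) (conj T C) i j ≈⟨ conj-inv T C i j ⟩
    C i j ∎

  nonscalar-sum : ∀ p → p ≡ 2 ⊎ p ≡ 3 → p · 1# ≈ 0# → ¬ k · 1# ≈ 0# → s ≤ h ℕ.* h →
    ∀ m → 3 ≤ m → ∀ (C : Mat (suc m)) → ¬ Scalar C → ∃₂ λ (A B : Mat (suc m)) → ((A ^M k) +M (B ^M k)) ≈M C
  nonscalar-sum p 2∨3 p≈0 k≉0 s≤hh m 3≤m C nonscalar = from-diagonals (diagonals p 2∨3 p≈0 s≤hh m 3≤m (tr C))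
    where
    from-diagonals : Diagonals m (tr C) → ∃₂ λ (A B : Mat (suc m)) → ((A ^M k) +M (B ^M k)) ≈M C
    from-diagonals (λs , μs , pλ , pμ , λ≉0 , μ≉0 , ∑≈tr) = from-similar (prescribe-diagonal m C (inj₂ nonscalar) (λ i → λs i + μs i) ∑≈tr)
      where
      from-similar : (∃ λ D → Similar C D × (∀ i → D i i ≈ λs i + μs i)) → ∃₂ λ (A B : Mat (suc m)) → ((A ^M k) +M (B ^M k)) ≈M C
      from-similar (D , sim , diagonal) = similar-sum {C = C} {D} sim (prescribed-sum k≉0 D λs μs pλ pμ λ≉0 μ≉0 diagonal)

-- Scalar and nonscalar matrices combined

open import Data.Nat using (_*_; _∸_; _^_; _>_; _≥_)

theorem1p15 : ∀ {c ℓ} (F : CommutativeRing c ℓ) (p l q n k : ℕ)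
    → Prime p → q ≡ p ^ l → IsFiniteField F q
    → n ≥ 2 → k ≥ 1
    → gcd k (q ∸ 1) * gcd k (q ∸ 1) < q
    → ¬ (p ∣ k)
    → (p ≡ 2 ⊎ p ≡ 3)
    → n > 3
    → (k ∸ 1) ^ 4 < q ^ n
    → let open Matrices F in
    ∀ (C : Mat n) → ∃₂ λ (A B : Mat n) → ((A ^M k) +M (B ^M k)) ≈M C
theorem1p15 F p l q (suc n-1) (suc k-1) _ q≡p^l isFF _ _ d²<q p∤k 2∨3 (s≤s 3≤n-1) k-1⁴<q^n C =
  by-cases (all? λ i → all? λ j → C i j ≟ (C zero zero F.* idM i j))
  where
  module F = CommutativeRing F
  open FiniteField F isFF using (_≟_)
  open Matrices F
  open PrescribedDiagonal F isFF using (Scalar)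
  open Extension F isFF using (characteristic; extension)
  open Moments F isFF k-1 using (s; q≡1+s)
  open EightPowers F isFF k-1 using (s≤h²)
  open Nonscalar F isFF k-1 using (nonscalar-sum; multiple-nonzero)
  open +-*-Solver using (solve; con; _:*_; _:=_)
  p≈0 = characteristic p l q≡p^l
  -- The logarithmic bound on n in exponentiated form. For k = 1 it reads 0 < q^n, in accordance
  -- with ln(0) = -∞.
  fourth-power : k-1 * k-1 * (k-1 * k-1) < q ^ suc n-1
  fourth-power = ≡.subst (_< q ^ suc n-1)
    (solve 1 (λ x → x :* (x :* (x :* (x :* con 1))) := x :* x :* (x :* x)) ≡.refl k-1) k-1⁴<q^n
  d²<q′ : gcd (suc k-1) s * gcd (suc k-1) s < q
  d²<q′ = ≡.subst (λ s → gcd (suc k-1) s * gcd (suc k-1) s < q) (≡.cong ℕ.pred q≡1+s) d²<q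
  by-cases : Dec (Scalar C) → ∃₂ λ (A B : Mat (suc n-1)) → ((A ^M suc k-1) +M (B ^M suc k-1)) ≈M C
  by-cases (yes scalar) =
    let A , B , eq = Representation.scalar-sum F isFF (extension p l q≡p^l 2∨3 n-1) k-1 fourth-power (C zero zero)
    in A , B , λ i j → F.trans (eq i j) (F.sym (scalar i j))
  by-cases (no nonscalar) =
    nonscalar-sum p 2∨3 p≈0 (multiple-nonzero p 2∨3 p≈0 (suc k-1) p∤k) (s≤h² d²<q′) n-1 3≤n-1 C nonscalar
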